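{- Let $\rho: W_F\to \mathrm{GL}_2(\overline{\mathbb{Q}}_\ell)$ be a nonexceptional supercuspidal representation such that $\rho(W_F)\subset \mathrm{GL}_2(\mathcal{O}_K)$. Then $\rho\cong \mathrm{Ind}_{W_E}^{W_F}\xi$, where $\xi$ is a $1$-dimensional representation of $W_E$ such that $\xi\neq\xi^\sigma$. Using Iwasawa decomposition, assume without loss of generality that there exists an upper triangular matrix $U=\begin{pmatrix} a& b\\ 0& d\end{pmatrix}\in \mathrm{GL}_2(K)$ such that $\rho(g)=U\,\mathrm{Ind}_{W_E}^{W_F}\xi(g)\,U^{ -1}$ for all $g\in W_F$. Let $i$ be the maximal nonnegative integer such that $\xi(h)\equiv \xi^\sigma(h)\pmod{\lambda^i}$ for all $h\in W_E$. Then $\overline{\rho}$ is irreducible if and only if $\overline{\xi}\neq\overline{\xi}^\sigma$. If $\overline{\rho}$ is reducible, then: (i) If $d/a\in\mathcal{O}_K^\times$, then $\overline{\rho}$ is isomorphic to $\mathrm{Ind}_{W_E}^{W_F}\overline{\xi}$ and decomposes as $\overline{\theta}_1\oplus\overline{\theta}_2$, where, for $h\in W_E$, $\theta_1(h)=\theta_2(h)=\xi(h)$, $\theta_1(h\sigma)=\sqrt{\xi(\sigma^2)}\,\xi(h)$ and $\theta_2(h\sigma)=-\sqrt{\xi(\sigma^2)}\,\xi(h)$. (ii) If $d/a\in\lambda$, then $\overline{\rho}$ is decomposable if and only if $v(b/d)\geq 1-i$, or equivalently, if and only if $\overline{\rho}|_{W_E}$ is decomposable. When $\overline{\rho}$ is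 decomposable, it decomposes as $\overline{\theta}_1\oplus\overline{\theta}_2$, where, for $h\in W_E$, $\theta_1(h)=\xi(h)$, $\theta_1(h\sigma)=\frac{b}{a}\xi(\sigma h\sigma)$, $\theta_2(h)=\xi^\sigma(h)$ and $\theta_2(h\sigma)=-\frac{b}{a}\xi(\sigma h\sigma)$.
   Context: $p\neq\ell$ are odd primes. $F/\mathbb{Q}_p$ is a finite extension with Weil group $W_F$; $E/F$ is a quadratic extension with Weil group $W_E\subset W_F$ (index $2$), and $\sigma\in W_F\setminus W_E$ is a fixed representative of the nontrivial coset. $K/\mathbb{Q}_\ell$ is a finite extension with ring of integers $\mathcal{O}_K$, maximal ideal $\lambda$, and normalized valuation $v$ (a uniformizer has valuation $1$). Representations are continuous for the $\ell$-adic topology. A bar denotes reduction modulo $\lambda$: for $\rho$ with image in $\mathrm{GL}_2(\mathcal{O}_K)$, acting on the lattice $\Lambda=\mathcal{O}_K^2$, $\overline{\rho}$ is the induced action of $W_F$ on $\Lambda/\lambda\Lambda$, a $2$-dimensional vector space over the finite field $\mathcal{O}_K/\lambda$. $\sqrt{\xi(\sigma^2)}$ denotes a square root of $\xi(\sigma^2)$. For a character $\xi$ of $W_E$, $\xi^\sigma(h)=\xi(\sigma h\sigma^{ -1})$. $\mathrm{Ind}_{W_E}^{W_F}\xi$ denotes the induced representation, in the matrix form given for $h\in W_E$ by $$\mathrm{Ind}_{W_E}^{W_F}\xi(h)=\begin{pmatrix}\xi(h)&0\\0&\xi^\sigma(h)\end{pmatrix},\qquad \mathrm{Ind}_{W_E}^{W_F}\xi(h\sigma)=\begin{pmatrix}0&\xi(h)\\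 \xi(\sigma h\sigma)&0\end{pmatrix}.$$ A continuous representation $\rho$ of $W_F$ is called a nonexceptional supercuspidal representation if its associated Weil--Deligne representation has zero monodromy operator (i.e. $\rho$ is trivial on an open subgroup of the inertia group) and $\rho\cong \mathrm{Ind}_{W_E}^{W_F}\xi$ for some quadratic $E/F$ and some $1$-dimensional representation $\xi$ of $W_E$ with $\xi\ne\xi^\sigma$.
   Formalization: That irreducibility of ρ̄ over O_K/λ implies ξ̄ ≠ ξ̄^σ is proved assuming ξ(σ²) has a square root in K; without one it can fail (d/a a unit, ξ̄ = ξ̄^σ). The explicit θ₁, θ₂ in (i) are given for any such root, which exists in K when ρ̄ is reducible. -}

module Defs where

open import Level using (0ℓ)
open import Algebra.Bundles using (Group; CommutativeRing; Semiring)
open import Algebra.Morphism.Structures using (IsGroupMonomorphism; IsRingHomomorphism; IsRingIsomorphism)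
import Algebra.Definitions.RawSemiring as RawSemiringOps
import Algebra.Morphism.Construct.Composition as Compose
import Algebra.Morphism.Construct.Identity as Identity
import Algebra.Properties.AbelianGroup as AbelianGroupProperties
import Algebra.Properties.Group as GroupProperties
import Algebra.Properties.Ring as RingProperties
open import Data.Empty using (⊥-elim)
open import Data.Fin.Base using (Fin)
open import Data.Integer.Base as ℤ using (ℤ; +_; -[1+_])
import Data.Integer.Properties as ℤₚ
open import Data.List.Base using (List; []; _∷_; map)
open import Data.List.Relation.Unary.All using (All)
open import Data.Nat.Base as ℕ using (ℕ; suc; NonZero)
open import Data.Product.Base using (Σ; Σ-syntax; ∃; _×_; _,_; proj₁; proj₂)
open import Data.Sum.Base using (_⊎_; inj₁; inj₂)
open import Function.Base using (_∘_)
import Relation.Binary.Construct.Add.Supremum.NonStrict as Supremum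
import Relation.Binary.Reasoning.Setoid as SetoidReasoning
open import Relation.Binary.PropositionalEquality as ≡ using (_≡_; cong; subst)
open import Relation.Nullary.Construct.Add.Supremum using (_⁺; ⊤⁺; [_])
open import Relation.Nullary.Decidable.Core using (Dec; yes; no)
open import Relation.Nullary.Negation.Core using (¬_)

-- A field in the classical sense: equality is decidable.  The value of the
-- inverse at zero is unconstrained.
record Field : Set₁ where
  field
    commutativeRing : CommutativeRing 0ℓ 0ℓ
  open CommutativeRing commutativeRing public
  open RawSemiringOps (Semiring.rawSemiring semiring) public using (_^_; sum) renaming (_×_ to _⋅_)
  infix 4 _≟_
  infix 9 _⁻¹
  field
    _≟_        : ∀ x y → Dec (x ≈ y)
    1≉0        : ¬ (1# ≈ 0#)
    _⁻¹        : Carrier → Carrier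
    ⁻¹-cong    : ∀ {x y} → x ≈ y → x ⁻¹ ≈ y ⁻¹
    *-inverseʳ : ∀ {x} → ¬ (x ≈ 0#) → x * x ⁻¹ ≈ 1#

  fromℤ : ℤ → Carrier
  fromℤ (+ n)    = n ⋅ 1#
  fromℤ -[1+ n ] = - (suc n ⋅ 1#)

  -- The value at x of the monic polynomial
  -- c₀ + c₁ X + … + cₙ₋₁ Xⁿ⁻¹ + Xⁿ, given by the list c₀, …, cₙ₋₁.
  evalMonic : List Carrier → Carrier → Carrier
  evalMonic []       x = 1#
  evalMonic (c ∷ cs) x = c + x * evalMonic cs x

  x-y≈0⇒x≈y : ∀ {x y} → x - y ≈ 0# → x ≈ y
  x-y≈0⇒x≈y {x} {y} = GroupProperties.x∙y⁻¹≈ε⇒x≈y +-group x y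

  noZeroDivisors : ∀ {x y} → x * y ≈ 0# → ¬ (x ≈ 0#) → y ≈ 0#
  noZeroDivisors {x} {y} xy≈0 x≉0 = begin
    y                ≈⟨ *-identityˡ y ⟨
    1# * y           ≈⟨ *-congʳ (trans (*-comm _ _) (*-inverseʳ x≉0)) ⟨
    x ⁻¹ * x * y     ≈⟨ *-assoc _ _ _ ⟩
    x ⁻¹ * (x * y)   ≈⟨ *-congˡ xy≈0 ⟩
    x ⁻¹ * 0#        ≈⟨ zeroʳ _ ⟩
    0#               ∎
    where open SetoidReasoning setoid

record Embedding (k L : Field) : Set where
  private
    module k = Field k
    module L = Field L
  field
    ⟦_⟧                : k.Carrier → L.Carrier
    isRingHomomorphism : IsRingHomomorphism k.rawRing L.rawRing ⟦_⟧
  open IsRingHomomorphism isRingHomomorphism public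

record AlgebraicClosure (k : Field) : Set₁ where
  field
    Ω         : Field
    embedding : Embedding k Ω
  open Field Ω using (Carrier; _≈_; 0#; evalMonic)
  open Embedding embedding using (⟦_⟧)
  field
    algebraic : ∀ x → Σ[ cs ∈ List (Field.Carrier k) ] evalMonic (map ⟦_⟧ cs) x ≈ 0#
    closed    : ∀ c cs → Σ[ x ∈ Carrier ] evalMonic (c ∷ cs) x ≈ 0#

ℤ∞ : Set
ℤ∞ = ℤ ⁺

open Supremum ℤ._≤_ public using () renaming (_≤⁺_ to _≤∞_)

infixl 6 _+∞_
_+∞_ : ℤ∞ → ℤ∞ → ℤ∞
[ m ] +∞ [ n ] = [ m ℤ.+ n ]
_     +∞ _     = ⊤⁺

-- A normalized discrete valuation; the ultrametric inequality
-- v (x + y) ≥ min (v x) (v y) is expressed through lower bounds.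
record DiscreteValuation (K : Field) : Set where
  open Field K
  field
    v      : Carrier → ℤ∞
    v-cong : ∀ {x y} → x ≈ y → v x ≡ v y
    v-0    : v 0# ≡ ⊤⁺
    v-∞    : ∀ {x} → v x ≡ ⊤⁺ → x ≈ 0#
    v-*    : ∀ x y → v (x * y) ≡ v x +∞ v y
    v-+    : ∀ {n x y} → n ≤∞ v x → n ≤∞ v y → n ≤∞ v (x + y)
    v-π    : Σ[ π ∈ Carrier ] v π ≡ [ + 1 ]

  infix 4 _≡_mod𝔪^_
  _≡_mod𝔪^_ : Carrier → Carrier → ℕ → Set
  x ≡ y mod𝔪^ n = [ + n ] ≤∞ v (x - y)

  _∈𝒪 _∈𝔪 _∈𝒪ˣ : Carrier → Set
  x ∈𝒪  = [ + 0 ] ≤∞ v x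
  x ∈𝔪  = [ + 1 ] ≤∞ v x
  x ∈𝒪ˣ = v x ≡ [ + 0 ]

  IsCauchy : (ℕ → Carrier) → Set
  IsCauchy s = ∀ n → Σ[ N ∈ ℕ ] ∀ i j → N ℕ.≤ i → N ℕ.≤ j → s i ≡ s j mod𝔪^ n

  ConvergesTo : (ℕ → Carrier) → Carrier → Set
  ConvergesTo s x = ∀ n → Σ[ N ∈ ℕ ] ∀ i → N ℕ.≤ i → s i ≡ x mod𝔪^ n

-- ℚ_p as the completion of ℚ.  A valuation on ℚ with values in ℤ ∪ {∞} and
-- taking the value 1 at p is the p-adic one, since the integers of positive
-- valuation form a prime ideal of ℤ containing p.
record PAdicNumbers (p : ℕ) : Set₁ where
  field
    ℚₚ        : Field
    valuation : DiscreteValuation ℚₚ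
  open Field ℚₚ
  open DiscreteValuation valuation
  field
    v-p      : v (p ⋅ 1#) ≡ [ + 1 ]
    complete : ∀ s → IsCauchy s → Σ[ x ∈ Carrier ] ConvergesTo s x
    ℚ-dense  : ∀ x n → Σ[ a ∈ ℤ ] Σ[ b ∈ ℕ ] Σ[ y ∈ Carrier ]
                 NonZero b × (b ⋅ 1#) * y ≈ fromℤ a × x ≡ y mod𝔪^ n

record PAdicField (p : ℕ) : Set₁ where
  field
    base      : PAdicNumbers p
    𝔽         : Field
  open PAdicNumbers base using (ℚₚ) renaming (valuation to valuationₚ)
  field
    embedding : Embedding ℚₚ 𝔽
  open Field 𝔽 public
  private
    module ℚₚ = Field ℚₚ
    module vₚ = DiscreteValuation valuationₚ
  open Embedding embedding using (⟦_⟧)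
  field
    degreeBound : ℕ
    generator   : Fin degreeBound → Carrier
    generates   : ∀ x → Σ[ c ∈ (Fin degreeBound → ℚₚ.Carrier) ]
                    x ≈ sum (λ j → ⟦ c j ⟧ * generator j)
    valuation   : DiscreteValuation 𝔽
  open DiscreteValuation valuation public
  field
    ramification : ℕ
    v-extends    : ∀ {x n} → vₚ.v x ≡ [ n ] → v ⟦ x ⟧ ≡ [ + ramification ℤ.* n ]

  HasResidueCardinality : ℕ → Set
  HasResidueCardinality q =
    Σ[ t ∈ (Fin q → Carrier) ]
      (∀ i → t i ∈𝒪) ×
      (∀ x → x ∈𝒪 → ∃ λ i → x ≡ t i mod𝔪^ 1) ×
      (∀ i j → t i ≡ t j mod𝔪^ 1 → i ≡ j)

-- The residue ring 𝒪/𝔪: elements are those of 𝒪, equality is congruence.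
module _ {K : Field} (valuation : DiscreteValuation K) where
  open Field K hiding (refl; sym; trans)
  private
    module K = Field K
  open DiscreteValuation valuation
  open RingProperties ring using (-1*x≈-x; -‿distribˡ-*; -‿distribʳ-*)
  open AbelianGroupProperties +-abelianGroup using (⁻¹-∙-comm; ⁻¹-involutive; x≈y⇒x∙y⁻¹≈ε)
  open SetoidReasoning setoid

  private
    resp : ∀ {n x y} → x ≈ y → n ≤∞ v x → n ≤∞ v y
    resp {n} x≈y = subst (n ≤∞_) (v-cong x≈y)

    zero∈ : ∀ {n x} → x ≈ 0# → n ≤∞ v x
    zero∈ {n} x≈0 = resp (K.sym x≈0) (subst (n ≤∞_) (≡.sym v-0) (n Supremum.≤⊤⁺))

    +∞-mono : ∀ {m n : ℤ} a b → [ m ] ≤∞ a → [ n ] ≤∞ b → [ m ℤ.+ n ] ≤∞ a +∞ b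
    +∞-mono [ a ] [ b ] Supremum.[ m≤a ] Supremum.[ n≤b ] = Supremum.[ ℤₚ.+-mono-≤ m≤a n≤b ]
    +∞-mono [ a ] ⊤⁺    _ _ = _ Supremum.≤⊤⁺
    +∞-mono ⊤⁺    b     _ _ = _ Supremum.≤⊤⁺

    v-*-≥ : ∀ {m n x y} → [ m ] ≤∞ v x → [ n ] ≤∞ v y → [ m ℤ.+ n ] ≤∞ v (x * y)
    v-*-≥ {m} {n} {x} {y} mx ny =
      subst ([ m ℤ.+ n ] ≤∞_) (≡.sym (v-* x y)) (+∞-mono (v x) (v y) mx ny)

    halve : ∀ (a : ℤ∞) → a +∞ a ≡ [ + 0 ] → [ + 0 ] ≤∞ a
    halve [ + n ]    eq = Supremum.[ ℤ.+≤+ ℕ.z≤n ]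

    double : ∀ (a : ℤ∞) → a ≡ a +∞ a → ¬ (a ≡ ⊤⁺) → a ≡ [ + 0 ]
    double ⊤⁺    eq ne = ⊥-elim (ne ≡.refl)
    double [ a ] eq ne = cong [_] (AbelianGroupProperties.identityʳ-unique ℤₚ.+-0-abelianGroup a a (≡.sym (unbracket eq)))
      where
      unbracket : ∀ {x y : ℤ} → _≡_ {A = ℤ∞} [ x ] [ y ] → x ≡ y
      unbracket ≡.refl = ≡.refl

    v-1 : v 1# ≡ [ + 0 ]
    v-1 = double (v 1#)
      (≡.trans (v-cong (K.sym (*-identityˡ 1#))) (v-* 1# 1#))
      (1≉0 ∘ v-∞)

    1∈𝒪 : 1# ∈𝒪
    1∈𝒪 rewrite v-1 = Supremum.[ ℤ.+≤+ ℕ.z≤n ]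

    -1∈𝒪 : (- 1#) ∈𝒪
    -1∈𝒪 = halve (v (- 1#))
      (≡.trans (≡.sym (v-* (- 1#) (- 1#)))
        (≡.trans (v-cong (K.trans (-1*x≈-x (- 1#)) (⁻¹-involutive 1#))) v-1))

    neg : ∀ {n x} → [ n ] ≤∞ v x → [ n ] ≤∞ v (- x)
    neg {n} {x} nx = resp (-1*x≈-x x) (subst (λ m → [ m ] ≤∞ v (- 1# * x)) (ℤₚ.+-identityˡ n) (v-*-≥ -1∈𝒪 nx))

    ≈⇒≡ : ∀ {n x y} → x ≈ y → x ≡ y mod𝔪^ n
    ≈⇒≡ {n} {x} {y} x≈y = zero∈ (x≈y⇒x∙y⁻¹≈ε x≈y)

    sym′ : ∀ {n x y} → x ≡ y mod𝔪^ n → y ≡ x mod𝔪^ n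
    sym′ {n} {x} {y} p = resp (begin
      - (x - y)      ≈⟨ ⁻¹-∙-comm x (- y) ⟨
      - x + - - y    ≈⟨ +-congˡ (⁻¹-involutive y) ⟩
      - x + y        ≈⟨ +-comm _ _ ⟩
      y - x          ∎) (neg p)

    telescope : ∀ x y z → (x - y) + (y - z) ≈ x - z
    telescope x y z = begin
      (x - y) + (y - z)      ≈⟨ +-assoc _ _ _ ⟩
      x + (- y + (y - z))    ≈⟨ +-congˡ (+-assoc _ _ _) ⟨
      x + ((- y + y) - z)    ≈⟨ +-congˡ (+-congʳ (-‿inverseˡ y)) ⟩
      x + (0# - z)           ≈⟨ +-congˡ (+-identityˡ _) ⟩
      x - z                  ∎

    trans′ : ∀ {n x y z} → x ≡ y mod𝔪^ n → y ≡ z mod𝔪^ n → x ≡ z mod𝔪^ n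
    trans′ {n} {x} {y} {z} p q = resp (telescope x y z) (v-+ p q)

    +-cong′ : ∀ {n x y u w} → x ≡ y mod𝔪^ n → u ≡ w mod𝔪^ n → (x + u) ≡ (y + w) mod𝔪^ n
    +-cong′ {n} {x} {y} {u} {w} p q = resp (begin
      (x - y) + (u - w)        ≈⟨ +-assoc _ _ _ ⟩
      x + (- y + (u - w))      ≈⟨ +-congˡ (+-assoc _ _ _) ⟨
      x + ((- y + u) - w)      ≈⟨ +-congˡ (+-congʳ (+-comm _ _)) ⟩
      x + ((u - y) - w)        ≈⟨ +-congˡ (+-assoc _ _ _) ⟩
      x + (u + (- y - w))      ≈⟨ +-assoc _ _ _ ⟨
      (x + u) + (- y - w)      ≈⟨ +-congˡ (⁻¹-∙-comm y w) ⟩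
      (x + u) - (y + w)        ∎) (v-+ p q)

    -‿cong′ : ∀ {n x y} → x ≡ y mod𝔪^ n → (- x) ≡ (- y) mod𝔪^ n
    -‿cong′ {n} {x} {y} p = resp (K.sym (⁻¹-∙-comm x (- y))) (neg p)

    *-cong′ : ∀ {n x y u w} → y ∈𝒪 → u ∈𝒪 → x ≡ y mod𝔪^ n → u ≡ w mod𝔪^ n → (x * u) ≡ (y * w) mod𝔪^ n
    *-cong′ {n} {x} {y} {u} {w} y∈ u∈ p q = resp (begin
      (x - y) * u + y * (u - w)              ≈⟨ +-cong (distribʳ u x (- y)) (distribˡ y u (- w)) ⟩
      (x * u + - y * u) + (y * u + y * - w)  ≈⟨ +-cong (+-congˡ (K.sym (-‿distribˡ-* y u))) (+-congˡ (K.sym (-‿distribʳ-* y w))) ⟩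
      (x * u - y * u) + (y * u - y * w)      ≈⟨ telescope _ _ _ ⟩
      x * u - y * w                          ∎)
      (v-+ (subst (λ m → [ m ] ≤∞ v ((x - y) * u)) (ℤₚ.+-identityʳ (+ n)) (v-*-≥ p u∈))
           (subst (λ m → [ m ] ≤∞ v (y * (u - w))) (ℤₚ.+-identityˡ (+ n)) (v-*-≥ y∈ q)))

  residueRing : CommutativeRing 0ℓ 0ℓ
  residueRing = record
    { Carrier = Σ Carrier _∈𝒪
    ; _≈_ = λ x y → proj₁ x ≡ proj₁ y mod𝔪^ 1
    ; _+_ = λ x y → proj₁ x + proj₁ y , v-+ (proj₂ x) (proj₂ y)
    ; _*_ = λ x y → proj₁ x * proj₁ y , v-*-≥ (proj₂ x) (proj₂ y)
    ; -_ = λ x → - proj₁ x , neg (proj₂ x)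
    ; 0# = 0# , zero∈ K.refl
    ; 1# = 1# , 1∈𝒪
    ; isCommutativeRing = record
      { isRing = record
        { +-isAbelianGroup = record
          { isGroup = record
            { isMonoid = record
              { isSemigroup = record
                { isMagma = record
                  { isEquivalence = record { refl = ≈⇒≡ K.refl ; sym = sym′ ; trans = trans′ }
                  ; ∙-cong = +-cong′
                  }
                ; assoc = λ _ _ _ → ≈⇒≡ (+-assoc _ _ _)
                }
              ; identity = (λ _ → ≈⇒≡ (+-identityˡ _)) , (λ _ → ≈⇒≡ (+-identityʳ _))
              }
            ; inverse = (λ _ → ≈⇒≡ (-‿inverseˡ _)) , (λ _ → ≈⇒≡ (-‿inverseʳ _))
            ; ⁻¹-cong = -‿cong′
            }
          ; comm = λ _ _ → ≈⇒≡ (+-comm _ _)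
          }
        ; *-cong = λ {_} {y} {u} p q → *-cong′ (proj₂ y) (proj₂ u) p q
        ; *-assoc = λ _ _ _ → ≈⇒≡ (*-assoc _ _ _)
        ; *-identity = (λ _ → ≈⇒≡ (*-identityˡ _)) , (λ _ → ≈⇒≡ (*-identityʳ _))
        ; distrib = (λ _ _ _ → ≈⇒≡ (distribˡ _ _ _)) , (λ _ _ _ → ≈⇒≡ (distribʳ _ _ _))
        }
      ; *-comm = λ _ _ → ≈⇒≡ (*-comm _ _)
      }
    }

  ≈⇒residue≈ : ∀ {x y} → x ≈ y → x ≡ y mod𝔪^ 1
  ≈⇒residue≈ = ≈⇒≡

  -- x ⇝ x̄: the element x of K lies in 𝒪 and has image x̄ in 𝒪/𝔪.
  infix 4 _⇝_
  _⇝_ : Carrier → CommutativeRing.Carrier residueRing → Set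
  x ⇝ x̄ = x ≡ proj₁ x̄ mod𝔪^ 1

record Mat₂ (A : Set) : Set where
  constructor mat
  field
    e₁₁ e₁₂ e₂₁ e₂₂ : A

open Mat₂ public

module Matrices (R : CommutativeRing 0ℓ 0ℓ) where
  open CommutativeRing R using (Carrier; _≈_; _+_; _*_; 0#; 1#)

  infix  4 _≈ᴹ_
  infixl 7 _*ᴹ_

  _≈ᴹ_ : Mat₂ Carrier → Mat₂ Carrier → Set
  M ≈ᴹ N = e₁₁ M ≈ e₁₁ N × e₁₂ M ≈ e₁₂ N × e₂₁ M ≈ e₂₁ N × e₂₂ M ≈ e₂₂ N

  _*ᴹ_ : Mat₂ Carrier → Mat₂ Carrier → Mat₂ Carrier
  mat a b c d *ᴹ mat a′ b′ c′ d′ =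
    mat (a * a′ + b * c′) (a * b′ + b * d′) (c * a′ + d * c′) (c * b′ + d * d′)

  1ᴹ : Mat₂ Carrier
  1ᴹ = mat 1# 0# 0# 1#

  infixr 7 _*ⱽ_
  _*ⱽ_ : Mat₂ Carrier → Carrier × Carrier → Carrier × Carrier
  mat a b c d *ⱽ (x , y) = a * x + b * y , c * x + d * y

  record GL₂ : Set where
    field
      matrix   : Mat₂ Carrier
      inverse  : Mat₂ Carrier
      inverseʳ : matrix *ᴹ inverse ≈ᴹ 1ᴹ
      inverseˡ : inverse *ᴹ matrix ≈ᴹ 1ᴹ

module Representations (G : Group 0ℓ 0ℓ) (R : CommutativeRing 0ℓ 0ℓ) where
  open Group G using (_∙_; ε) renaming (Carrier to ∣G∣; _≈_ to _≈ᴳ_)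
  open CommutativeRing R using (Carrier; _≈_; _+_; _*_; 0#; 1#)
  private
    module R = CommutativeRing R
  open Matrices R

  -- Since χ ε ≈ 1, all values are units.
  record Character : Set where
    field
      χ      : ∣G∣ → Carrier
      χ-cong : ∀ {g h} → g ≈ᴳ h → χ g ≈ χ h
      χ-∙    : ∀ g h → χ (g ∙ h) ≈ χ g * χ h
      χ-ε    : χ ε ≈ 1#

  infix 4 _≋_
  _≋_ : Character → Character → Set
  φ ≋ ψ = ∀ g → Character.χ φ g ≈ Character.χ ψ g

  -- Since ρ ε is the identity matrix, all values lie in GL₂.
  record Representation : Set where
    field
      ρ      : ∣G∣ → Mat₂ Carrier
      ρ-cong : ∀ {g h} → g ≈ᴳ h → ρ g ≈ᴹ ρ h
      ρ-∙    : ∀ g h → ρ (g ∙ h) ≈ᴹ ρ g *ᴹ ρ h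
      ρ-ε    : ρ ε ≈ᴹ 1ᴹ

  open Representation

  infix 4 _≅_
  _≅_ : Representation → Representation → Set
  φ ≅ ψ = Σ[ P ∈ GL₂ ] ∀ g → ρ φ g ≈ᴹ GL₂.matrix P *ᴹ ρ ψ g *ᴹ GL₂.inverse P

  record Subrepresentation (φ : Representation) : Set₁ where
    infix 4 _∈S
    field
      _∈S    : Carrier × Carrier → Set
      ∈-resp : ∀ {x x′ y y′} → x ≈ x′ → y ≈ y′ → (x , y) ∈S → (x′ , y′) ∈S
      0∈     : (0# , 0#) ∈S
      +∈     : ∀ {x x′ y y′} → (x , y) ∈S → (x′ , y′) ∈S → (x + x′ , y + y′) ∈S
      *∈     : ∀ c {x y} → (x , y) ∈S → (c * x , c * y) ∈S
      ρ∈     : ∀ g {u} → u ∈S → ρ φ g *ⱽ u ∈S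

    IsNonzero IsProper : Set
    IsNonzero = Σ[ x ∈ Carrier ] Σ[ y ∈ Carrier ] (x , y) ∈S × ¬ (x ≈ 0# × y ≈ 0#)
    IsProper  = Σ[ u ∈ Carrier × Carrier ] ¬ (u ∈S)

  Reducible : Representation → Set₁
  Reducible φ = Σ[ S ∈ Subrepresentation φ ]
    Subrepresentation.IsNonzero S × Subrepresentation.IsProper S

  Irreducible : Representation → Set₁
  Irreducible φ = ¬ Reducible φ

  record Decomposable (φ : Representation) : Set₁ where
    field
      S T : Subrepresentation φ
    open Subrepresentation S using (_∈S) renaming (IsNonzero to S-IsNonzero)
    open Subrepresentation T using () renaming (_∈S to _∈T; IsNonzero to T-IsNonzero)
    field
      S-nonzero : S-IsNonzero
      T-nonzero : T-IsNonzero
      S∩T≈0     : ∀ {x y} → (x , y) ∈S → (x , y) ∈T → x ≈ 0# × y ≈ 0#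
      S+T       : ∀ x y → Σ[ s ∈ Carrier × Carrier ] Σ[ t ∈ Carrier × Carrier ]
                    s ∈S × t ∈T × x ≈ proj₁ s + proj₁ t × y ≈ proj₂ s + proj₂ t

  infixr 6 _⊕_
  _⊕_ : Character → Character → Representation
  φ ⊕ ψ = record
    { ρ      = λ g → mat (φ.χ g) 0# 0# (ψ.χ g)
    ; ρ-cong = λ g≈h → φ.χ-cong g≈h , R.refl , R.refl , ψ.χ-cong g≈h
    ; ρ-∙    = λ g h →
        R.trans (φ.χ-∙ g h) (R.sym (R.trans (R.+-congˡ (R.zeroˡ _)) (R.+-identityʳ _))) ,
        R.sym (R.trans (R.+-cong (R.zeroʳ _) (R.zeroˡ _)) (R.+-identityʳ _)) ,
        R.sym (R.trans (R.+-cong (R.zeroˡ _) (R.zeroʳ _)) (R.+-identityʳ _)) ,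
        R.trans (ψ.χ-∙ g h) (R.sym (R.trans (R.+-congʳ (R.zeroˡ _)) (R.+-identityˡ _)))
    ; ρ-ε    = φ.χ-ε , R.refl , R.refl , ψ.χ-ε
    }
    where
    module φ = Character φ
    module ψ = Character ψ

open Representations public using (Character; Representation)

module _ {G : Group 0ℓ 0ℓ} {K : Field} (valuation : DiscreteValuation K) where
  open Group G using () renaming (Carrier to ∣G∣)
  open DiscreteValuation valuation
  open Field K using (commutativeRing)

  -- The matrices φ g then lie in GL₂(𝒪), as φ (g⁻¹) is integral as well.
  IsIntegral : Representation G commutativeRing → Set
  IsIntegral φ = ∀ g → e₁₁ (ρ g) ∈𝒪 × e₁₂ (ρ g) ∈𝒪 × e₂₁ (ρ g) ∈𝒪 × e₂₂ (ρ g) ∈𝒪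
    where open Representation φ

  reduction : (φ : Representation G commutativeRing) → IsIntegral φ →
              Representation G (residueRing valuation)
  reduction φ int = record
    { ρ = λ g → let (a , b , c , d) = int g in
        mat (e₁₁ (ρ g) , a) (e₁₂ (ρ g) , b) (e₂₁ (ρ g) , c) (e₂₂ (ρ g) , d)
    ; ρ-cong = λ g≈h → let (a , b , c , d) = ρ-cong g≈h in
        ≈⇒residue≈ valuation a , ≈⇒residue≈ valuation b , ≈⇒residue≈ valuation c , ≈⇒residue≈ valuation d
    ; ρ-∙ = λ g h → let (a , b , c , d) = ρ-∙ g h in
        ≈⇒residue≈ valuation a , ≈⇒residue≈ valuation b , ≈⇒residue≈ valuation c , ≈⇒residue≈ valuation d
    ; ρ-ε = let (a , b , c , d) = ρ-ε in
        ≈⇒residue≈ valuation a , ≈⇒residue≈ valuation b , ≈⇒residue≈ valuation c , ≈⇒residue≈ valuation d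
    }
    where open Representation φ

  IsReductionOf : Character G (residueRing valuation) → (∣G∣ → Field.Carrier K) → Set
  IsReductionOf φ̄ f = ∀ g → _⇝_ valuation (f g) (Character.χ φ̄ g)

-- A subgroup H of index two, with a representative σ of the nontrivial coset:
-- every g ∉ H is hσ with h = gσ⁻¹ ∈ H.
record IndexTwoSubgroup (G : Group 0ℓ 0ℓ) : Set₁ where
  open Group G
  infix 4 _∈H
  field
    _∈H    : Carrier → Set
    ∈H-resp : ∀ {g h} → g ≈ h → g ∈H → h ∈H
    ε∈H    : ε ∈H
    ∙∈H    : ∀ {g h} → g ∈H → h ∈H → g ∙ h ∈H
    ⁻¹∈H   : ∀ {g} → g ∈H → g ⁻¹ ∈H
    σ      : Carrier
    σ∉H    : ¬ (σ ∈H)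
    coset  : ∀ g → g ∈H ⊎ g ∙ σ ⁻¹ ∈H

  open GroupProperties G using (//-rightDividesˡ; //-rightDividesʳ; \\-leftDividesˡ; \\-leftDividesʳ; ⁻¹-involutive)

  subgroup : Group 0ℓ 0ℓ
  subgroup = record
    { Carrier = Σ Carrier _∈H
    ; _≈_ = λ g h → proj₁ g ≈ proj₁ h
    ; _∙_ = λ g h → proj₁ g ∙ proj₁ h , ∙∈H (proj₂ g) (proj₂ h)
    ; ε = ε , ε∈H
    ; _⁻¹ = λ g → proj₁ g ⁻¹ , ⁻¹∈H (proj₂ g)
    ; isGroup = record
      { isMonoid = record
        { isSemigroup = record
          { isMagma = record
            { isEquivalence = record { refl = Group.refl G ; sym = sym ; trans = trans }
            ; ∙-cong = ∙-cong
            }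
          ; assoc = λ _ _ _ → assoc _ _ _
          }
        ; identity = (λ _ → identityˡ _) , (λ _ → identityʳ _)
        }
      ; inverse = (λ _ → inverseˡ _) , (λ _ → inverseʳ _)
      ; ⁻¹-cong = ⁻¹-cong
      }
    }

  H : Set
  H = Σ Carrier _∈H

  ∉⇒∈ : ∀ {g} → ¬ (g ∈H) → g ∙ σ ⁻¹ ∈H
  ∉⇒∈ {g} g∉ with coset g
  ... | inj₁ g∈ = ⊥-elim (g∉ g∈)
  ... | inj₂ ∈  = ∈

  ∈-cancelʳ : ∀ {g h} → g ∙ h ∈H → h ∈H → g ∈H
  ∈-cancelʳ {g} {h} gh∈ h∈ = ∈H-resp (//-rightDividesʳ h g) (∙∈H gh∈ (⁻¹∈H h∈))

  ∈-cancelˡ : ∀ {g h} → g ∙ h ∈H → g ∈H → h ∈H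
  ∈-cancelˡ {g} {h} gh∈ g∈ = ∈H-resp (\\-leftDividesʳ g h) (∙∈H (⁻¹∈H g∈) gh∈)

  ∉∙∉ : ∀ {g h} → ¬ (g ∈H) → ¬ (h ∈H) → g ∙ h ∈H
  ∉∙∉ {g} {h} g∉ h∉ with coset (g ∙ h)
  ... | inj₁ ∈ = ∈
  ... | inj₂ ∈ = ⊥-elim (g∉ (∈-cancelʳ (∈H-resp (assoc g h (σ ⁻¹)) ∈) (∉⇒∈ h∉)))

  ∈σ⁻¹⇒∉ : ∀ {g} → g ∙ σ ⁻¹ ∈H → ¬ (g ∈H)
  ∈σ⁻¹⇒∉ gσ⁻¹∈ g∈ = σ∉H (∈H-resp (⁻¹-involutive σ) (⁻¹∈H (∈-cancelˡ gσ⁻¹∈ g∈)))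

  σσ∈H : σ ∙ σ ∈H
  σσ∈H = ∉∙∉ σ∉H σ∉H

  σh∉H : ∀ {h} → h ∈H → ¬ (σ ∙ h ∈H)
  σh∉H h∈ σh∈ = σ∉H (∈-cancelʳ σh∈ h∈)

  σhσ∈H : ∀ {h} → h ∈H → σ ∙ h ∙ σ ∈H
  σhσ∈H h∈ = ∉∙∉ (σh∉H h∈) σ∉H

  σhσ⁻¹∈H : ∀ {h} → h ∈H → σ ∙ h ∙ σ ⁻¹ ∈H
  σhσ⁻¹∈H h∈ = ∉⇒∈ (σh∉H h∈)

  σ² : H
  σ² = σ ∙ σ , σσ∈H

  σ⟨_⟩σ σ⟨_⟩σ⁻¹ : H → H
  σ⟨ h , h∈ ⟩σ   = σ ∙ h ∙ σ , σhσ∈H h∈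
  σ⟨ h , h∈ ⟩σ⁻¹ = σ ∙ h ∙ σ ⁻¹ , σhσ⁻¹∈H h∈

  -- The function on G with h ↦ f h and hσ ↦ f′ h for h ∈ H.
  cosetwise : {A : Set} → (H → A) → (H → A) → Carrier → A
  cosetwise f f′ g with coset g
  ... | inj₁ g∈    = f (g , g∈)
  ... | inj₂ gσ⁻¹∈ = f′ (g ∙ σ ⁻¹ , gσ⁻¹∈)

module Induction {G : Group 0ℓ 0ℓ} (I : IndexTwoSubgroup G) (R : CommutativeRing 0ℓ 0ℓ) where
  open Group G using (_∙_; ε) renaming (_⁻¹ to _⁻¹ᴳ; _≈_ to _≈ᴳ_)
  private
    module G = Group G
    module GP = GroupProperties G
  open IndexTwoSubgroup I
  open CommutativeRing R hiding (_≉_)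
  open Matrices R

  _^σ : Character subgroup R → Character subgroup R
  ξ ^σ = record
    { χ      = λ h → χ σ⟨ h ⟩σ⁻¹
    ; χ-cong = λ g≈h → χ-cong (G.∙-congʳ (G.∙-congˡ g≈h))
    ; χ-∙    = λ (g , _) (h , _) → trans (χ-cong (conj-∙ g h)) (χ-∙ _ _)
    ; χ-ε    = trans (χ-cong conj-ε) χ-ε
    }
    where
    open Character ξ
    open SetoidReasoning G.setoid
    conj-ε : σ ∙ ε ∙ σ ⁻¹ᴳ ≈ᴳ ε
    conj-ε = G.trans (G.∙-congʳ (G.identityʳ σ)) (G.inverseʳ σ)
    conj-∙ : ∀ g h → σ ∙ (g ∙ h) ∙ σ ⁻¹ᴳ ≈ᴳ (σ ∙ g ∙ σ ⁻¹ᴳ) ∙ (σ ∙ h ∙ σ ⁻¹ᴳ)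
    conj-∙ g h = begin
      σ ∙ (g ∙ h) ∙ σ ⁻¹ᴳ                    ≈⟨ G.∙-congʳ (G.assoc σ g h) ⟨
      σ ∙ g ∙ h ∙ σ ⁻¹ᴳ                      ≈⟨ G.assoc _ _ _ ⟩
      σ ∙ g ∙ (h ∙ σ ⁻¹ᴳ)                    ≈⟨ G.∙-congˡ (GP.\\-leftDividesʳ σ _) ⟨
      σ ∙ g ∙ (σ ⁻¹ᴳ ∙ (σ ∙ (h ∙ σ ⁻¹ᴳ)))    ≈⟨ G.assoc _ _ _ ⟨
      σ ∙ g ∙ σ ⁻¹ᴳ ∙ (σ ∙ (h ∙ σ ⁻¹ᴳ))      ≈⟨ G.∙-congˡ (G.assoc _ _ _) ⟨
      (σ ∙ g ∙ σ ⁻¹ᴳ) ∙ (σ ∙ h ∙ σ ⁻¹ᴳ)      ∎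

  _|H : Representation G R → Representation subgroup R
  φ |H = record
    { ρ      = λ h → ρ (proj₁ h)
    ; ρ-cong = ρ-cong
    ; ρ-∙    = λ g h → ρ-∙ (proj₁ g) (proj₁ h)
    ; ρ-ε    = ρ-ε
    }
    where open Representation φ

  Ind : Character subgroup R → Representation G R
  Ind ξ = record
    { ρ      = ind
    ; ρ-cong = ind-cong
    ; ρ-∙    = ind-∙
    ; ρ-ε    = ind-ε
    }
    where
    open Character ξ renaming (χ to ξ⟨_⟩)
    open Character (ξ ^σ) using () renaming (χ to ξ^σ⟨_⟩; χ-cong to χ^σ-cong; χ-∙ to χ^σ-∙; χ-ε to χ^σ-ε)

    ind : G.Carrier → Mat₂ Carrier
    ind = cosetwise (λ h → mat ξ⟨ h ⟩ 0# 0# ξ^σ⟨ h ⟩)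
                    (λ h → mat 0# ξ⟨ h ⟩ ξ⟨ σ⟨ h ⟩σ ⟩ 0#)

    ind-cong : ∀ {g h} → g ≈ᴳ h → ind g ≈ᴹ ind h
    ind-cong {g} {h} g≈h with coset g | coset h
    ... | inj₁ g∈ | inj₁ h∈ = χ-cong g≈h , refl , refl , χ^σ-cong {g , g∈} {h , h∈} g≈h
    ... | inj₁ g∈ | inj₂ h∈ = ⊥-elim (∈σ⁻¹⇒∉ h∈ (∈H-resp g≈h g∈))
    ... | inj₂ g∈ | inj₁ h∈ = ⊥-elim (∈σ⁻¹⇒∉ g∈ (∈H-resp (G.sym g≈h) h∈))
    ... | inj₂ _  | inj₂ _  =
      refl , χ-cong (G.∙-congʳ g≈h) , χ-cong (G.∙-congʳ (G.∙-congˡ (G.∙-congʳ g≈h))) , refl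

    ind-ε : ind ε ≈ᴹ 1ᴹ
    ind-ε with coset ε
    ... | inj₁ ∈ = trans (χ-cong G.refl) χ-ε , refl , refl , trans (χ^σ-cong {ε , ∈} {ε , ε∈H} G.refl) χ^σ-ε
    ... | inj₂ ∈ = ⊥-elim (∈σ⁻¹⇒∉ ∈ ε∈H)

    first : ∀ {x y z w} → x ≈ y * z → x ≈ y * z + 0# * w
    first e = trans e (sym (trans (+-congˡ (zeroˡ _)) (+-identityʳ _)))
    second : ∀ {x y z w} → x ≈ y * z → x ≈ 0# * w + y * z
    second e = trans e (sym (trans (+-congʳ (zeroˡ _)) (+-identityˡ _)))
    none₁ : ∀ {x y} → 0# ≈ x * 0# + 0# * y
    none₁ = sym (trans (+-cong (zeroʳ _) (zeroˡ _)) (+-identityˡ _))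
    none₂ : ∀ {x y} → 0# ≈ 0# * x + y * 0#
    none₂ = sym (trans (+-cong (zeroˡ _) (zeroʳ _)) (+-identityˡ _))

    ξ-∙ : ∀ {a b c} → proj₁ c ≈ᴳ proj₁ a ∙ proj₁ b → ξ⟨ c ⟩ ≈ ξ⟨ a ⟩ * ξ⟨ b ⟩
    ξ-∙ c≈ab = trans (χ-cong c≈ab) (χ-∙ _ _)

    open SetoidReasoning G.setoid

    cancel : ∀ {a b} → a ∙ σ ⁻¹ᴳ ∙ (σ ∙ b) ≈ᴳ a ∙ b
    cancel {a} {b} = begin
      a ∙ σ ⁻¹ᴳ ∙ (σ ∙ b)    ≈⟨ G.assoc _ _ _ ⟩
      a ∙ (σ ⁻¹ᴳ ∙ (σ ∙ b))  ≈⟨ G.∙-congˡ (GP.\\-leftDividesʳ σ b) ⟩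
      a ∙ b                  ∎

    cancel′ : ∀ {a b} → σ ∙ (a ∙ σ ⁻¹ᴳ) ∙ σ ∙ b ≈ᴳ σ ∙ (a ∙ b)
    cancel′ {a} {b} = begin
      σ ∙ (a ∙ σ ⁻¹ᴳ) ∙ σ ∙ b      ≈⟨ G.assoc _ _ _ ⟩
      σ ∙ (a ∙ σ ⁻¹ᴳ) ∙ (σ ∙ b)    ≈⟨ G.assoc _ _ _ ⟩
      σ ∙ (a ∙ σ ⁻¹ᴳ ∙ (σ ∙ b))    ≈⟨ G.∙-congˡ cancel ⟩
      σ ∙ (a ∙ b)                  ∎

    undo : ∀ {a} → a ∙ σ ⁻¹ᴳ ∙ σ ≈ᴳ a
    undo = GP.//-rightDividesˡ σ _

    sandwich : ∀ {a b} → a ∙ σ ⁻¹ᴳ ∙ (σ ∙ (b ∙ σ ⁻¹ᴳ) ∙ σ) ≈ᴳ a ∙ b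
    sandwich {a} {b} = begin
      a ∙ σ ⁻¹ᴳ ∙ (σ ∙ (b ∙ σ ⁻¹ᴳ) ∙ σ)  ≈⟨ G.∙-congˡ (G.assoc _ _ _) ⟩
      a ∙ σ ⁻¹ᴳ ∙ (σ ∙ (b ∙ σ ⁻¹ᴳ ∙ σ))  ≈⟨ cancel ⟩
      a ∙ (b ∙ σ ⁻¹ᴳ ∙ σ)                ≈⟨ G.∙-congˡ undo ⟩
      a ∙ b                              ∎

    expand : ∀ {a} → σ ∙ (a ∙ σ ⁻¹ᴳ) ∙ σ ≈ᴳ σ ∙ a
    expand = G.trans (G.assoc _ _ _) (G.∙-congˡ undo)

    ind-∙ : ∀ g h → ind (g ∙ h) ≈ᴹ ind g *ᴹ ind h
    ind-∙ g h with coset g | coset h | coset (g ∙ h)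
    ... | inj₁ g∈ | inj₁ h∈ | inj₁ gh∈ = first (ξ-∙ G.refl) , none₁ , none₂ , second (trans (χ^σ-cong {g ∙ h , gh∈} {g ∙ h , ∙∈H g∈ h∈} G.refl) (χ^σ-∙ (g , g∈) (h , h∈)))
    ... | inj₁ g∈ | inj₁ h∈ | inj₂ gh∈ = ⊥-elim (∈σ⁻¹⇒∉ gh∈ (∙∈H g∈ h∈))
    ... | inj₁ g∈ | inj₂ h∈ | inj₁ gh∈ = ⊥-elim (∈σ⁻¹⇒∉ h∈ (∈-cancelˡ gh∈ g∈))
    ... | inj₁ g∈ | inj₂ h∈ | inj₂ gh∈ =
      none₁ ,
      first (ξ-∙ (G.assoc _ _ _)) ,
      second (ξ-∙ (G.trans expand (G.trans (G.sym (G.assoc _ _ _)) (G.sym sandwich)))) ,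
      none₂
    ... | inj₂ g∈ | inj₁ h∈ | inj₁ gh∈ = ⊥-elim (∈σ⁻¹⇒∉ g∈ (∈-cancelʳ gh∈ h∈))
    ... | inj₂ g∈ | inj₁ h∈ | inj₂ gh∈ =
      none₂ ,
      second (ξ-∙ (G.trans (G.assoc _ _ _) (G.sym (G.trans (G.∙-congˡ (G.assoc _ _ _)) cancel)))) ,
      first (ξ-∙ (G.trans expand (G.sym cancel′))) ,
      none₁
    ... | inj₂ g∈ | inj₂ h∈ | inj₁ gh∈ =
      second (ξ-∙ (G.sym sandwich)) ,
      none₂ ,
      none₁ ,
      first (ξ-∙ (G.trans assoc₃ (G.sym cancel′)))
      where
      assoc₃ : σ ∙ (g ∙ h) ∙ σ ⁻¹ᴳ ≈ᴳ σ ∙ (g ∙ (h ∙ σ ⁻¹ᴳ))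
      assoc₃ = G.trans (G.assoc _ _ _) (G.∙-congˡ (G.assoc _ _ _))
    ... | inj₂ g∈ | inj₂ h∈ | inj₂ gh∈ = ⊥-elim (∈σ⁻¹⇒∉ gh∈ (∉∙∉ (∈σ⁻¹⇒∉ g∈) (∈σ⁻¹⇒∉ h∈)))

record Automorphism {k : Field} (Ω/k : AlgebraicClosure k) : Set where
  open AlgebraicClosure Ω/k
  private
    module Ω = Field Ω
  open Ω using (Carrier; _≈_; rawRing)
  field
    to                : Carrier → Carrier
    isRingIsomorphism : IsRingIsomorphism rawRing rawRing to
    fixes             : ∀ a → to (Embedding.⟦_⟧ embedding a) ≈ Embedding.⟦_⟧ embedding a
  open IsRingIsomorphism isRingIsomorphism public

  from : Carrier → Carrier
  from y = proj₁ (surjective y)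

  to-from : ∀ y → to (from y) ≈ y
  to-from y = proj₂ (surjective y) Ω.refl

GaloisGroup : {k : Field} → AlgebraicClosure k → Group 0ℓ 0ℓ
GaloisGroup {k} Ω/k = record
  { Carrier = Automorphism Ω/k
  ; _≈_ = λ s t → ∀ x → to s x ≈ to t x
  ; _∙_ = λ s t → record
    { to = to s ∘ to t
    ; isRingIsomorphism = Compose.isRingIsomorphism trans (isRingIsomorphism t) (isRingIsomorphism s)
    ; fixes = λ a → trans (⟦⟧-cong s (fixes t a)) (fixes s a)
    }
  ; ε = record
    { to = λ x → x
    ; isRingIsomorphism = Identity.isRingIsomorphism rawRing refl
    ; fixes = λ _ → refl
    }
  ; _⁻¹ = inverse
  ; isGroup = record
    { isMonoid = record
      { isSemigroup = record
        { isMagma = record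
          { isEquivalence = record
            { refl = λ _ → refl ; sym = λ p x → sym (p x) ; trans = λ p q x → trans (p x) (q x) }
          ; ∙-cong = λ {s} {_} {_} {t′} p q x → trans (⟦⟧-cong s (q x)) (p (to t′ x))
          }
        ; assoc = λ _ _ _ _ → refl
        }
      ; identity = (λ _ _ → refl) , (λ _ _ → refl)
      }
    ; inverse = (λ s x → injective s (to-from s (to s x))) , to-from
    ; ⁻¹-cong = λ {s} {t} p x → injective t (trans (sym (p (from s x))) (trans (to-from s x) (sym (to-from t x))))
    }
  }
  where
  open AlgebraicClosure Ω/k
  open Field Ω
  open Automorphism

  inverse : Automorphism Ω/k → Automorphism Ω/k
  inverse s = record
    { to = from s
    ; isRingIsomorphism = record
      { isRingMonomorphism = record
        { isRingHomomorphism = record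
          { isSemiringHomomorphism = record
            { isNearSemiringHomomorphism = record
              { +-isMonoidHomomorphism = record
                { isMagmaHomomorphism = record
                  { isRelHomomorphism = record { cong = from-cong }
                  ; homo = λ x y → lift (trans (to-from s _)
                      (sym (trans (+-homo s _ _) (+-cong (to-from s x) (to-from s y)))))
                  }
                ; ε-homo = lift (trans (to-from s _) (sym (0#-homo s)))
                }
              ; *-homo = λ x y → lift (trans (to-from s _)
                  (sym (trans (*-homo s _ _) (*-cong (to-from s x) (to-from s y)))))
              }
            ; 1#-homo = lift (trans (to-from s _) (sym (1#-homo s)))
            }
          ; -‿homo = λ x → lift (trans (to-from s _) (sym (trans (-‿homo s _) (-‿cong (to-from s x)))))
          }
        ; injective = λ {x} {y} p → trans (sym (to-from s x)) (trans (⟦⟧-cong s p) (to-from s y))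
        }
      ; surjective = λ y → to s y , λ z≈ → lift (trans (to-from s _) z≈)
      }
    ; fixes = λ a → lift (trans (to-from s _) (sym (fixes s a)))
    }
    where
    lift : ∀ {x y} → to s x ≈ to s y → x ≈ y
    lift = injective s
    from-cong : ∀ {x y} → x ≈ y → from s x ≈ from s y
    from-cong x≈y = lift (trans (to-from s _) (trans x≈y (sym (to-from s _))))

-- A subgroup, as a group with an injective homomorphism.
record Subgroup (G : Group 0ℓ 0ℓ) : Set₁ where
  field
    group : Group 0ℓ 0ℓ
    ι     : Group.Carrier group → Group.Carrier G
    isGroupMonomorphism : IsGroupMonomorphism (Group.rawGroup group) (Group.rawGroup G) ι
  open IsGroupMonomorphism isGroupMonomorphism public

module IntegralElements {p : ℕ} (F : PAdicField p) (Ω/F : AlgebraicClosure (PAdicField.𝔽 F)) where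
  open AlgebraicClosure Ω/F
  open Field Ω
  open Embedding embedding using (⟦_⟧)

  IsIntegralElement : Carrier → Set
  IsIntegralElement x =
    Σ[ cs ∈ List (PAdicField.Carrier F) ] All (PAdicField._∈𝒪 F) cs × evalMonic (map ⟦_⟧ cs) x ≈ 0#

  -- The maximal ideal of the local ring of integral elements: its non-units.
  InMaximalIdeal : Carrier → Set
  InMaximalIdeal x = IsIntegralElement x × (∀ y → IsIntegralElement y → ¬ (x * y ≈ 1#))

  infix 4 _≡̄_
  _≡̄_ : Carrier → Carrier → Set
  x ≡̄ y = InMaximalIdeal (x - y)

  open Automorphism

  -- τ acts on the residue field of Ω as the n-th or the (-n)-th power of
  -- x ↦ x^q.
  IsFrobeniusPower : ℕ → Automorphism Ω/F → Set
  IsFrobeniusPower q τ = Σ[ n ∈ ℕ ]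
    ((∀ x → IsIntegralElement x → to τ x ≡̄ x ^ (q ℕ.^ n)) ⊎
     (∀ x → IsIntegralElement x → to τ x ^ (q ℕ.^ n) ≡̄ x))

  IsInertial : Automorphism Ω/F → Set
  IsInertial τ = ∀ x → IsIntegralElement x → to τ x ≡̄ x

-- The Weil group of F: the subgroup of the absolute Galois group consisting of
-- all elements that act on the residue field as an integral power of Frobenius.
record WeilGroup {p : ℕ} (F : PAdicField p) (Ω/F : AlgebraicClosure (PAdicField.𝔽 F)) : Set₁ where
  open AlgebraicClosure Ω/F
  open IntegralElements F Ω/F
  private
    module Ω = Field Ω
    module F = PAdicField F
  open Group (GaloisGroup Ω/F) using (_≈_)
  field
    q        : ℕ
    q-card   : F.HasResidueCardinality q
    W        : Subgroup (GaloisGroup Ω/F)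
  open Subgroup W public
  open Group group public using () renaming (Carrier to ∣W∣; _∙_ to _∙ᵂ_; _⁻¹ to _⁻¹ᵂ)
  field
    frobenius : ∀ w → IsFrobeniusPower q (ι w)
    full      : ∀ τ → IsFrobeniusPower q τ → Σ[ w ∈ ∣W∣ ] ι w ≈ τ

  act : ∣W∣ → Ω.Carrier → Ω.Carrier
  act w = Automorphism.to (ι w)

  -- The subgroups I_F ∩ Gal(Ω / F(x₁, …, xₙ)), indexed by lists x₁, …, xₙ,
  -- form a basis of neighbourhoods of the identity in the Weil group, the
  -- inertia group I_F being open and carrying the Krull topology.
  _∈Nbhd_ : ∣W∣ → List Ω.Carrier → Set
  w ∈Nbhd xs = IsInertial (ι w) × All (λ x → act w x Ω.≈ x) xs

  module _ {K : Field} (valuation : DiscreteValuation K) where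
    open Field K using (Carrier)
    open DiscreteValuation valuation

    -- Continuity of f : X → K, where X is identified through incl with a subset
    -- of the Weil group and carries the subspace topology.
    IsContinuous : {X : Set} (incl : X → ∣W∣) → (X → Carrier) → Set
    IsContinuous incl f = ∀ x n → Σ[ ys ∈ List Ω.Carrier ]
      ∀ x′ → (incl x ⁻¹ᵂ ∙ᵂ incl x′) ∈Nbhd ys → f x′ ≡ f x mod𝔪^ n

-- A quadratic extension E of F inside Ω: a subfield with F-basis 1, α.
record QuadraticExtension {k : Field} (Ω/k : AlgebraicClosure k) : Set₁ where
  open AlgebraicClosure Ω/k
  open Field Ω
  open Embedding embedding using (⟦_⟧)
  infix 4 _∈E
  field
    _∈E     : Carrier → Set
    ∈E-resp : ∀ {x y} → x ≈ y → x ∈E → y ∈E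
    base∈E  : ∀ a → ⟦ a ⟧ ∈E
    +∈E     : ∀ {x y} → x ∈E → y ∈E → x + y ∈E
    -∈E     : ∀ {x} → x ∈E → (- x) ∈E
    *∈E     : ∀ {x y} → x ∈E → y ∈E → x * y ∈E
    ⁻¹∈E    : ∀ {x} → ¬ (x ≈ 0#) → x ∈E → x ⁻¹ ∈E
    α       : Carrier
    α∈E     : α ∈E
    α∉F     : ∀ a → ¬ (α ≈ ⟦ a ⟧)
    spans   : ∀ {x} → x ∈E → Σ[ a ∈ Field.Carrier k ] Σ[ b ∈ Field.Carrier k ] x ≈ ⟦ a ⟧ + ⟦ b ⟧ * α

module _ {p : ℕ} {F : PAdicField p} {Ω/F : AlgebraicClosure (PAdicField.𝔽 F)}
         (W_F : WeilGroup F Ω/F) (E/F : QuadraticExtension Ω/F) where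
  open AlgebraicClosure Ω/F
  open Field Ω
  open Embedding embedding using (⟦_⟧)
  open WeilGroup W_F
  open QuadraticExtension E/F
  open SetoidReasoning setoid

  -- Membership in W_E, which inside the Galois group of F is W_F ∩ Gal(Ω/E).
  FixesE : ∣W∣ → Set
  FixesE w = ∀ x → x ∈E → act w x ≈ x

  private
    module A (w : ∣W∣) = Automorphism (ι w)

    act-∙ : ∀ w w′ x → act (w ∙ᵂ w′) x ≈ act w (act w′ x)
    act-∙ w w′ x = ∙-homo w w′ x

    act-⁻¹ : ∀ w x → act (w ⁻¹ᵂ) (act w x) ≈ x
    act-⁻¹ w x = trans (⁻¹-homo w (act w x)) (A.injective w (A.to-from w (act w x)))

    a b : Field.Carrier (PAdicField.𝔽 F)
    a = proj₁ (spans (*∈E α∈E α∈E))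
    b = proj₁ (proj₂ (spans (*∈E α∈E α∈E)))

    α² : α * α ≈ ⟦ a ⟧ + ⟦ b ⟧ * α
    α² = proj₂ (proj₂ (spans (*∈E α∈E α∈E)))

    act-α² : ∀ w → act w α * act w α ≈ ⟦ a ⟧ + ⟦ b ⟧ * act w α
    act-α² w = begin
      act w α * act w α                ≈⟨ A.*-homo w α α ⟨
      act w (α * α)                    ≈⟨ A.⟦⟧-cong w α² ⟩
      act w (⟦ a ⟧ + ⟦ b ⟧ * α)        ≈⟨ A.+-homo w _ _ ⟩
      act w ⟦ a ⟧ + act w (⟦ b ⟧ * α)  ≈⟨ +-cong (A.fixes w a) (trans (A.*-homo w _ _) (*-congʳ (A.fixes w b))) ⟩
      ⟦ a ⟧ + ⟦ b ⟧ * act w α          ∎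

    root : ∀ {y z} → y * y ≈ ⟦ a ⟧ + ⟦ b ⟧ * y → y * ((y + z) - ⟦ b ⟧) ≈ ⟦ a ⟧ + y * z
    root {y} {z} y² = begin
      y * ((y + z) - ⟦ b ⟧)                          ≈⟨ distribˡ _ _ _ ⟩
      y * (y + z) + y * - ⟦ b ⟧                      ≈⟨ +-cong (distribˡ _ _ _) (trans (sym (-‿distribʳ-* _ _)) (-‿cong (*-comm _ _))) ⟩
      (y * y + y * z) - ⟦ b ⟧ * y                    ≈⟨ +-congʳ (+-comm _ _) ⟩
      (y * z + y * y) - ⟦ b ⟧ * y                    ≈⟨ +-assoc _ _ _ ⟩
      y * z + (y * y - ⟦ b ⟧ * y)                    ≈⟨ +-congˡ (+-congʳ y²) ⟩
      y * z + (⟦ a ⟧ + ⟦ b ⟧ * y - ⟦ b ⟧ * y)        ≈⟨ +-congˡ (GroupProperties.//-rightDividesʳ +-group _ _) ⟩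
      y * z + ⟦ a ⟧                                  ≈⟨ +-comm _ _ ⟩
      ⟦ a ⟧ + y * z                                  ∎
      where open RingProperties ring using (-‿distribʳ-*)

    conjugate : ∀ w → ¬ (act w α ≈ α) → act w α + α ≈ ⟦ b ⟧
    conjugate w wα≉α = x-y≈0⇒x≈y (noZeroDivisors (begin
      (y - α) * ((y + α) - ⟦ b ⟧)                        ≈⟨ [y-z]x≈yx-zx _ _ _ ⟩
      y * ((y + α) - ⟦ b ⟧) - α * ((y + α) - ⟦ b ⟧)      ≈⟨ +-cong (root (act-α² w)) (-‿cong (trans (*-congˡ (+-congʳ (+-comm y α))) (root α²))) ⟩
      (⟦ a ⟧ + y * α) - (⟦ a ⟧ + α * y)                  ≈⟨ +-congˡ (-‿cong (+-congˡ (*-comm α y))) ⟩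
      (⟦ a ⟧ + y * α) - (⟦ a ⟧ + y * α)                  ≈⟨ -‿inverseʳ _ ⟩
      0#                                                 ∎) (wα≉α ∘ x-y≈0⇒x≈y))
      where
      open RingProperties ring using ([y-z]x≈yx-zx)
      y : Carrier
      y = act w α

    fixesα⇒fixesE : ∀ {w} → act w α ≈ α → FixesE w
    fixesα⇒fixesE {w} wα≈α x x∈E =
      let (c , d , x≈) = spans x∈E in begin
      act w x                          ≈⟨ A.⟦⟧-cong w x≈ ⟩
      act w (⟦ c ⟧ + ⟦ d ⟧ * α)        ≈⟨ A.+-homo w _ _ ⟩
      act w ⟦ c ⟧ + act w (⟦ d ⟧ * α)  ≈⟨ +-cong (A.fixes w c) (trans (A.*-homo w _ _) (*-cong (A.fixes w d) wα≈α)) ⟩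
      ⟦ c ⟧ + ⟦ d ⟧ * α                ≈⟨ x≈ ⟨
      x                                ∎

    swap : ∀ {x y z} → x + y ≈ z → y ≈ z - x
    swap {x} {y} x+y≈z = trans (sym (GroupProperties.//-rightDividesʳ +-group x y)) (+-congʳ (trans (+-comm y x) x+y≈z))

    act-conjugate : ∀ w → ¬ (act w α ≈ α) → act w (⟦ b ⟧ - α) ≈ α
    act-conjugate w wα≉α = begin
      act w (⟦ b ⟧ - α)          ≈⟨ A.+-homo w _ _ ⟩
      act w ⟦ b ⟧ + act w (- α)  ≈⟨ +-cong (A.fixes w b) (A.-‿homo w α) ⟩
      ⟦ b ⟧ - act w α            ≈⟨ swap (conjugate w wα≉α) ⟨
      α                          ∎

    cosetE : ∀ σ → ¬ FixesE σ → ∀ w → FixesE w ⊎ FixesE (w ∙ᵂ σ ⁻¹ᵂ)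
    cosetE σ σ∉ w with act w α ≟ α
    ... | yes wα≈α = inj₁ (fixesα⇒fixesE wα≈α)
    ... | no  wα≉α = inj₂ (fixesα⇒fixesE (begin
      act (w ∙ᵂ σ ⁻¹ᵂ) α                           ≈⟨ act-∙ w (σ ⁻¹ᵂ) α ⟩
      act w (act (σ ⁻¹ᵂ) α)                        ≈⟨ A.⟦⟧-cong w (A.⟦⟧-cong (σ ⁻¹ᵂ) (act-conjugate σ (σ∉ ∘ fixesα⇒fixesE))) ⟨
      act w (act (σ ⁻¹ᵂ) (act σ (⟦ b ⟧ - α)))      ≈⟨ A.⟦⟧-cong w (act-⁻¹ σ _) ⟩
      act w (⟦ b ⟧ - α)                            ≈⟨ act-conjugate w wα≉α ⟩
      α                                            ∎))

  W_E : (σ : ∣W∣) → ¬ FixesE σ → IndexTwoSubgroup group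
  W_E σ σ∉ = record
    { _∈H     = FixesE
    ; ∈H-resp = λ g≈h g∈ x x∈E → trans (sym (⟦⟧-cong g≈h x)) (g∈ x x∈E)
    ; ε∈H     = λ x _ → ε-homo x
    ; ∙∈H     = λ {g} {h} g∈ h∈ x x∈E →
        trans (act-∙ g h x) (trans (A.⟦⟧-cong g (h∈ x x∈E)) (g∈ x x∈E))
    ; ⁻¹∈H    = λ {g} g∈ x x∈E → trans (A.⟦⟧-cong (g ⁻¹ᵂ) (sym (g∈ x x∈E))) (act-⁻¹ g x)
    ; σ       = σ
    ; σ∉H     = σ∉
    ; coset   = cosetE σ σ∉
    }

module _ {p ℓ : ℕ} {F : PAdicField p} {Ω/F : AlgebraicClosure (PAdicField.𝔽 F)}
         (W_F : WeilGroup F Ω/F) (K : PAdicField ℓ) where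
  open WeilGroup W_F
  open PAdicField K using (Carrier; _≈_; _*_; commutativeRing; valuation)
  open Matrices commutativeRing
  open Representations group commutativeRing using (_≅_)

  IsContinuousRep : Representation group commutativeRing → Set
  IsContinuousRep φ = Cts e₁₁ × Cts e₁₂ × Cts e₂₁ × Cts e₂₂
    where
    Cts : (Mat₂ Carrier → Carrier) → Set
    Cts entry = IsContinuous valuation (λ w → w) (entry ∘ Representation.ρ φ)

  HasZeroMonodromy : Representation group commutativeRing → Set
  HasZeroMonodromy φ = ∃ λ xs → ∀ w → w ∈Nbhd xs → Representation.ρ φ w ≈ᴹ 1ᴹ

  -- A representation φ with zero monodromy, together with a presentation of it
  -- as an induced representation.  The isomorphism is given by a matrix over K,
  -- which forces the values of ξ to lie in K.
  record NonexceptionalSupercuspidal (φ : Representation group commutativeRing) : Set₁ where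
    field
      continuous    : IsContinuousRep φ
      zeroMonodromy : HasZeroMonodromy φ
      E/F           : QuadraticExtension Ω/F
      σ             : ∣W∣
      σ∉W_E         : ¬ FixesE W_F E/F σ
    index2 : IndexTwoSubgroup group
    index2 = W_E W_F E/F σ σ∉W_E
    open IndexTwoSubgroup index2 public using (H; subgroup; σ²; σ⟨_⟩σ; σ⟨_⟩σ⁻¹; cosetwise)
    open Induction index2 commutativeRing using (_^σ; Ind)
    open Representations subgroup commutativeRing using (_≋_)
    field
      ξ             : Character subgroup commutativeRing
      ξ-continuous  : IsContinuous valuation proj₁ (Character.χ ξ)
      ξ≢ξ^σ         : ¬ (ξ ≋ ξ ^σ)
      ρ≅Ind         : φ ≅ Ind ξ

    ξ⟨_⟩ ξ^σ⟨_⟩ : H → Carrier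
    ξ⟨ h ⟩   = Character.χ ξ h
    ξ^σ⟨ h ⟩ = Character.χ (ξ ^σ) h

    -- K need not contain a square root of ξ(σ²).  If it does not, Ind ξ̄ may be
    -- irreducible over the residue field of K although ξ̄ = ξ̄^σ.
    SquareRoot : Set
    SquareRoot = Σ[ r ∈ Carrier ] r * r ≈ ξ⟨ σ² ⟩

{-# OPTIONS --safe #-}

-- Dividing U by a gives V = (1 c ; 0 e) with c = b/a, e = d/a, and
--   ρ(h)  = (ξ(h)  (b/d)(ξ^σ(h) - ξ(h)) ; 0  ξ^σ(h)),
--   ρ(hσ) = (c y  (ξ(h) - c² y)/e ; e y  -c y)  with y = ξ(σhσ).
-- Integrality and invertibility of y put c and e in 𝒪.  If e is a unit, then V
-- reduces to an isomorphism of ρ̄ with Ind ξ̄, and a proper nonzero invariant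
-- subspace of Ind ξ̄ is spanned by some (1 , t) with t² = ξ̄(σ²) and forces
-- ξ̄ = ξ̄^σ.  If e ∈ 𝔪, then ρ̄ is upper triangular, integrality of ρ(σ) gives
-- c² ξ(σ²) ≡ 1, so v(b/d) = -v(e), and integrality of ρ(h) gives ξ̄ = ξ̄^σ.  The
-- ρ̄(h) are then unipotent up to scalars, so a decomposition makes their upper
-- right entries vanish, which raises the congruence ξ ≡ ξ^σ to the exponent
-- 1 + v(e); conversely, if these entries vanish, ρ̄ is diagonalized by
-- diagonalizing ρ̄(σ), whose eigenvalues ± c ξ(σ²) differ as ℓ is odd.
module Submission where

-- The division by `a` is harmless because scalar matrices are central, and it leaves exactly the
-- two ratios on which the answer depends. The case distinction asks whether `V` stays invertible
-- modulo 𝔪. If it does not, ρ̄ can no longer be compared with Ind ξ̄ through `V`, and everything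
-- has to come from the entries of ρ: those are integral although the factor `f = a/d` in them is
-- not, and the congruences of that case are such integrality statements multiplied by `e`. The
-- bound 1 - i has this origin: the upper right entry β(h) of ρ(h) satisfies ξ^σ(h) - ξ(h) = c⁻¹
-- β(h) e with c a unit, so all β(h) lie in 𝔪 exactly if ξ ≡ ξ^σ modulo λ^(1+v(e)), which means, i
-- being maximal, 1 + v(e) ≤ i. The square root of ξ(σ²) is a second obstacle. An invariant line of
-- Ind ξ̄ supplies one in the residue field, its slope, and this suffices to decompose ρ̄; a root in
-- K serves to write θ₁ and θ₂ as functions with values in K and to pass from ξ̄ = ξ̄^σ to
-- reducibility.

open import Defs
open import Level using (0ℓ)
open import Algebra.Bundles using (Group; CommutativeRing)
import Algebra.Properties.AbelianGroup as AbelianGroupProperties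
import Algebra.Properties.CommutativeSemigroup as CommutativeSemigroupProperties
import Algebra.Properties.Group as GroupProperties
import Algebra.Properties.Ring as RingProperties
import Algebra.Properties.Semiring.Mult as Mult
import Algebra.Properties.Semiring.Mult.TCOptimised as Mult′
import Algebra.Solver.Ring as RingSolver
open import Algebra.Solver.Ring.AlmostCommutativeRing using (fromCommutativeRing; _-Raw-AlmostCommutative⟶_)
open import Data.Empty using (⊥-elim)
open import Data.Integer.Base as ℤ using (ℤ; +_; -[1+_])
import Data.Integer.Properties as ℤₚ
open import Data.Maybe.Base using (Maybe; just; nothing)
open import Data.Nat.Base as ℕ using (ℕ; zero; suc; _≤_)
open import Data.Nat.Divisibility using (divides)
open import Data.Nat.DivMod using (_/_; _%_; m%n<n; m≡m%n+[m/n]*n)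
open import Data.Nat.Primality using (Prime; prime⇒irreducible)
open import Data.Product.Base using (Σ-syntax; _×_; _,_; proj₁; proj₂)
open import Data.Sum.Base as Sum using (_⊎_; inj₁; inj₂)
open import Function.Base using (_∘_)
open import Function.Bundles using (_⇔_; mk⇔)
open import Relation.Binary.Bundles using (Setoid)
import Relation.Binary.Construct.Add.Supremum.NonStrict as Supremum
import Relation.Binary.Reasoning.Setoid as SetoidReasoning
open import Relation.Binary.PropositionalEquality as ≡ using (_≡_; _≢_)
open import Relation.Nullary.Construct.Add.Supremum using ([_]; ⊤⁺)
open import Relation.Nullary.Decidable.Core using (Dec; yes; no)
open import Relation.Nullary.Negation.Core using (¬_)

-- A ring solver with integer coefficients, which sees that x - x vanishes.
module IntegerCoefficients (R : CommutativeRing 0ℓ 0ℓ) where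
  open CommutativeRing R
  open RingProperties ring using (-0#≈0#; -‿distribʳ-*)
  open AbelianGroupProperties +-abelianGroup using (⁻¹-∙-comm; ⁻¹-involutive)
  open Mult semiring using (×-homo-+; ×1-homo-*; ×-congˡ) renaming (_×_ to _⋅_)
  open Mult′ semiring using (×ᵤ≈×) renaming (_×_ to _⋅′_)
  open SetoidReasoning setoid

  -- With the optimised multiple, 0 and 1 go to `0#` and `1#` by computation, so identities proved
  -- with `:0` and `:1` fit the matrix entries as they stand.
  ι : ℤ → Carrier
  ι (+ n)    = n ⋅′ 1#
  ι -[1+ n ] = - (suc n ⋅′ 1#)

  ι-+ : ∀ n → ι (+ n) ≈ n ⋅ 1#
  ι-+ n = sym (×ᵤ≈× n 1#)

  ι-neg : ∀ z → ι (ℤ.- z) ≈ - ι z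
  ι-neg (+ 0)       = sym -0#≈0#
  ι-neg (+ (suc n)) = refl
  ι-neg -[1+ n ]    = sym (⁻¹-involutive _)

  cancelˡ : ∀ x y z → (x + y) - (x + z) ≈ y - z
  cancelˡ x y z = begin
    (x + y) - (x + z)      ≈⟨ +-congˡ (⁻¹-∙-comm x z) ⟨
    (x + y) + (- x - z)    ≈⟨ CommutativeSemigroupProperties.interchange +-commutativeSemigroup x y (- x) (- z) ⟩
    (x - x) + (y - z)      ≈⟨ +-congʳ (-‿inverseʳ x) ⟩
    0# + (y - z)           ≈⟨ +-identityˡ _ ⟩
    y - z                  ∎

  ι-⊖ : ∀ m n → ι (m ℤ.⊖ n) ≈ m ⋅ 1# - n ⋅ 1#
  ι-⊖ zero    zero    = sym (-‿inverseʳ 0#)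
  ι-⊖ zero    (suc n) = trans (-‿cong (ι-+ (suc n))) (sym (+-identityˡ _))
  ι-⊖ (suc m) zero    = trans (ι-+ (suc m)) (sym (trans (+-congˡ -0#≈0#) (+-identityʳ _)))
  ι-⊖ (suc m) (suc n) = begin
    ι (suc m ℤ.⊖ suc n)          ≡⟨ ≡.cong ι (ℤₚ.[1+m]⊖[1+n]≡m⊖n m n) ⟩
    ι (m ℤ.⊖ n)                  ≈⟨ ι-⊖ m n ⟩
    m ⋅ 1# - n ⋅ 1#              ≈⟨ cancelˡ 1# _ _ ⟨
    suc m ⋅ 1# - suc n ⋅ 1#      ∎

  ι-+-homo : ∀ x y → ι (x ℤ.+ y) ≈ ι x + ι y
  ι-+-homo (+ m) (+ n) = begin
    ι (+ (m ℕ.+ n))    ≈⟨ ι-+ (m ℕ.+ n) ⟩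
    (m ℕ.+ n) ⋅ 1#     ≈⟨ ×-homo-+ 1# m n ⟩
    m ⋅ 1# + n ⋅ 1#    ≈⟨ +-cong (ι-+ m) (ι-+ n) ⟨
    ι (+ m) + ι (+ n)  ∎
  ι-+-homo (+ m) -[1+ n ] =
    trans (ι-⊖ m (suc n)) (sym (+-cong (ι-+ m) (-‿cong (ι-+ (suc n)))))
  ι-+-homo -[1+ m ] (+ n) =
    trans (ι-⊖ n (suc m)) (trans (+-comm _ _) (sym (+-cong (-‿cong (ι-+ (suc m))) (ι-+ n))))
  ι-+-homo -[1+ m ] -[1+ n ] = begin
    - ι (+ (suc (suc (m ℕ.+ n))))    ≈⟨ -‿cong (ι-+ (suc (suc (m ℕ.+ n)))) ⟩
    - (suc (suc (m ℕ.+ n)) ⋅ 1#)     ≈⟨ -‿cong (×-congˡ (≡.cong suc (≡.sym (ℕₚ.+-suc m n)))) ⟩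
    - ((suc m ℕ.+ suc n) ⋅ 1#)       ≈⟨ -‿cong (×-homo-+ 1# (suc m) (suc n)) ⟩
    - (suc m ⋅ 1# + suc n ⋅ 1#)      ≈⟨ ⁻¹-∙-comm _ _ ⟨
    - (suc m ⋅ 1#) - (suc n ⋅ 1#)    ≈⟨ +-cong (-‿cong (ι-+ (suc m))) (-‿cong (ι-+ (suc n))) ⟨
    ι -[1+ m ] + ι -[1+ n ]          ∎
    where import Data.Nat.Properties as ℕₚ

  ι-*⁺ : ∀ m n → ι (+ m ℤ.* + n) ≈ ι (+ m) * ι (+ n)
  ι-*⁺ m n = begin
    ι (+ m ℤ.* + n)          ≡⟨ ≡.cong ι (≡.sym (ℤₚ.pos-* m n)) ⟩
    ι (+ (m ℕ.* n))          ≈⟨ ι-+ (m ℕ.* n) ⟩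
    (m ℕ.* n) ⋅ 1#           ≈⟨ ×1-homo-* m n ⟩
    m ⋅ 1# * n ⋅ 1#          ≈⟨ *-cong (ι-+ m) (ι-+ n) ⟨
    ι (+ m) * ι (+ n)        ∎

  ι-*-negʳ : ∀ x y → ι (x ℤ.* y) ≈ ι x * ι y → ι (x ℤ.* (ℤ.- y)) ≈ ι x * ι (ℤ.- y)
  ι-*-negʳ x y p = begin
    ι (x ℤ.* (ℤ.- y))    ≡⟨ ≡.cong ι (≡.sym (ℤₚ.neg-distribʳ-* x y)) ⟩
    ι (ℤ.- (x ℤ.* y))    ≈⟨ ι-neg (x ℤ.* y) ⟩
    - ι (x ℤ.* y)        ≈⟨ -‿cong p ⟩
    - (ι x * ι y)        ≈⟨ -‿distribʳ-* _ _ ⟩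
    ι x * - ι y          ≈⟨ *-congˡ (ι-neg y) ⟨
    ι x * ι (ℤ.- y)      ∎

  ι-*-negˡ : ∀ x y → ι (x ℤ.* y) ≈ ι x * ι y → ι ((ℤ.- x) ℤ.* y) ≈ ι (ℤ.- x) * ι y
  ι-*-negˡ x y p = begin
    ι ((ℤ.- x) ℤ.* y)    ≡⟨ ≡.cong ι (ℤₚ.*-comm (ℤ.- x) y) ⟩
    ι (y ℤ.* (ℤ.- x))    ≈⟨ ι-*-negʳ y x (trans (reflexive (≡.cong ι (ℤₚ.*-comm y x))) (trans p (*-comm _ _))) ⟩
    ι y * ι (ℤ.- x)      ≈⟨ *-comm _ _ ⟩
    ι (ℤ.- x) * ι y      ∎

  ι-*⁺ʳ : ∀ m y → ι (+ m ℤ.* y) ≈ ι (+ m) * ι y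
  ι-*⁺ʳ m (+ n)    = ι-*⁺ m n
  ι-*⁺ʳ m -[1+ n ] = ι-*-negʳ (+ m) (+ suc n) (ι-*⁺ m (suc n))

  ι-*-homo : ∀ x y → ι (x ℤ.* y) ≈ ι x * ι y
  ι-*-homo (+ m)    y = ι-*⁺ʳ m y
  ι-*-homo -[1+ m ] y = ι-*-negˡ (+ suc m) y (ι-*⁺ʳ (suc m) y)

  morphism : ℤ.+-*-rawRing -Raw-AlmostCommutative⟶ fromCommutativeRing R
  morphism = record
    { ⟦_⟧ = ι
    ; +-homo = ι-+-homo
    ; *-homo = ι-*-homo
    ; -‿homo = ι-neg
    ; 0-homo = refl
    ; 1-homo = refl
    }

  -- Coefficients are compared in ℤ because equality in `R` need not be decidable. This is sound,
  -- and only identities that depend on the characteristic of `R` are missed.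
  coeff≟ : ∀ x y → Maybe (ι x ≈ ι y)
  coeff≟ x y with x ℤₚ.≟ y
  ... | yes x≡y = just (reflexive (≡.cong ι x≡y))
  ... | no  _   = nothing

  open RingSolver ℤ.+-*-rawRing (fromCommutativeRing R) morphism coeff≟ public
    using (solve; _:=_; _:+_; _:*_; _:-_; :-_; con; Polynomial)

  :0 :1 : ∀ {n} → Polynomial n
  :0 = con (+ 0)
  :1 = con (+ 1)

-- Algebra of 2 × 2 matrices over a commutative ring

module MatrixProperties (R : CommutativeRing 0ℓ 0ℓ) where
  open CommutativeRing R
  open Matrices R
  open IntegerCoefficients R

  ≈ᴹ-setoid : Setoid 0ℓ 0ℓ
  ≈ᴹ-setoid = record
    { Carrier = Mat₂ Carrier
    ; _≈_ = _≈ᴹ_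
    ; isEquivalence = record
      { refl  = refl , refl , refl , refl
      ; sym   = λ (a , b , c , d) → sym a , sym b , sym c , sym d
      ; trans = λ (a , b , c , d) (a′ , b′ , c′ , d′) → trans a a′ , trans b b′ , trans c c′ , trans d d′
      }
    }

  open Setoid ≈ᴹ-setoid public using () renaming (refl to ≈ᴹ-refl; sym to ≈ᴹ-sym; trans to ≈ᴹ-trans)

  infix 4 _≈ⱽ_
  _≈ⱽ_ : Carrier × Carrier → Carrier × Carrier → Set
  (x , y) ≈ⱽ (x′ , y′) = x ≈ x′ × y ≈ y′

  ≈ⱽ-sym : ∀ {u w} → u ≈ⱽ w → w ≈ⱽ u
  ≈ⱽ-sym (p , q) = sym p , sym q

  ≈ⱽ-trans : ∀ {u w z} → u ≈ⱽ w → w ≈ⱽ z → u ≈ⱽ z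
  ≈ⱽ-trans (p , q) (p′ , q′) = trans p p′ , trans q q′

  *ᴹ-cong : ∀ {M M′ N N′} → M ≈ᴹ M′ → N ≈ᴹ N′ → M *ᴹ N ≈ᴹ M′ *ᴹ N′
  *ᴹ-cong (a , b , c , d) (a′ , b′ , c′ , d′) =
    +-cong (*-cong a a′) (*-cong b c′) , +-cong (*-cong a b′) (*-cong b d′) ,
    +-cong (*-cong c a′) (*-cong d c′) , +-cong (*-cong c b′) (*-cong d d′)

  *ᴹ-congˡ : ∀ {M N N′} → N ≈ᴹ N′ → M *ᴹ N ≈ᴹ M *ᴹ N′
  *ᴹ-congˡ = *ᴹ-cong ≈ᴹ-refl

  *ᴹ-congʳ : ∀ {M M′ N} → M ≈ᴹ M′ → M *ᴹ N ≈ᴹ M′ *ᴹ N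
  *ᴹ-congʳ p = *ᴹ-cong p ≈ᴹ-refl

  *ⱽ-cong : ∀ {M M′ u w} → M ≈ᴹ M′ → u ≈ⱽ w → M *ⱽ u ≈ⱽ M′ *ⱽ w
  *ⱽ-cong (a , b , c , d) (x , y) = +-cong (*-cong a x) (*-cong b y) , +-cong (*-cong c x) (*-cong d y)

  private
    -- A row times a matrix times a column: this one identity gives every entry of both
    -- associativity laws.
    assoc-entry : ∀ a b a′ b′ c′ d′ x y →
      (a * a′ + b * c′) * x + (a * b′ + b * d′) * y ≈ a * (a′ * x + b′ * y) + b * (c′ * x + d′ * y)
    assoc-entry = solve 8 (λ a b a′ b′ c′ d′ x y →
      (a :* a′ :+ b :* c′) :* x :+ (a :* b′ :+ b :* d′) :* y :=
      a :* (a′ :* x :+ b′ :* y) :+ b :* (c′ :* x :+ d′ :* y)) refl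

    1-0-comb : ∀ x y → 1# * x + 0# * y ≈ x
    1-0-comb = solve 2 (λ x y → :1 :* x :+ :0 :* y := x) refl

    0-1-comb : ∀ x y → 0# * x + 1# * y ≈ y
    0-1-comb = solve 2 (λ x y → :0 :* x :+ :1 :* y := y) refl

    comb-1-0 : ∀ x y → x * 1# + y * 0# ≈ x
    comb-1-0 = solve 2 (λ x y → x :* :1 :+ y :* :0 := x) refl

    comb-0-1 : ∀ x y → x * 0# + y * 1# ≈ y
    comb-0-1 = solve 2 (λ x y → x :* :0 :+ y :* :1 := y) refl

  *ᴹ-assoc : ∀ L M N → (L *ᴹ M) *ᴹ N ≈ᴹ L *ᴹ (M *ᴹ N)
  *ᴹ-assoc (mat a b c d) (mat a′ b′ c′ d′) (mat x y z w) =
    assoc-entry a b a′ b′ c′ d′ x z , assoc-entry a b a′ b′ c′ d′ y w ,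
    assoc-entry c d a′ b′ c′ d′ x z , assoc-entry c d a′ b′ c′ d′ y w

  *ⱽ-assoc : ∀ M N u → (M *ᴹ N) *ⱽ u ≈ⱽ M *ⱽ (N *ⱽ u)
  *ⱽ-assoc (mat a b c d) (mat a′ b′ c′ d′) (x , y) =
    assoc-entry a b a′ b′ c′ d′ x y , assoc-entry c d a′ b′ c′ d′ x y

  *ᴹ-identityˡ : ∀ M → 1ᴹ *ᴹ M ≈ᴹ M
  *ᴹ-identityˡ (mat a b c d) = 1-0-comb a c , 1-0-comb b d , 0-1-comb a c , 0-1-comb b d

  *ᴹ-identityʳ : ∀ M → M *ᴹ 1ᴹ ≈ᴹ M
  *ᴹ-identityʳ (mat a b c d) = comb-1-0 a b , comb-0-1 a b , comb-1-0 c d , comb-0-1 c d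

  *ⱽ-identityˡ : ∀ u → 1ᴹ *ⱽ u ≈ⱽ u
  *ⱽ-identityˡ (x , y) = 1-0-comb x y , 0-1-comb x y

  open SetoidReasoning ≈ᴹ-setoid

  conjugate⇒intertwine : ∀ {M N P Q} → Q *ᴹ P ≈ᴹ 1ᴹ → M ≈ᴹ P *ᴹ N *ᴹ Q → M *ᴹ P ≈ᴹ P *ᴹ N
  conjugate⇒intertwine {M} {N} {P} {Q} QP≈1 M≈PNQ = begin
    M *ᴹ P                ≈⟨ *ᴹ-congʳ M≈PNQ ⟩
    P *ᴹ N *ᴹ Q *ᴹ P      ≈⟨ *ᴹ-assoc (P *ᴹ N) Q P ⟩
    P *ᴹ N *ᴹ (Q *ᴹ P)    ≈⟨ *ᴹ-congˡ QP≈1 ⟩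
    P *ᴹ N *ᴹ 1ᴹ          ≈⟨ *ᴹ-identityʳ (P *ᴹ N) ⟩
    P *ᴹ N                ∎

  intertwine⇒conjugate : ∀ {M N P Q} → P *ᴹ Q ≈ᴹ 1ᴹ → M *ᴹ P ≈ᴹ P *ᴹ N → M ≈ᴹ P *ᴹ N *ᴹ Q
  intertwine⇒conjugate {M} {N} {P} {Q} PQ≈1 MP≈PN = begin
    M                     ≈⟨ *ᴹ-identityʳ M ⟨
    M *ᴹ 1ᴹ               ≈⟨ *ᴹ-congˡ PQ≈1 ⟨
    M *ᴹ (P *ᴹ Q)         ≈⟨ *ᴹ-assoc M P Q ⟨
    M *ᴹ P *ᴹ Q           ≈⟨ *ᴹ-congʳ MP≈PN ⟩
    P *ᴹ N *ᴹ Q           ∎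

  GL₂-inverse : GL₂ → GL₂
  GL₂-inverse P = record { matrix = inverse ; inverse = matrix ; inverseʳ = inverseˡ ; inverseˡ = inverseʳ }
    where open GL₂ P

  GL₂-* : GL₂ → GL₂ → GL₂
  GL₂-* P Q = record
    { matrix = P.matrix *ᴹ Q.matrix
    ; inverse = Q.inverse *ᴹ P.inverse
    ; inverseʳ = cancel P.matrix Q.matrix Q.inverse P.inverse Q.inverseʳ P.inverseʳ
    ; inverseˡ = cancel Q.inverse P.inverse P.matrix Q.matrix P.inverseˡ Q.inverseˡ
    }
    where
    module P = GL₂ P
    module Q = GL₂ Q
    cancel : ∀ K L M N → L *ᴹ M ≈ᴹ 1ᴹ → K *ᴹ N ≈ᴹ 1ᴹ → K *ᴹ L *ᴹ (M *ᴹ N) ≈ᴹ 1ᴹ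
    cancel K L M N LM≈1 KN≈1 = begin
      K *ᴹ L *ᴹ (M *ᴹ N)      ≈⟨ *ᴹ-assoc K L (M *ᴹ N) ⟩
      K *ᴹ (L *ᴹ (M *ᴹ N))    ≈⟨ *ᴹ-congˡ (*ᴹ-assoc L M N) ⟨
      K *ᴹ (L *ᴹ M *ᴹ N)      ≈⟨ *ᴹ-congˡ (*ᴹ-congʳ LM≈1) ⟩
      K *ᴹ (1ᴹ *ᴹ N)          ≈⟨ *ᴹ-congˡ (*ᴹ-identityˡ N) ⟩
      K *ᴹ N                  ≈⟨ KN≈1 ⟩
      1ᴹ                      ∎

-- Isomorphisms, subrepresentations and triangular representations

module RepresentationProperties (G : Group 0ℓ 0ℓ) (R : CommutativeRing 0ℓ 0ℓ) where
  open Group G using (_∙_) renaming (Carrier to ∣G∣; _≈_ to _≈ᴳ_)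
  open CommutativeRing R
  open Matrices R
  open MatrixProperties R
  open Representations G R hiding (Character; Representation)
  open IntegerCoefficients R using (solve; _:=_; _:+_; _:*_; :0)
  open Representation

  -- The form of conjugacy without inverses. It is multiplicative in the group element, so checking
  -- it on generators is enough, and it survives reduction entry by entry.
  Intertwines : Mat₂ Carrier → Representation G R → Representation G R → ∣G∣ → Set
  Intertwines P φ ψ g = ρ φ g *ᴹ P ≈ᴹ P *ᴹ ρ ψ g

  module _ {φ ψ : Representation G R} where
    open SetoidReasoning ≈ᴹ-setoid

    ≅-fromIntertwiner : (P : GL₂) → (∀ g → Intertwines (GL₂.matrix P) φ ψ g) → φ ≅ ψ
    ≅-fromIntertwiner P φP≈Pψ = P , λ g → intertwine⇒conjugate (GL₂.inverseʳ P) (φP≈Pψ g)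

    ≅-intertwines : ((P , _) : φ ≅ ψ) → ∀ g → Intertwines (GL₂.matrix P) φ ψ g
    ≅-intertwines (P , φ≈PψQ) g = conjugate⇒intertwine (GL₂.inverseˡ P) (φ≈PψQ g)

    intertwines-cong : ∀ {P g h} → g ≈ᴳ h → Intertwines P φ ψ g → Intertwines P φ ψ h
    intertwines-cong {P} {g} {h} g≈h φP≈Pψ = begin
      ρ φ h *ᴹ P      ≈⟨ *ᴹ-congʳ (ρ-cong φ g≈h) ⟨
      ρ φ g *ᴹ P      ≈⟨ φP≈Pψ ⟩
      P *ᴹ ρ ψ g      ≈⟨ *ᴹ-congˡ (ρ-cong ψ g≈h) ⟩
      P *ᴹ ρ ψ h      ∎

    intertwines-∙ : ∀ {P g h} → Intertwines P φ ψ g → Intertwines P φ ψ h → Intertwines P φ ψ (g ∙ h)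
    intertwines-∙ {P} {g} {h} gP≈Pg hP≈Ph = begin
      ρ φ (g ∙ h) *ᴹ P            ≈⟨ *ᴹ-congʳ (ρ-∙ φ g h) ⟩
      ρ φ g *ᴹ ρ φ h *ᴹ P         ≈⟨ *ᴹ-assoc (ρ φ g) (ρ φ h) P ⟩
      ρ φ g *ᴹ (ρ φ h *ᴹ P)       ≈⟨ *ᴹ-congˡ hP≈Ph ⟩
      ρ φ g *ᴹ (P *ᴹ ρ ψ h)       ≈⟨ *ᴹ-assoc (ρ φ g) P (ρ ψ h) ⟨
      ρ φ g *ᴹ P *ᴹ ρ ψ h         ≈⟨ *ᴹ-congʳ gP≈Pg ⟩
      P *ᴹ ρ ψ g *ᴹ ρ ψ h         ≈⟨ *ᴹ-assoc P (ρ ψ g) (ρ ψ h) ⟩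
      P *ᴹ (ρ ψ g *ᴹ ρ ψ h)       ≈⟨ *ᴹ-congˡ (ρ-∙ ψ g h) ⟨
      P *ᴹ ρ ψ (g ∙ h)            ∎

  ≅-sym : ∀ {φ ψ} → φ ≅ ψ → ψ ≅ φ
  ≅-sym {φ} {ψ} φ≅ψ@(P , _) = GL₂-inverse P , λ g →
    intertwine⇒conjugate {P = Q} (GL₂.inverseˡ P) (≈ᴹ-sym (Qφ≈ψQ g))
    where
    Q : Mat₂ Carrier
    Q = GL₂.inverse P
    open SetoidReasoning ≈ᴹ-setoid
    Qφ≈ψQ : ∀ g → Q *ᴹ ρ φ g ≈ᴹ ρ ψ g *ᴹ Q
    Qφ≈ψQ g = begin
      Q *ᴹ ρ φ g                             ≈⟨ *ᴹ-congˡ (proj₂ φ≅ψ g) ⟩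
      Q *ᴹ (GL₂.matrix P *ᴹ ρ ψ g *ᴹ Q)      ≈⟨ *ᴹ-assoc Q (GL₂.matrix P *ᴹ ρ ψ g) Q ⟨
      Q *ᴹ (GL₂.matrix P *ᴹ ρ ψ g) *ᴹ Q      ≈⟨ *ᴹ-congʳ (*ᴹ-assoc Q (GL₂.matrix P) (ρ ψ g)) ⟨
      Q *ᴹ GL₂.matrix P *ᴹ ρ ψ g *ᴹ Q        ≈⟨ *ᴹ-congʳ (*ᴹ-congʳ (GL₂.inverseˡ P)) ⟩
      1ᴹ *ᴹ ρ ψ g *ᴹ Q                       ≈⟨ *ᴹ-congʳ (*ᴹ-identityˡ (ρ ψ g)) ⟩
      ρ ψ g *ᴹ Q                             ∎

  ≅-trans : ∀ {φ ψ θ} → φ ≅ ψ → ψ ≅ θ → φ ≅ θ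
  ≅-trans {φ} {ψ} {θ} φ≅ψ@(P , _) ψ≅θ@(P′ , _) = ≅-fromIntertwiner {φ} {θ} (GL₂-* P P′) λ g → begin
    ρ φ g *ᴹ (M *ᴹ M′)      ≈⟨ *ᴹ-assoc (ρ φ g) M M′ ⟨
    ρ φ g *ᴹ M *ᴹ M′        ≈⟨ *ᴹ-congʳ (≅-intertwines {φ} {ψ} φ≅ψ g) ⟩
    M *ᴹ ρ ψ g *ᴹ M′        ≈⟨ *ᴹ-assoc M (ρ ψ g) M′ ⟩
    M *ᴹ (ρ ψ g *ᴹ M′)      ≈⟨ *ᴹ-congˡ (≅-intertwines {ψ} {θ} ψ≅θ g) ⟩
    M *ᴹ (M′ *ᴹ ρ θ g)      ≈⟨ *ᴹ-assoc M M′ (ρ θ g) ⟨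
    M *ᴹ M′ *ᴹ ρ θ g        ∎
    where
    open SetoidReasoning ≈ᴹ-setoid
    M M′ : Mat₂ Carrier
    M  = GL₂.matrix P
    M′ = GL₂.matrix P′

  0ⱽ : Carrier × Carrier
  0ⱽ = 0# , 0#

  *ⱽ-zeroʳ : ∀ M → M *ⱽ 0ⱽ ≈ⱽ 0ⱽ
  *ⱽ-zeroʳ (mat a b c d) = vanish a b , vanish c d
    where
    vanish : ∀ x y → x * 0# + y * 0# ≈ 0#
    vanish = solve 2 (λ x y → x :* :0 :+ y :* :0 := :0) refl

  *ⱽ-distribˡ : ∀ M x y x′ y′ →
    M *ⱽ (x + x′ , y + y′) ≈ⱽ (proj₁ (M *ⱽ (x , y)) + proj₁ (M *ⱽ (x′ , y′)) , proj₂ (M *ⱽ (x , y)) + proj₂ (M *ⱽ (x′ , y′)))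
  *ⱽ-distribˡ (mat a b c d) x y x′ y′ = entry a b x y x′ y′ , entry c d x y x′ y′
    where
    entry : ∀ a b x y x′ y′ → a * (x + x′) + b * (y + y′) ≈ (a * x + b * y) + (a * x′ + b * y′)
    entry = solve 6 (λ a b x y x′ y′ →
      a :* (x :+ x′) :+ b :* (y :+ y′) := (a :* x :+ b :* y) :+ (a :* x′ :+ b :* y′)) refl

  *ⱽ-scale : ∀ M c x y → M *ⱽ (c * x , c * y) ≈ⱽ (c * proj₁ (M *ⱽ (x , y)) , c * proj₂ (M *ⱽ (x , y)))
  *ⱽ-scale (mat a b a′ b′) c x y = entry a b c x y , entry a′ b′ c x y
    where
    entry : ∀ a b c x y → a * (c * x) + b * (c * y) ≈ c * (a * x + b * y)
    entry = solve 5 (λ a b c x y → a :* (c :* x) :+ b :* (c :* y) := c :* (a :* x :+ b :* y)) refl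

  module _ {φ : Representation G R} (S : Subrepresentation φ) where
    open Subrepresentation S

    ∈S-resp : ∀ {u w} → u ≈ⱽ w → u ∈S → w ∈S
    ∈S-resp (p , q) = ∈-resp p q

  inverse-cancelˡ : ∀ {P Q} → Q *ᴹ P ≈ᴹ 1ᴹ → ∀ u → Q *ⱽ (P *ⱽ u) ≈ⱽ u
  inverse-cancelˡ {P} {Q} QP≈1 u = ≈ⱽ-trans (≈ⱽ-sym (*ⱽ-assoc Q P u))
    (≈ⱽ-trans (*ⱽ-cong QP≈1 (refl , refl)) (*ⱽ-identityˡ u))

  *ⱽ-injective : ∀ {P Q} → Q *ᴹ P ≈ᴹ 1ᴹ → ∀ {u} → P *ⱽ u ≈ⱽ 0ⱽ → u ≈ⱽ 0ⱽ
  *ⱽ-injective {P} {Q} QP≈1 {u} Pu≈0 = ≈ⱽ-trans (≈ⱽ-sym (inverse-cancelˡ QP≈1 u))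
    (≈ⱽ-trans (*ⱽ-cong {Q} ≈ᴹ-refl Pu≈0) (*ⱽ-zeroʳ Q))

  module _ {φ ψ : Representation G R} (φ≅ψ : φ ≅ ψ) where
    private
      P Q : Mat₂ Carrier
      P = GL₂.matrix (proj₁ φ≅ψ)
      Q = GL₂.inverse (proj₁ φ≅ψ)
      QP≈1 : Q *ᴹ P ≈ᴹ 1ᴹ
      QP≈1 = GL₂.inverseˡ (proj₁ φ≅ψ)
      PQ≈1 : P *ᴹ Q ≈ᴹ 1ᴹ
      PQ≈1 = GL₂.inverseʳ (proj₁ φ≅ψ)

    module _ (S : Subrepresentation φ) where
      open Subrepresentation S

      -- Taking preimages under `P` instead of images under `Q` turns membership into membership in
      -- `S`, so the closure properties involve no choice of preimages.
      pullback : Subrepresentation ψ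
      pullback = record
        { _∈S    = λ u → P *ⱽ u ∈S
        ; ∈-resp = λ p q → ∈S-resp S (*ⱽ-cong {P} ≈ᴹ-refl (p , q))
        ; 0∈     = ∈S-resp S (≈ⱽ-sym (*ⱽ-zeroʳ P)) 0∈
        ; +∈     = λ u∈ w∈ → ∈S-resp S (≈ⱽ-sym (*ⱽ-distribˡ P _ _ _ _)) (+∈ u∈ w∈)
        ; *∈     = λ c u∈ → ∈S-resp S (≈ⱽ-sym (*ⱽ-scale P c _ _)) (*∈ c u∈)
        ; ρ∈     = λ g {u} u∈ → ∈S-resp S
            (≈ⱽ-trans (≈ⱽ-sym (*ⱽ-assoc (ρ φ g) P u))
              (≈ⱽ-trans (*ⱽ-cong (≅-intertwines {φ} {ψ} φ≅ψ g) (refl , refl)) (*ⱽ-assoc P (ρ ψ g) u)))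
            (ρ∈ g u∈)
        }

      pullback-∋ : ∀ {u} → u ∈S → P *ⱽ (Q *ⱽ u) ∈S
      pullback-∋ {u} = ∈S-resp S (≈ⱽ-sym (inverse-cancelˡ PQ≈1 u))

      pullback-nonzero : IsNonzero → Subrepresentation.IsNonzero pullback
      pullback-nonzero (x , y , u∈ , u≉0) = _ , _ , pullback-∋ u∈ , u≉0 ∘ *ⱽ-injective PQ≈1

      pullback-proper : IsProper → Subrepresentation.IsProper pullback
      pullback-proper (u , u∉) = Q *ⱽ u , u∉ ∘ ∈S-resp S (inverse-cancelˡ PQ≈1 u)

    reducible-≅ : Reducible φ → Reducible ψ
    reducible-≅ (S , nonzero , proper) = pullback S , pullback-nonzero S nonzero , pullback-proper S proper

    decomposable-≅ : Decomposable φ → Decomposable ψ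
    decomposable-≅ D = record
      { S = pullback S
      ; T = pullback T
      ; S-nonzero = pullback-nonzero S S-nonzero
      ; T-nonzero = pullback-nonzero T T-nonzero
      ; S∩T≈0 = λ u∈S u∈T → *ⱽ-injective QP≈1 (S∩T≈0 u∈S u∈T)
      ; S+T = λ x y →
          let (s , t , s∈ , t∈ , x≈ , y≈) = S+T (proj₁ (P *ⱽ (x , y))) (proj₂ (P *ⱽ (x , y)))
              (p , q) = ≈ⱽ-trans (≈ⱽ-sym (inverse-cancelˡ QP≈1 (x , y)))
                (≈ⱽ-trans (*ⱽ-cong {Q} ≈ᴹ-refl (x≈ , y≈)) (*ⱽ-distribˡ Q _ _ _ _))
          in Q *ⱽ s , Q *ⱽ t , pullback-∋ S s∈ , pullback-∋ T t∈ , p , q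
      }
      where open Decomposable D

  decomposable⇒reducible : ∀ {φ} → Decomposable φ → Reducible φ
  decomposable⇒reducible D = S , S-nonzero ,
    (let (x , y , t∈T , t≉0) = T-nonzero in (x , y) , λ t∈S → t≉0 (S∩T≈0 t∈S t∈T))
    where open Decomposable D

  module _ (φ : Representation G R) (e₂₁≈0 : ∀ g → e₂₁ (ρ φ g) ≈ 0#) where
    private
      drop : ∀ {x y z} → y ≈ 0# → x + z * y ≈ x
      drop y≈0 = trans (+-congˡ (trans (*-congˡ y≈0) (zeroʳ _))) (+-identityʳ _)

    first-line : Subrepresentation φ
    first-line = record
      { _∈S    = λ u → proj₂ u ≈ 0#
      ; ∈-resp = λ _ y≈y′ y≈0 → trans (sym y≈y′) y≈0
      ; 0∈     = refl
      ; +∈     = λ y≈0 y′≈0 → trans (+-cong y≈0 y′≈0) (+-identityʳ 0#)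
      ; *∈     = λ c y≈0 → trans (*-congˡ y≈0) (zeroʳ c)
      ; ρ∈     = λ g y≈0 → trans (drop y≈0) (trans (*-congʳ (e₂₁≈0 g)) (zeroˡ _))
      }

    triangular-reducible : ¬ (1# ≈ 0#) → Reducible φ
    triangular-reducible 1≉0 = first-line , (1# , 0# , refl , 1≉0 ∘ proj₁) , (0# , 1#) , 1≉0

    diagonal₁ diagonal₂ : Character G R
    diagonal₁ = record
      { χ      = e₁₁ ∘ ρ φ
      ; χ-cong = λ g≈h → proj₁ (ρ-cong φ g≈h)
      ; χ-∙    = λ g h → trans (proj₁ (ρ-∙ φ g h)) (drop (e₂₁≈0 h))
      ; χ-ε    = proj₁ (ρ-ε φ)
      }
    diagonal₂ = record
      { χ      = e₂₂ ∘ ρ φ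
      ; χ-cong = λ g≈h → proj₂ (proj₂ (proj₂ (ρ-cong φ g≈h)))
      ; χ-∙    = λ g h → trans (proj₂ (proj₂ (proj₂ (ρ-∙ φ g h))))
          (trans (+-congʳ (trans (*-congʳ (e₂₁≈0 g)) (zeroˡ _))) (+-identityˡ _))
      ; χ-ε    = proj₂ (proj₂ (proj₂ (ρ-ε φ)))
      }

  module _ (θ₁ θ₂ : Character G R) (1≉0 : ¬ (1# ≈ 0#)) where
    private
      second-line : Subrepresentation (θ₁ ⊕ θ₂)
      second-line = record
        { _∈S    = λ u → proj₁ u ≈ 0#
        ; ∈-resp = λ x≈x′ _ x≈0 → trans (sym x≈x′) x≈0
        ; 0∈     = refl
        ; +∈     = λ x≈0 x′≈0 → trans (+-cong x≈0 x′≈0) (+-identityʳ 0#)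
        ; *∈     = λ c x≈0 → trans (*-congˡ x≈0) (zeroʳ c)
        ; ρ∈     = λ g x≈0 → trans (+-cong (trans (*-congˡ x≈0) (zeroʳ _)) (zeroˡ _)) (+-identityʳ _)
        }

    ⊕-decomposable : Decomposable (θ₁ ⊕ θ₂)
    ⊕-decomposable = record
      { S = first-line (θ₁ ⊕ θ₂) (λ _ → refl)
      ; T = second-line
      ; S-nonzero = 1# , 0# , refl , 1≉0 ∘ proj₁
      ; T-nonzero = 0# , 1# , refl , 1≉0 ∘ proj₂
      ; S∩T≈0 = λ y≈0 x≈0 → x≈0 , y≈0
      ; S+T = λ x y → (x , 0#) , (0# , y) , refl , refl , sym (+-identityʳ x) , sym (+-identityˡ y)
      }

-- Linear algebra in the plane over a field

module FieldProperties (k : Field) where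
  open Field k
  open IntegerCoefficients commutativeRing using (solve; _:=_; _:+_; _:*_; _:-_; :-_; :0; :1)

  *-≉0 : ∀ {x y} → ¬ (x ≈ 0#) → ¬ (y ≈ 0#) → ¬ (x * y ≈ 0#)
  *-≉0 x≉0 y≉0 xy≈0 = y≉0 (noZeroDivisors xy≈0 x≉0)

  x*y≈1⇒x≉0 : ∀ {x y} → x * y ≈ 1# → ¬ (x ≈ 0#)
  x*y≈1⇒x≉0 xy≈1 x≈0 = 1≉0 (trans (sym xy≈1) (trans (*-congʳ x≈0) (zeroˡ _)))

  x²≈0⇒x≈0 : ∀ {x} → x * x ≈ 0# → x ≈ 0#
  x²≈0⇒x≈0 {x} x²≈0 with x ≟ 0#
  ... | yes x≈0 = x≈0
  ... | no  x≉0 = noZeroDivisors x²≈0 x≉0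

  x≈y⇒x-y≈0 : ∀ {x y} → x ≈ y → x - y ≈ 0#
  x≈y⇒x-y≈0 x≈y = trans (+-congʳ x≈y) (-‿inverseʳ _)

  x≉-x : ∀ {x} → ¬ (1# + 1# ≈ 0#) → ¬ (x ≈ 0#) → ¬ (x ≈ - x)
  x≉-x {x} 2≉0 x≉0 x≈-x = *-≉0 2≉0 x≉0
    (trans (solve 1 (λ x → (:1 :+ :1) :* x := x :- (:- x)) refl x) (x≈y⇒x-y≈0 x≈-x))

  module _ (G : Group 0ℓ 0ℓ) where
    open Group G using (inverseʳ) renaming (_⁻¹ to _⁻¹ᴳ)
    open Matrices commutativeRing
    open MatrixProperties commutativeRing
    open RepresentationProperties G commutativeRing
    open Representations G commutativeRing hiding (Character; Representation)
    open Representation using (ρ)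

    character≉0 : ∀ (θ : Character G commutativeRing) g → ¬ (Character.χ θ g ≈ 0#)
    character≉0 θ g = x*y≈1⇒x≉0 (trans (sym (χ-∙ g (g ⁻¹ᴳ))) (trans (χ-cong (inverseʳ g)) χ-ε))
      where open Character θ

    module _ {φ : Representation G commutativeRing} (S : Subrepresentation φ) where
      open Subrepresentation S

      -- Cramer's rule, with `i` the inverse of the determinant `δ`.
      independent⇒full : ∀ {x y x′ y′} → ¬ (x * y′ - x′ * y ≈ 0#) →
                         (x , y) ∈S → (x′ , y′) ∈S → ∀ u → u ∈S
      independent⇒full {x} {y} {x′} {y′} δ≉0 u∈ u′∈ (p , q) =
        ∈-resp (cramer₁ p q) (cramer₂ p q) (+∈ (*∈ ((p * y′ - x′ * q) * i) u∈) (*∈ ((x * q - p * y) * i) u′∈))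
        where
        δ i : Carrier
        δ = x * y′ - x′ * y
        i = δ ⁻¹
        δi≈1 : ∀ z → z * (δ * i) ≈ z
        δi≈1 z = trans (*-congˡ (*-inverseʳ δ≉0)) (*-identityʳ z)
        cramer₁ : ∀ p q → (p * y′ - x′ * q) * i * x + (x * q - p * y) * i * x′ ≈ p
        cramer₁ p q = trans (solve 7 (λ p q x y x′ y′ i →
          (p :* y′ :- x′ :* q) :* i :* x :+ (x :* q :- p :* y) :* i :* x′ :=
          p :* ((x :* y′ :- x′ :* y) :* i)) refl p q x y x′ y′ i) (δi≈1 p)
        cramer₂ : ∀ p q → (p * y′ - x′ * q) * i * y + (x * q - p * y) * i * y′ ≈ q
        cramer₂ p q = trans (solve 7 (λ p q x y x′ y′ i →
          (p :* y′ :- x′ :* q) :* i :* y :+ (x :* q :- p :* y) :* i :* y′ :=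
          q :* ((x :* y′ :- x′ :* y) :* i)) refl p q x y x′ y′ i) (δi≈1 q)

      -- If y ≉ 0, then φ g - a sends (x , y) to β y (1 , 0).
      unipotent⇒∋e₁ : ∀ {a β} g → ρ φ g ≈ᴹ mat a β 0# a → ¬ (β ≈ 0#) → IsNonzero → (1# , 0#) ∈S
      unipotent⇒∋e₁ {a} {β} g φg β≉0 (x , y , u∈ , u≉0) with y ≟ 0#
      ... | yes y≈0 = ∈-resp (trans (*-comm _ _) (*-inverseʳ x≉0)) (trans (*-congˡ y≈0) (zeroʳ _)) (*∈ (x ⁻¹) u∈)
        where
        x≉0 : ¬ (x ≈ 0#)
        x≉0 x≈0 = u≉0 (x≈0 , y≈0)
      ... | no  y≉0 = ∈-resp
        (trans (*-congˡ (solve 4 (λ a β x y → (a :* x :+ β :* y) :+ (:- a) :* x := β :* y) refl a β x y))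
          (trans (*-comm _ _) (*-inverseʳ (*-≉0 β≉0 y≉0))))
        (solve 4 (λ a x y i → i :* ((:0 :* x :+ a :* y) :+ (:- a) :* y) := :0) refl a x y _)
        (*∈ ((β * y) ⁻¹) (+∈ (∈S-resp S (*ⱽ-cong φg (refl , refl)) (ρ∈ g u∈)) (*∈ (- a) u∈)))
    -- A nontrivial Jordan block has (1 , 0) in each of its nonzero invariant subspaces, so two
    -- complementary ones cannot exist.
    unipotent-decomposable : ∀ {φ : Representation G commutativeRing} {a β} g →
      ρ φ g ≈ᴹ mat a β 0# a → Decomposable φ → β ≈ 0#
    unipotent-decomposable {β = β} g φg D with β ≟ 0#
    ... | yes β≈0 = β≈0
    ... | no  β≉0 = ⊥-elim (1≉0 (proj₁ (S∩T≈0
      (unipotent⇒∋e₁ S g φg β≉0 S-nonzero) (unipotent⇒∋e₁ T g φg β≉0 T-nonzero))))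
      where open Decomposable D

-- Representations induced from a subgroup of index two

module InductionProperties {G : Group 0ℓ 0ℓ} (I : IndexTwoSubgroup G) (k : Field) where
  open Group G using (_∙_; assoc; identityʳ; inverseʳ; ∙-congˡ; ∙-congʳ)
    renaming (Carrier to ∣G∣; _⁻¹ to _⁻¹ᴳ; _≈_ to _≈ᴳ_; refl to ≈ᴳ-refl; sym to ≈ᴳ-sym; trans to ≈ᴳ-trans)
  open GroupProperties G using (//-rightDividesˡ)
  open Field k hiding (_≉_)
  open FieldProperties k
  open IndexTwoSubgroup I
  open Induction I commutativeRing
  open Matrices commutativeRing
  open MatrixProperties commutativeRing
  open RepresentationProperties G commutativeRing
  open Representations G commutativeRing hiding (Character; Representation; _≋_)
  open Representations subgroup commutativeRing using (_≋_)
  open IntegerCoefficients commutativeRing using (solve; _:=_; _:+_; _:*_; _:-_; :-_; :0; :1)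
  open Representation using (ρ)

  module _ {φ ψ : Representation G commutativeRing} where

    -- An element outside `H` is (gσ⁻¹)σ, a product of two elements at which the intertwining
    -- relation is known.
    ≅-fromCosets : (P : GL₂) → ((h : H) → Intertwines (GL₂.matrix P) φ ψ (proj₁ h)) →
                   Intertwines (GL₂.matrix P) φ ψ σ → φ ≅ ψ
    ≅-fromCosets P onH onσ = ≅-fromIntertwiner {φ} {ψ} P λ g → everywhere g (coset g)
      where
      everywhere : ∀ g → g ∈H ⊎ g ∙ σ ⁻¹ᴳ ∈H → Intertwines (GL₂.matrix P) φ ψ g
      everywhere g (inj₁ g∈) = onH (g , g∈)
      everywhere g (inj₂ gσ⁻¹∈) = intertwines-cong {φ} {ψ} {GL₂.matrix P} (//-rightDividesˡ σ g)
        (intertwines-∙ {φ} {ψ} {GL₂.matrix P} (onH (g ∙ σ ⁻¹ᴳ , gσ⁻¹∈)) onσ)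

  module _ (φ : Representation G commutativeRing) (e₂₁≈0 : ∀ g → e₂₁ (ρ φ g) ≈ 0#) where
    private
      -- `(w , 1)` is to be the eigenvector of the triangular matrix `ρ φ σ` for its second
      -- eigenvalue, whence the denominator `e₂₂ - e₁₁`.
      δ w : Carrier
      δ = e₂₂ (ρ φ σ) - e₁₁ (ρ φ σ)
      w = e₁₂ (ρ φ σ) * δ ⁻¹

      shear : GL₂
      shear = record
        { matrix   = mat 1# w 0# 1#
        ; inverse  = mat 1# (- w) 0# 1#
        ; inverseʳ = unit , solve 1 (λ w → :1 :* (:- w) :+ w :* :1 := :0) refl w , zero₂₁ , unit′
        ; inverseˡ = unit , solve 1 (λ w → :1 :* w :+ (:- w) :* :1 := :0) refl w , zero₂₁ , unit′
        }
        where
        unit : ∀ {x} → 1# * 1# + x * 0# ≈ 1#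
        unit {x} = solve 1 (λ x → :1 :* :1 :+ x :* :0 := :1) refl x
        unit′ : ∀ {x} → 0# * x + 1# * 1# ≈ 1#
        unit′ {x} = solve 1 (λ x → :0 :* x :+ :1 :* :1 := :1) refl x
        zero₂₁ : 0# * 1# + 1# * 0# ≈ 0#
        zero₂₁ = solve 0 (:0 :* :1 :+ :1 :* :0 := :0) refl

      -- Of the four entries of the intertwining relation only the upper right one is a condition:
      -- it says that `(w , 1)` is an eigenvector of `ρ φ g`. For scalar `ρ φ g` it holds with any
      -- `w`.
      shear-intertwines : ∀ g → e₁₁ (ρ φ g) * w + e₁₂ (ρ φ g) ≈ w * e₂₂ (ρ φ g) →
        Intertwines (mat 1# w 0# 1#) φ (diagonal₁ φ e₂₁≈0 ⊕ diagonal₂ φ e₂₁≈0) g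
      shear-intertwines g eq =
        solve 3 (λ a b w → a :* :1 :+ b :* :0 := :1 :* a :+ w :* :0) refl a₁₁ (e₁₂ (ρ φ g)) w ,
        trans (+-congˡ (*-identityʳ _)) (trans eq (solve 2 (λ w z → w :* z := :1 :* :0 :+ w :* z) refl w a₂₂)) ,
        trans (+-congʳ (*-congʳ (e₂₁≈0 g))) (solve 2 (λ x z → :0 :* :1 :+ z :* :0 := :0 :* x :+ :1 :* :0) refl a₁₁ a₂₂) ,
        trans (+-congʳ (*-congʳ (e₂₁≈0 g))) (solve 2 (λ w z → :0 :* w :+ z :* :1 := :0 :* :0 :+ :1 :* z) refl w a₂₂)
        where
        a₁₁ a₂₂ : Carrier
        a₁₁ = e₁₁ (ρ φ g)
        a₂₂ = e₂₂ (ρ φ g)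

    triangular-splits :
      ((h : H) → e₁₂ (ρ φ (proj₁ h)) ≈ 0# × e₁₁ (ρ φ (proj₁ h)) ≈ e₂₂ (ρ φ (proj₁ h))) →
      ¬ (e₁₁ (ρ φ σ) ≈ e₂₂ (ρ φ σ)) →
      φ ≅ diagonal₁ φ e₂₁≈0 ⊕ diagonal₂ φ e₂₁≈0
    triangular-splits scalar e₁₁≉e₂₂ = ≅-fromCosets {φ} {diagonal₁ φ e₂₁≈0 ⊕ diagonal₂ φ e₂₁≈0} shear
      (λ h → shear-intertwines (proj₁ h) (let (e₁₂≈0 , e₁₁≈e₂₂) = scalar h in
        trans (+-cong (*-congʳ e₁₁≈e₂₂) e₁₂≈0) (trans (+-identityʳ _) (*-comm _ _))))
      (shear-intertwines σ (begin
        a₁₁ * w + a₁₂                    ≈⟨ +-congˡ (trans (*-congˡ (*-inverseʳ δ≉0)) (*-identityʳ a₁₂)) ⟨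
        a₁₁ * w + a₁₂ * (δ * δ ⁻¹)       ≈⟨ solve 4 (λ x y z i → x :* (y :* i) :+ y :* ((z :- x) :* i) := y :* i :* z) refl a₁₁ a₁₂ a₂₂ (δ ⁻¹) ⟩
        w * a₂₂                          ∎))
      where
      open SetoidReasoning setoid
      a₁₁ a₁₂ a₂₂ : Carrier
      a₁₁ = e₁₁ (ρ φ σ)
      a₁₂ = e₁₂ (ρ φ σ)
      a₂₂ = e₂₂ (ρ φ σ)
      δ≉0 : ¬ (δ ≈ 0#)
      δ≉0 = e₁₁≉e₂₂ ∘ sym ∘ x-y≈0⇒x≈y

  module _ (ξ : Character subgroup commutativeRing) where
    open Character ξ renaming (χ to ξ⟨_⟩; χ-cong to ξ-cong; χ-∙ to ξ-∙; χ-ε to ξ-ε)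
    open Character (ξ ^σ) using () renaming (χ to ξ^σ⟨_⟩)

    Ind-H : ∀ h → ρ (Ind ξ) (proj₁ h) ≈ᴹ mat ξ⟨ h ⟩ 0# 0# ξ^σ⟨ h ⟩
    Ind-H (g , g∈) with coset g
    -- `coset` produces its own proof of membership, which need not be `g∈`; `ξ-cong` bridges the
    -- two.
    ... | inj₁ _     = ξ-cong ≈ᴳ-refl , refl , refl , ξ-cong ≈ᴳ-refl
    ... | inj₂ gσ⁻¹∈ = ⊥-elim (∈σ⁻¹⇒∉ gσ⁻¹∈ g∈)

    Ind-σ : ρ (Ind ξ) σ ≈ᴹ mat 0# 1# ξ⟨ σ² ⟩ 0#
    Ind-σ with coset σ
    ... | inj₁ σ∈ = ⊥-elim (σ∉H σ∈)
    ... | inj₂ _  =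
      refl , trans (ξ-cong (inverseʳ σ)) ξ-ε ,
      ξ-cong (∙-congʳ (≈ᴳ-trans (∙-congˡ (inverseʳ σ)) (identityʳ σ))) , refl

    ξ-σhσ : ∀ h → ξ⟨ σ⟨ h ⟩σ ⟩ ≈ ξ^σ⟨ h ⟩ * ξ⟨ σ² ⟩
    ξ-σhσ (h , _) = trans (ξ-cong σhσ≈σhσ⁻¹σ²) (ξ-∙ _ _)
      where
      σhσ≈σhσ⁻¹σ² : σ ∙ h ∙ σ ≈ᴳ σ ∙ h ∙ σ ⁻¹ᴳ ∙ (σ ∙ σ)
      σhσ≈σhσ⁻¹σ² = ≈ᴳ-trans (∙-congʳ (≈ᴳ-sym (//-rightDividesˡ σ (σ ∙ h)))) (assoc _ _ _)

    ξ≉0 : ∀ h → ¬ (ξ⟨ h ⟩ ≈ 0#)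
    ξ≉0 = character≉0 subgroup ξ

    module _ (S : Subrepresentation (Ind ξ)) where
      open Subrepresentation S

      ∋-H : ∀ {x y} h → (x , y) ∈S → (ξ⟨ h ⟩ * x , ξ^σ⟨ h ⟩ * y) ∈S
      ∋-H {x} {y} h u∈ = ∈S-resp S
        (≈ⱽ-trans (*ⱽ-cong (Ind-H h) (refl , refl))
          (solve 3 (λ a x y → a :* x :+ :0 :* y := a :* x) refl ξ⟨ h ⟩ x y ,
           solve 3 (λ a x y → :0 :* x :+ a :* y := a :* y) refl ξ^σ⟨ h ⟩ x y))
        (ρ∈ (proj₁ h) u∈)

      ∋-σ : ∀ {x y} → (x , y) ∈S → (y , ξ⟨ σ² ⟩ * x) ∈S
      ∋-σ {x} {y} u∈ = ∈S-resp S
        (≈ⱽ-trans (*ⱽ-cong Ind-σ (refl , refl))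
          (solve 2 (λ x y → :0 :* x :+ :1 :* y := y) refl x y ,
           solve 3 (λ a x y → a :* x :+ :0 :* y := a :* x) refl ξ⟨ σ² ⟩ x y))
        (ρ∈ σ u∈)

      -- Unless u and Ind ξ σ u span everything, u is an eigenvector of Ind ξ σ
      -- with both coordinates nonzero, so it is no eigenvector of Ind ξ h if
      -- ξ h and ξ^σ h differ.
      proper⇒ : IsNonzero → IsProper → ξ ≋ ξ ^σ × Σ[ t ∈ Carrier ] t * t ≈ ξ⟨ σ² ⟩
      proper⇒ (x , y , u∈ , u≉0) (_ , w∉) = invariant , y * x ⁻¹ , t²≈s
        where
        s : Carrier
        s = ξ⟨ σ² ⟩
        open SetoidReasoning setoid

        full : {A : Set} {x y x′ y′ : Carrier} → (x , y) ∈S → (x′ , y′) ∈S → ¬ (x * y′ - x′ * y ≈ 0#) → A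
        full u∈ u′∈ δ≉0 = ⊥-elim (w∉ (independent⇒full G S δ≉0 u∈ u′∈ _))

        y²≈sx² : y * y ≈ s * (x * x)
        y²≈sx² with x * (s * x) - y * y ≟ 0#
        ... | yes δ≈0 = trans (sym (x-y≈0⇒x≈y δ≈0)) (solve 2 (λ x s → x :* (s :* x) := s :* (x :* x)) refl x s)
        ... | no  δ≉0 = full u∈ (∋-σ u∈) δ≉0

        x≉0 : ¬ (x ≈ 0#)
        x≉0 x≈0 = u≉0 (x≈0 , x²≈0⇒x≈0 (trans y²≈sx² (trans (*-congˡ (trans (*-congˡ x≈0) (zeroʳ x))) (zeroʳ s))))

        y≉0 : ¬ (y ≈ 0#)
        y≉0 y≈0 = *-≉0 (ξ≉0 σ²) (*-≉0 x≉0 x≉0) (trans (sym y²≈sx²) (trans (*-congˡ y≈0) (zeroʳ y)))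

        invariant : ξ ≋ ξ ^σ
        invariant h with ξ⟨ h ⟩ ≟ ξ^σ⟨ h ⟩
        ... | yes ξ≈ξ^σ = ξ≈ξ^σ
        ... | no  ξ≉ξ^σ = full u∈ (∋-H h u∈) λ δ≈0 →
          *-≉0 (*-≉0 x≉0 y≉0) (ξ≉ξ^σ ∘ sym ∘ x-y≈0⇒x≈y)
            (trans (solve 4 (λ x y a b → x :* y :* (b :- a) := x :* (b :* y) :- a :* x :* y) refl x y ξ⟨ h ⟩ ξ^σ⟨ h ⟩) δ≈0)

        t²≈s : y * x ⁻¹ * (y * x ⁻¹) ≈ s
        t²≈s = begin
          y * x ⁻¹ * (y * x ⁻¹)              ≈⟨ solve 2 (λ y i → y :* i :* (y :* i) := y :* y :* (i :* i)) refl y (x ⁻¹) ⟩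
          y * y * (x ⁻¹ * x ⁻¹)              ≈⟨ *-congʳ y²≈sx² ⟩
          s * (x * x) * (x ⁻¹ * x ⁻¹)        ≈⟨ solve 3 (λ s x i → s :* (x :* x) :* (i :* i) := s :* ((x :* i) :* (x :* i))) refl s x (x ⁻¹) ⟩
          s * ((x * x ⁻¹) * (x * x ⁻¹))      ≈⟨ *-congˡ (*-cong (*-inverseʳ x≉0) (*-inverseʳ x≉0)) ⟩
          s * (1# * 1#)                      ≈⟨ solve 1 (λ s → s :* (:1 :* :1) := s) refl s ⟩
          s                                  ∎

    -- The root is the slope of the invariant line: reducibility alone provides what is needed to
    -- split `Ind ξ` completely.
    Ind-reducible⇒ : Reducible (Ind ξ) → ξ ≋ ξ ^σ × Σ[ t ∈ Carrier ] t * t ≈ ξ⟨ σ² ⟩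
    Ind-reducible⇒ (S , nonzero , proper) = proper⇒ S nonzero proper

    module _ (ξ≋ξ^σ : ξ ≋ ξ ^σ) where

      -- (1 , t) is then an eigenvector of Ind ξ, with character e₁₁ + t e₁₂.
      module _ {t : Carrier} (t²≈s : t * t ≈ ξ⟨ σ² ⟩) where
        private
          E : ∣G∣ → Mat₂ Carrier
          E = ρ (Ind ξ)

        eigenvalue : ∣G∣ → Carrier
        eigenvalue g = e₁₁ (E g) + t * e₁₂ (E g)

        eigenvector : ∀ g → e₂₁ (E g) + t * e₂₂ (E g) ≈ t * eigenvalue g
        eigenvector g with coset g
        ... | inj₁ g∈ = trans (+-congˡ (*-congˡ (sym (ξ≋ξ^σ (g , g∈)))))
          (solve 2 (λ t x → :0 :+ t :* x := t :* (x :+ t :* :0)) refl t ξ⟨ g , g∈ ⟩)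
        ... | inj₂ g∈ = trans
          (+-congʳ (trans (ξ-σhσ h) (*-cong (sym (ξ≋ξ^σ h)) (sym t²≈s))))
          (solve 2 (λ t x → x :* (t :* t) :+ t :* :0 := t :* (:0 :+ t :* x)) refl t ξ⟨ h ⟩)
          where
          h : H
          h = g ∙ σ ⁻¹ᴳ , g∈

        eigencharacter : Character G commutativeRing
        eigencharacter = record
          { χ      = eigenvalue
          ; χ-cong = λ g≈h → let (p , q , _) = Representation.ρ-cong (Ind ξ) g≈h in +-cong p (*-congˡ q)
          ; χ-∙    = λ g h → let (p , q , _) = Representation.ρ-∙ (Ind ξ) g h in
              trans (+-cong p (*-congˡ q))
                -- Regroups as the first row of `E g` times the column `E h (1 , t)`, whose second
                -- coordinate `eigenvector h` rewrites as t times the first.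
                (trans (solve 7 (λ t a b a′ b′ c′ d′ →
                    (a :* a′ :+ b :* c′) :+ t :* (a :* b′ :+ b :* d′) :=
                    a :* (a′ :+ t :* b′) :+ b :* (c′ :+ t :* d′)) refl
                    t (e₁₁ (E g)) (e₁₂ (E g)) (e₁₁ (E h)) (e₁₂ (E h)) (e₂₁ (E h)) (e₂₂ (E h)))
                  (trans (+-congˡ (*-congˡ (eigenvector h)))
                    (solve 4 (λ t a b c → a :* c :+ b :* (t :* c) := (a :+ t :* b) :* c) refl
                      t (e₁₁ (E g)) (e₁₂ (E g)) (eigenvalue h))))
          ; χ-ε    = let (p , q , _) = Representation.ρ-ε (Ind ξ) in
              trans (+-cong p (*-congˡ q)) (solve 1 (λ t → :1 :+ t :* :0 := :1) refl t)
          }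

      module _ {t t′ : Carrier} (t²≈s : t * t ≈ ξ⟨ σ² ⟩) (t′²≈s : t′ * t′ ≈ ξ⟨ σ² ⟩) (t≉t′ : ¬ (t ≈ t′)) where
        private
          i : Carrier
          i = (t - t′) ⁻¹
          [t-t′]i≈1 : (t - t′) * i ≈ 1#
          [t-t′]i≈1 = *-inverseʳ (t≉t′ ∘ x-y≈0⇒x≈y)

        -- The columns are the eigenvectors (1 , t) and (1 , t′) belonging to the two roots.
        vandermonde : GL₂
        vandermonde = record
          { matrix   = mat 1# 1# t t′
          ; inverse  = mat (- t′ * i) i (t * i) (- i)
          ; inverseʳ =
              trans (solve 3 (λ t t′ i → :1 :* ((:- t′) :* i) :+ :1 :* (t :* i) := (t :- t′) :* i) refl t t′ i) [t-t′]i≈1 ,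
              solve 1 (λ i → :1 :* i :+ :1 :* (:- i) := :0) refl i ,
              solve 3 (λ t t′ i → t :* ((:- t′) :* i) :+ t′ :* (t :* i) := :0) refl t t′ i ,
              trans (solve 3 (λ t t′ i → t :* i :+ t′ :* (:- i) := (t :- t′) :* i) refl t t′ i) [t-t′]i≈1
          ; inverseˡ =
              trans (solve 3 (λ t t′ i → (:- t′) :* i :* :1 :+ i :* t := (t :- t′) :* i) refl t t′ i) [t-t′]i≈1 ,
              solve 2 (λ t′ i → (:- t′) :* i :* :1 :+ i :* t′ := :0) refl t′ i ,
              solve 2 (λ t i → t :* i :* :1 :+ (:- i) :* t := :0) refl t i ,
              trans (solve 3 (λ t t′ i → t :* i :* :1 :+ (:- i) :* t′ := (t :- t′) :* i) refl t t′ i) [t-t′]i≈1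
          }

        Ind-splits : Ind ξ ≅ eigencharacter t²≈s ⊕ eigencharacter t′²≈s
        Ind-splits = ≅-fromIntertwiner {Ind ξ} {eigencharacter t²≈s ⊕ eigencharacter t′²≈s} vandermonde λ g →
          top t²≈s g , top′ t′²≈s g , bottom t²≈s g , bottom′ t′²≈s g
          where
          E : ∣G∣ → Mat₂ Carrier
          E = ρ (Ind ξ)
          top : ∀ {r} (r² : r * r ≈ ξ⟨ σ² ⟩) g →
            e₁₁ (E g) * 1# + e₁₂ (E g) * r ≈ 1# * eigenvalue r² g + 1# * 0#
          top {r} r² g = solve 3 (λ r a b → a :* :1 :+ b :* r := :1 :* (a :+ r :* b) :+ :1 :* :0) refl r (e₁₁ (E g)) (e₁₂ (E g))
          top′ : ∀ {r} (r² : r * r ≈ ξ⟨ σ² ⟩) g →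
            e₁₁ (E g) * 1# + e₁₂ (E g) * r ≈ 1# * 0# + 1# * eigenvalue r² g
          top′ r² g = trans (top r² g) (+-comm _ _)
          bottom : ∀ {r r′} (r² : r * r ≈ ξ⟨ σ² ⟩) g →
            e₂₁ (E g) * 1# + e₂₂ (E g) * r ≈ r * eigenvalue r² g + r′ * 0#
          bottom {r} {r′} r² g = trans
            (solve 3 (λ r a b → a :* :1 :+ b :* r := a :+ r :* b) refl r (e₂₁ (E g)) (e₂₂ (E g)))
            (trans (eigenvector r² g) (solve 2 (λ x r′ → x := x :+ r′ :* :0) refl (r * eigenvalue r² g) r′))
          bottom′ : ∀ {r r′} (r² : r * r ≈ ξ⟨ σ² ⟩) g →
            e₂₁ (E g) * 1# + e₂₂ (E g) * r ≈ r′ * 0# + r * eigenvalue r² g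
          bottom′ r² g = trans (bottom r² g) (+-comm _ _)

-- The valuation ring and its residue field

module ValuationProperties {K : Field} (valuation : DiscreteValuation K) where
  open Field K
  open DiscreteValuation valuation
  open IntegerCoefficients commutativeRing using (solve; _:=_; _:+_; _:*_; _:-_; :-_; :0; :1)
  private
    module 𝒪/𝔪 = CommutativeRing (residueRing valuation)

  infix 4 _≤∞?_
  _≤∞?_ : ∀ m n → Dec (m ≤∞ n)
  _≤∞?_ = Supremum.≤⁺-dec ℤ._≤_ ℤₚ._≤?_

  ≤∞-trans : ∀ {l m n} → l ≤∞ m → m ≤∞ n → l ≤∞ n
  ≤∞-trans = Supremum.≤⁺-trans ℤ._≤_ ℤₚ.≤-trans

  ≡⇒≤∞ : ∀ {m n : ℤ∞} → m ≡ n → m ≤∞ n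
  ≡⇒≤∞ {[ m ]} ≡.refl = Supremum.[ ℤₚ.≤-refl ]
  ≡⇒≤∞ {⊤⁺}    ≡.refl = ⊤⁺ Supremum.≤⊤⁺

  ≡-trans : ∀ {n x y z} → x ≡ y mod𝔪^ n → y ≡ z mod𝔪^ n → x ≡ z mod𝔪^ n
  ≡-trans {x = x} {y} {z} p q = ≡.subst (_ ≤∞_)
    (v-cong (solve 3 (λ x y z → (x :- y) :+ (y :- z) := x :- z) refl x y z)) (v-+ p q)

  []-injective : ∀ {m n : ℤ} → _≡_ {A = ℤ∞} [ m ] [ n ] → m ≡ n
  []-injective ≡.refl = ≡.refl

  ≤v-resp : ∀ {n x y} → x ≈ y → n ≤∞ v x → n ≤∞ v y
  ≤v-resp {n} x≈y = ≡.subst (n ≤∞_) (v-cong x≈y)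

  ≤v-* : ∀ {m n x y} → [ m ] ≤∞ v x → [ n ] ≤∞ v y → [ m ℤ.+ n ] ≤∞ v (x * y)
  ≤v-* {m} {n} {x} {y} m≤ n≤ = ≡.subst ([ m ℤ.+ n ] ≤∞_) (≡.sym (v-* x y)) (+∞-mono m≤ n≤)
    where
    +∞-mono : ∀ {α β : ℤ∞} → [ m ] ≤∞ α → [ n ] ≤∞ β → [ m ℤ.+ n ] ≤∞ α +∞ β
    +∞-mono Supremum.[ p ]       Supremum.[ q ]       = Supremum.[ ℤₚ.+-mono-≤ p q ]
    +∞-mono Supremum.[ p ]       (_ Supremum.≤⊤⁺)     = _ Supremum.≤⊤⁺
    +∞-mono (_ Supremum.≤⊤⁺)     _                    = _ Supremum.≤⊤⁺

  ≤v-𝒪* : ∀ {n x y} → x ∈𝒪 → [ n ] ≤∞ v y → [ n ] ≤∞ v (x * y)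
  ≤v-𝒪* {n} {x} {y} x∈ n≤ = ≡.subst (λ m → [ m ] ≤∞ v (x * y)) (ℤₚ.+-identityˡ n) (≤v-* x∈ n≤)

  ≤v-neg : ∀ {n x} → [ n ] ≤∞ v x → [ n ] ≤∞ v (- x)
  ≤v-neg {x = x} n≤ = ≤v-resp (solve 1 (λ x → (:- :1) :* x := :- x) refl x)
    (≤v-𝒪* (proj₂ (𝒪/𝔪.- 𝒪/𝔪.1#)) n≤)

  ≡-sym : ∀ {n x y} → x ≡ y mod𝔪^ n → y ≡ x mod𝔪^ n
  ≡-sym {x = x} {y} p = ≤v-resp (solve 2 (λ x y → :- (x :- y) := y :- x) refl x y) (≤v-neg p)

  1∈𝒪 : 1# ∈𝒪
  1∈𝒪 = proj₂ 𝒪/𝔪.1#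

  *-∈𝒪 : ∀ {x y} → x ∈𝒪 → y ∈𝒪 → (x * y) ∈𝒪
  *-∈𝒪 = ≤v-𝒪*

  ∈𝒪-resp : ∀ {x y} → x ≈ y → x ∈𝒪 → y ∈𝒪
  ∈𝒪-resp = ≤v-resp

  ∈𝔪⇒≡0 : ∀ {x} → x ∈𝔪 → x ≡ 0# mod𝔪^ 1
  ∈𝔪⇒≡0 {x} = ≤v-resp (solve 1 (λ x → x := x :- :0) refl x)

  ≡0⇒∈𝔪 : ∀ {x} → x ≡ 0# mod𝔪^ 1 → x ∈𝔪
  ≡0⇒∈𝔪 {x} = ≤v-resp (solve 1 (λ x → x :- :0 := x) refl x)

  ∈𝒪ˣ⇒∈𝒪 : ∀ {x} → x ∈𝒪ˣ → x ∈𝒪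
  ∈𝒪ˣ⇒∈𝒪 v≡0 = ≡⇒≤∞ (≡.sym v≡0)

  ∈𝒪⇒∈𝒪ˣ⊎∈𝔪 : ∀ {x} → x ∈𝒪 → x ∈𝒪ˣ ⊎ x ∈𝔪
  ∈𝒪⇒∈𝒪ˣ⊎∈𝔪 {x} x∈ with v x | x∈
  ... | ⊤⁺          | _                         = inj₂ (_ Supremum.≤⊤⁺)
  ... | [ + 0 ]     | _                         = inj₁ ≡.refl
  ... | [ + suc n ] | _                         = inj₂ Supremum.[ ℤ.+≤+ (ℕ.s≤s ℕ.z≤n) ]
  ... | [ -[1+ _ ] ] | Supremum.[ () ]

  ∈𝒪ˣ⇒∉𝔪 : ∀ {x} → x ∈𝒪ˣ → ¬ (x ∈𝔪)
  ∈𝒪ˣ⇒∉𝔪 v≡0 1≤v with ≡.subst ([ + 1 ] ≤∞_) v≡0 1≤v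
  ... | Supremum.[ ℤ.+≤+ () ]

  v-finite : ∀ {x} → ¬ (x ≈ 0#) → Σ[ n ∈ ℤ ] v x ≡ [ n ]
  v-finite {x} x≉0 with v x in eq
  ... | [ n ] = n , ≡.refl
  ... | ⊤⁺    = ⊥-elim (x≉0 (v-∞ eq))

  -- `v 1#` is finite and equal to its own double.
  1∈𝒪ˣ : 1# ∈𝒪ˣ
  1∈𝒪ˣ with v-finite 1≉0
  ... | n , v1≡n = ≡.trans v1≡n (≡.cong [_] (AbelianGroupProperties.identityʳ-unique ℤₚ.+-0-abelianGroup n n ([]-injective n+n≡n)))
    where
    n+n≡n : [ n ℤ.+ n ] ≡ [ n ]
    n+n≡n = ≡.trans (≡.sym (≡.cong₂ _+∞_ v1≡n v1≡n))
      (≡.trans (≡.sym (v-* 1# 1#)) (≡.trans (v-cong (*-identityˡ 1#)) v1≡n))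

  v-inverse : ∀ {x y n} → x * y ≈ 1# → v x ≡ [ n ] → v y ≡ [ ℤ.- n ]
  v-inverse {x} {y} {n} xy≈1 vx≡n with v-finite {y} (FieldProperties.x*y≈1⇒x≉0 K (trans (*-comm y x) xy≈1))
  ... | m , vy≡m = ≡.trans vy≡m (≡.cong [_] (AbelianGroupProperties.inverseʳ-unique ℤₚ.+-0-abelianGroup n m ([]-injective n+m≡0)))
    where
    n+m≡0 : [ n ℤ.+ m ] ≡ [ + 0 ]
    n+m≡0 = ≡.trans (≡.sym (≡.cong₂ _+∞_ vx≡n vy≡m))
      (≡.trans (≡.sym (v-* x y)) (≡.trans (v-cong xy≈1) 1∈𝒪ˣ))

  inverse-∈𝒪ˣ : ∀ {x y} → x * y ≈ 1# → x ∈𝒪ˣ → y ∈𝒪ˣ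
  inverse-∈𝒪ˣ = v-inverse

  ∈𝒪ˣ⇒≉0 : ∀ {x} → x ∈𝒪ˣ → ¬ (x ≈ 0#)
  ∈𝒪ˣ⇒≉0 {x} x∈𝒪ˣ x≈0 = ∈𝒪ˣ⇒∉𝔪 x∈𝒪ˣ (≡0⇒∈𝔪 (≈⇒residue≈ valuation x≈0))

  ∈𝒪-cancelʳ : ∀ {x y} → y ∈𝒪ˣ → (x * y) ∈𝒪 → x ∈𝒪
  ∈𝒪-cancelʳ {x} {y} y∈𝒪ˣ xy∈ = ∈𝒪-resp
    (trans (solve 3 (λ x y i → i :* (x :* y) := x :* (y :* i)) refl x y (y ⁻¹))
      (trans (*-congˡ y*y⁻¹≈1) (*-identityʳ x)))
    (*-∈𝒪 (∈𝒪ˣ⇒∈𝒪 (inverse-∈𝒪ˣ y*y⁻¹≈1 y∈𝒪ˣ)) xy∈)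
    where
    y*y⁻¹≈1 : y * y ⁻¹ ≈ 1#
    y*y⁻¹≈1 = *-inverseʳ (∈𝒪ˣ⇒≉0 y∈𝒪ˣ)

  square-∈𝒪ˣ⇒∈𝒪 : ∀ {x} → (x * x) ∈𝒪ˣ → x ∈𝒪
  square-∈𝒪ˣ⇒∈𝒪 {x} vx²≡0 with v x | ≡.trans (≡.sym (v-* x x)) vx²≡0
  -- For `⊤⁺` and for negative integers the doubled valuation computes to something other than
  -- `[ + 0 ]`, which leaves this case.
  ... | [ + n ] | _ = Supremum.[ ℤ.+≤+ ℕ.z≤n ]

  ∈𝒪∧∉𝔪⇒∈𝒪ˣ : ∀ {x} → x ∈𝒪 → ¬ (x ∈𝔪) → x ∈𝒪ˣ
  ∈𝒪∧∉𝔪⇒∈𝒪ˣ x∈ x∉𝔪 with ∈𝒪⇒∈𝒪ˣ⊎∈𝔪 x∈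
  ... | inj₁ unit = unit
  ... | inj₂ x∈𝔪  = ⊥-elim (x∉𝔪 x∈𝔪)

  ∈𝒪∧≢0⇒∈𝒪ˣ : ∀ {x} → x ∈𝒪 → ¬ (x ≡ 0# mod𝔪^ 1) → x ∈𝒪ˣ
  ∈𝒪∧≢0⇒∈𝒪ˣ x∈ x≢0 = ∈𝒪∧∉𝔪⇒∈𝒪ˣ x∈ (x≢0 ∘ ∈𝔪⇒≡0)

  private
    -- The test is on `x - 0#` because equality with zero in the residue ring unfolds to it. The
    -- constant value on 𝔪 makes `inv` respect congruence there.
    inv : 𝒪/𝔪.Carrier → 𝒪/𝔪.Carrier
    inv (x , x∈) with [ + 1 ] ≤∞? v (x - 0#)
    ... | yes _   = 𝒪/𝔪.0#
    ... | no  x≢0 = x ⁻¹ , ∈𝒪ˣ⇒∈𝒪 (inverse-∈𝒪ˣ (*-inverseʳ (∈𝒪ˣ⇒≉0 x∈𝒪ˣ)) x∈𝒪ˣ)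
      where
      x∈𝒪ˣ : x ∈𝒪ˣ
      x∈𝒪ˣ = ∈𝒪∧≢0⇒∈𝒪ˣ x∈ x≢0

    inverseʳ : ∀ x → ¬ (x 𝒪/𝔪.≈ 𝒪/𝔪.0#) → x 𝒪/𝔪.* inv x 𝒪/𝔪.≈ 𝒪/𝔪.1#
    inverseʳ (x , x∈) x≢0 with [ + 1 ] ≤∞? v (x - 0#)
    ... | yes x≡0 = ⊥-elim (x≢0 x≡0)
    ... | no  _   = ≈⇒residue≈ valuation (*-inverseʳ (∈𝒪ˣ⇒≉0 (∈𝒪∧≢0⇒∈𝒪ˣ x∈ x≢0)))

    inv-0 : ∀ x → x 𝒪/𝔪.≈ 𝒪/𝔪.0# → inv x 𝒪/𝔪.≈ 𝒪/𝔪.0#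
    inv-0 (x , x∈) x≡0 with [ + 1 ] ≤∞? v (x - 0#)
    ... | yes _   = 𝒪/𝔪.refl {𝒪/𝔪.0#}
    ... | no  x≢0 = ⊥-elim (x≢0 x≡0)

    -- Outside 𝔪 this is uniqueness of inverses in a commutative ring, in place of an estimate of
    -- x⁻¹ - y⁻¹.
    inv-cong : ∀ x y → x 𝒪/𝔪.≈ y → inv x 𝒪/𝔪.≈ inv y
    inv-cong x y x≈y = from-dec ([ + 1 ] ≤∞? v (proj₁ x - 0#))
      where
      open SetoidReasoning 𝒪/𝔪.setoid
      y≈x : y 𝒪/𝔪.≈ x
      y≈x = 𝒪/𝔪.sym {x} {y} x≈y
      from-dec : Dec (x 𝒪/𝔪.≈ 𝒪/𝔪.0#) → inv x 𝒪/𝔪.≈ inv y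
      from-dec (yes x≈0) = begin
        inv x      ≈⟨ inv-0 x x≈0 ⟩
        𝒪/𝔪.0#     ≈⟨ inv-0 y (𝒪/𝔪.trans {y} {x} {𝒪/𝔪.0#} y≈x x≈0) ⟨
        inv y      ∎
      from-dec (no x≉0) = begin
        inv x                              ≈⟨ 𝒪/𝔪.*-identityʳ (inv x) ⟨
        inv x 𝒪/𝔪.* 𝒪/𝔪.1#                 ≈⟨ 𝒪/𝔪.*-congˡ {inv x} {y 𝒪/𝔪.* inv y} {𝒪/𝔪.1#} (inverseʳ y (λ y≈0 → x≉0 (𝒪/𝔪.trans {x} {y} {𝒪/𝔪.0#} x≈y y≈0))) ⟨
        inv x 𝒪/𝔪.* (y 𝒪/𝔪.* inv y)        ≈⟨ 𝒪/𝔪.*-assoc (inv x) y (inv y) ⟨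
        inv x 𝒪/𝔪.* y 𝒪/𝔪.* inv y          ≈⟨ 𝒪/𝔪.*-congʳ {inv y} {inv x 𝒪/𝔪.* y} {𝒪/𝔪.1#} inv-x*y≈1 ⟩
        𝒪/𝔪.1# 𝒪/𝔪.* inv y                 ≈⟨ 𝒪/𝔪.*-identityˡ (inv y) ⟩
        inv y                              ∎
        where
        inv-x*y≈1 : inv x 𝒪/𝔪.* y 𝒪/𝔪.≈ 𝒪/𝔪.1#
        inv-x*y≈1 = begin
          inv x 𝒪/𝔪.* y      ≈⟨ 𝒪/𝔪.*-congˡ {inv x} {y} {x} y≈x ⟩
          inv x 𝒪/𝔪.* x      ≈⟨ 𝒪/𝔪.*-comm (inv x) x ⟩
          x 𝒪/𝔪.* inv x      ≈⟨ inverseʳ x x≉0 ⟩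
          𝒪/𝔪.1#             ∎

  -- Congruence modulo 𝔪 is decidable because the order of `ℤ∞` is. The results on induced
  -- representations over a `Field` thereby apply to reductions.
  residueField : Field
  residueField = record
    { commutativeRing = residueRing valuation
    ; _≟_        = λ x y → [ + 1 ] ≤∞? v (proj₁ x - proj₁ y)
    ; 1≉0        = ∈𝒪ˣ⇒∉𝔪 1∈𝒪ˣ ∘ ≡0⇒∈𝔪
    ; _⁻¹        = inv
    ; ⁻¹-cong    = λ {x} {y} → inv-cong x y
    ; *-inverseʳ = λ {x} → inverseʳ x
    }

  natural∈𝒪 : ∀ n → (n ⋅ 1#) ∈𝒪
  natural∈𝒪 zero    = proj₂ 𝒪/𝔪.0#
  natural∈𝒪 (suc n) = v-+ 1∈𝒪 (natural∈𝒪 n)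

  -- If 2 were in 𝔪, then so would be 1 = (1 + 2n) - n · 2.
  odd∈𝔪⇒2∈𝒪ˣ : ∀ n → (suc (n ℕ.* 2) ⋅ 1#) ∈𝔪 → (2 ⋅ 1#) ∈𝒪ˣ
  odd∈𝔪⇒2∈𝒪ˣ n 1+2n∈𝔪 with ∈𝒪⇒∈𝒪ˣ⊎∈𝔪 (natural∈𝒪 2)
  ... | inj₁ 2∈𝒪ˣ = 2∈𝒪ˣ
  ... | inj₂ 2∈𝔪  = ⊥-elim (∈𝒪ˣ⇒∉𝔪 1∈𝒪ˣ (≤v-resp
    (trans (+-congˡ (-‿cong (sym (×1-homo-* n 2))))
      (solve 2 (λ x y → (x :+ y) :- y := x) refl 1# ((n ℕ.* 2) ⋅ 1#)))
    (v-+ 1+2n∈𝔪 (≤v-neg (≤v-𝒪* (natural∈𝒪 n) 2∈𝔪)))))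
    where open Mult semiring using (×1-homo-*)

-- Two is a unit for odd ℓ

prime-odd : ∀ {p} → Prime p → p ≢ 2 → Σ[ n ∈ ℕ ] p ≡ suc (n ℕ.* 2)
prime-odd {p} p-prime p≢2 with p % 2 | m%n<n p 2 | m≡m%n+[m/n]*n p 2
... | 1 | _ | p≡1+2n = p / 2 , p≡1+2n
... | 0 | _ | p≡2n with prime⇒irreducible p-prime (divides (p / 2) p≡2n)
...   | inj₁ ()
...   | inj₂ 2≡p = ⊥-elim (p≢2 (≡.sym 2≡p))
prime-odd {p} p-prime p≢2 | suc (suc _) | ℕ.s≤s (ℕ.s≤s ()) | _

-- v(2) is the ramification index times the ℓ-adic valuation of 2, which is 0.
2-unit : ∀ {ℓ} → Prime ℓ → ℓ ≢ 2 → (K : PAdicField ℓ) → let open PAdicField K in (1# + 1#) ∈𝒪ˣ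
2-unit {ℓ} ℓ-prime ℓ≢2 K = ≡.trans (v-cong 1+1≈⟦2⟧)
  (≡.trans (v-extends v[2]≡0) (≡.cong [_] (ℤₚ.*-zeroʳ (+ ramification))))
  where
  open PAdicField K
  open PAdicNumbers base using (ℚₚ; v-p) renaming (valuation to valuationₚ)
  module ℚₗ = Field ℚₚ
  module V = ValuationProperties valuationₚ
  open Embedding embedding using (⟦_⟧; ⟦⟧-cong; +-homo; 1#-homo)
  odd : Σ[ n ∈ ℕ ] ℓ ≡ suc (n ℕ.* 2)
  odd = prime-odd ℓ-prime ℓ≢2
  v[2]≡0 : DiscreteValuation.v valuationₚ (2 ℚₗ.⋅ ℚₗ.1#) ≡ [ + 0 ]
  v[2]≡0 = V.odd∈𝔪⇒2∈𝒪ˣ (proj₁ odd) (V.≡⇒≤∞ (≡.sym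
    (≡.subst (λ m → DiscreteValuation.v valuationₚ (m ℚₗ.⋅ ℚₗ.1#) ≡ [ + 1 ]) (proj₂ odd) v-p)))
  1+1≈⟦2⟧ : 1# + 1# ≈ ⟦ 2 ℚₗ.⋅ ℚₗ.1# ⟧
  1+1≈⟦2⟧ = sym (trans (⟦⟧-cong (ℚₗ.+-congˡ (ℚₗ.+-identityʳ ℚₗ.1#)))
    (trans (+-homo ℚₗ.1# ℚₗ.1#) (+-cong 1#-homo 1#-homo)))

-- Explicit entries of ρ over K

module TriangularConjugate
  {G : Group 0ℓ 0ℓ} (I : IndexTwoSubgroup G) (K : Field)
  (φ : Representation G (Field.commutativeRing K))
  (ξ : Character (IndexTwoSubgroup.subgroup I) (Field.commutativeRing K))
  (φ≅Ind : Representations._≅_ G (Field.commutativeRing K) φ (Induction.Ind I (Field.commutativeRing K) ξ))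
  {a b d : Field.Carrier K}
  (U≈ : Matrices._≈ᴹ_ (Field.commutativeRing K)
          (Matrices.GL₂.matrix (proj₁ φ≅Ind)) (mat a b (Field.0# K) d))
  where
  open Field K
  open IndexTwoSubgroup I
  open Induction I commutativeRing
  open Matrices commutativeRing
  open MatrixProperties commutativeRing
  open FieldProperties K
  open InductionProperties I K
  open RepresentationProperties G commutativeRing
  open IntegerCoefficients commutativeRing using (solve; _:=_; _:+_; _:*_; _:-_; :-_; :0; :1)
  open Representation using (ρ)
  open Character ξ renaming (χ to ξ⟨_⟩)
  open Character (ξ ^σ) using () renaming (χ to ξ^σ⟨_⟩)

  private
    U : GL₂
    U = proj₁ φ≅Ind

  -- The upper left entry of U⁻¹U is a multiple of `a`, since the entry of U below the diagonal is
  -- zero. For `d` the lower right entry of UU⁻¹ plays this role.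
  a≉0 : ¬ (a ≈ 0#)
  a≉0 = x*y≈1⇒x≉0 (trans (solve 3 (λ a x y → a :* x := x :* a :+ y :* :0) refl a _ _)
    (trans (≈ᴹ-sym (*ᴹ-congˡ {GL₂.inverse U} U≈) .proj₁) (GL₂.inverseˡ U .proj₁)))

  d≉0 : ¬ (d ≈ 0#)
  d≉0 = x*y≈1⇒x≉0 (trans (solve 3 (λ d x y → d :* x := :0 :* y :+ d :* x) refl d _ _)
    (trans (≈ᴹ-sym (*ᴹ-congʳ {N = GL₂.inverse U} U≈) .proj₂ .proj₂ .proj₂) (GL₂.inverseʳ U .proj₂ .proj₂ .proj₂)))

  -- `f` is the inverse of `e`, written as a/d so that the b/d of the valuation bound becomes the
  -- product `c * f`.
  c e f : Carrier
  c = b * a ⁻¹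
  e = d * a ⁻¹
  f = a * d ⁻¹

  e*f≈1 : e * f ≈ 1#
  e*f≈1 = begin
    d * a ⁻¹ * (a * d ⁻¹)      ≈⟨ solve 4 (λ d a i j → d :* i :* (a :* j) := (a :* i) :* (d :* j)) refl d a (a ⁻¹) (d ⁻¹) ⟩
    (a * a ⁻¹) * (d * d ⁻¹)    ≈⟨ *-cong (*-inverseʳ a≉0) (*-inverseʳ d≉0) ⟩
    1# * 1#                    ≈⟨ *-identityˡ 1# ⟩
    1#                         ∎
    where open SetoidReasoning setoid

  b/d≈c*f : b * d ⁻¹ ≈ c * f
  b/d≈c*f = begin
    b * d ⁻¹                   ≈⟨ *-identityˡ _ ⟨
    1# * (b * d ⁻¹)            ≈⟨ *-congʳ (*-inverseʳ a≉0) ⟨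
    a * a ⁻¹ * (b * d ⁻¹)      ≈⟨ solve 4 (λ a b i j → a :* i :* (b :* j) := b :* i :* (a :* j)) refl a b (a ⁻¹) (d ⁻¹) ⟩
    b * a ⁻¹ * (a * d ⁻¹)      ∎
    where open SetoidReasoning setoid

  V : GL₂
  V = record
    { matrix   = mat 1# c 0# e
    ; inverse  = mat 1# (- (c * f)) 0# f
    ; inverseʳ =
        solve 1 (λ c → :1 :* :1 :+ c :* :0 := :1) refl c ,
        solve 2 (λ c f → :1 :* (:- (c :* f)) :+ c :* f := :0) refl c f ,
        solve 1 (λ e → :0 :* :1 :+ e :* :0 := :0) refl e ,
        trans (solve 3 (λ c e f → :0 :* (:- (c :* f)) :+ e :* f := e :* f) refl c e f) e*f≈1
    ; inverseˡ =
        solve 1 (λ x → :1 :* :1 :+ x :* :0 := :1) refl (- (c * f)) ,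
        trans (solve 3 (λ c e f → :1 :* c :+ (:- (c :* f)) :* e := c :* (:1 :- e :* f)) refl c e f)
          (trans (*-congˡ (x≈y⇒x-y≈0 (sym e*f≈1))) (zeroʳ c)) ,
        solve 1 (λ f → :0 :* :1 :+ f :* :0 := :0) refl f ,
        trans (solve 3 (λ c e f → :0 :* c :+ f :* e := e :* f) refl c e f) e*f≈1
    }

  V-intertwines : ∀ g → Intertwines (GL₂.matrix V) φ (Ind ξ) g
  V-intertwines g = begin
    M *ᴹ GL₂.matrix V             ≈⟨ *ᴹ-congˡ {M} US≈V ⟨
    M *ᴹ (GL₂.matrix U *ᴹ S)      ≈⟨ *ᴹ-assoc M (GL₂.matrix U) S ⟨
    M *ᴹ GL₂.matrix U *ᴹ S        ≈⟨ *ᴹ-congʳ (≅-intertwines {φ} {Ind ξ} φ≅Ind g) ⟩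
    GL₂.matrix U *ᴹ N *ᴹ S        ≈⟨ *ᴹ-assoc (GL₂.matrix U) N S ⟩
    GL₂.matrix U *ᴹ (N *ᴹ S)      ≈⟨ *ᴹ-congˡ {GL₂.matrix U} (S-central (e₁₁ N) (e₁₂ N) (e₂₁ N) (e₂₂ N)) ⟩
    GL₂.matrix U *ᴹ (S *ᴹ N)      ≈⟨ *ᴹ-assoc (GL₂.matrix U) S N ⟨
    GL₂.matrix U *ᴹ S *ᴹ N        ≈⟨ *ᴹ-congʳ {N = N} US≈V ⟩
    GL₂.matrix V *ᴹ N             ∎
    where
    open SetoidReasoning ≈ᴹ-setoid
    M N S : Mat₂ Carrier
    M = ρ φ g
    N = ρ (Ind ξ) g
    S = mat (a ⁻¹) 0# 0# (a ⁻¹)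
    S-central : ∀ x y z w → mat x y z w *ᴹ S ≈ᴹ S *ᴹ mat x y z w
    S-central x y z w =
      solve 4 (λ i x y z → x :* i :+ y :* :0 := i :* x :+ :0 :* z) refl (a ⁻¹) x y z ,
      solve 4 (λ i x y w → x :* :0 :+ y :* i := i :* y :+ :0 :* w) refl (a ⁻¹) x y w ,
      solve 4 (λ i z w x → z :* i :+ w :* :0 := :0 :* x :+ i :* z) refl (a ⁻¹) z w x ,
      solve 4 (λ i z w y → z :* :0 :+ w :* i := :0 :* y :+ i :* w) refl (a ⁻¹) z w y
    US≈V : GL₂.matrix U *ᴹ S ≈ᴹ GL₂.matrix V
    US≈V = ≈ᴹ-trans (*ᴹ-congʳ {N = S} U≈)
      ( trans (solve 3 (λ a b i → a :* i :+ b :* :0 := a :* i) refl a b (a ⁻¹)) (*-inverseʳ a≉0)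
      , solve 3 (λ a b i → a :* :0 :+ b :* i := b :* i) refl a b (a ⁻¹)
      , solve 2 (λ d i → :0 :* i :+ d :* :0 := :0) refl d (a ⁻¹)
      , solve 2 (λ d i → :0 :* :0 :+ d :* i := d :* i) refl d (a ⁻¹))

  φ≈VIndV⁻¹ : ∀ g → ρ φ g ≈ᴹ GL₂.matrix V *ᴹ ρ (Ind ξ) g *ᴹ GL₂.inverse V
  φ≈VIndV⁻¹ g = intertwine⇒conjugate {ρ φ g} {ρ (Ind ξ) g} {GL₂.matrix V} (GL₂.inverseʳ V) (V-intertwines g)

  private
    V-diagonal : ∀ x z → GL₂.matrix V *ᴹ mat x 0# 0# z *ᴹ GL₂.inverse V ≈ᴹ mat x (c * f * (z - x)) 0# z
    V-diagonal x z =
      solve 3 (λ x z c → (:1 :* x :+ c :* :0) :* :1 :+ (:1 :* :0 :+ c :* z) :* :0 := x) refl x z c ,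
      solve 4 (λ x z c f → (:1 :* x :+ c :* :0) :* (:- (c :* f)) :+ (:1 :* :0 :+ c :* z) :* f := c :* f :* (z :- x)) refl x z c f ,
      solve 3 (λ x z e → (:0 :* x :+ e :* :0) :* :1 :+ (:0 :* :0 :+ e :* z) :* :0 := :0) refl x z e ,
      trans (solve 5 (λ x z c e f → (:0 :* x :+ e :* :0) :* (:- (c :* f)) :+ (:0 :* :0 :+ e :* z) :* f := z :* (e :* f)) refl x z c e f)
        (trans (*-congˡ e*f≈1) (*-identityʳ z))

    V-antidiagonal : ∀ x y → GL₂.matrix V *ᴹ mat 0# x y 0# *ᴹ GL₂.inverse V ≈ᴹ
      mat (c * y) (f * (x - c * c * y)) (e * y) (- c * y)
    V-antidiagonal x y =
      solve 3 (λ x y c → (:1 :* :0 :+ c :* y) :* :1 :+ (:1 :* x :+ c :* :0) :* :0 := c :* y) refl x y c ,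
      solve 4 (λ x y c f → (:1 :* :0 :+ c :* y) :* (:- (c :* f)) :+ (:1 :* x :+ c :* :0) :* f := f :* (x :- c :* c :* y)) refl x y c f ,
      solve 3 (λ x y e → (:0 :* :0 :+ e :* y) :* :1 :+ (:0 :* x :+ e :* :0) :* :0 := e :* y) refl x y e ,
      trans (solve 5 (λ x y c e f → (:0 :* :0 :+ e :* y) :* (:- (c :* f)) :+ (:0 :* x :+ e :* :0) :* f := (:- c) :* y :* (e :* f)) refl x y c e f)
        (trans (*-congˡ e*f≈1) (*-identityʳ _))

  φ-H : ∀ h → ρ φ (proj₁ h) ≈ᴹ mat ξ⟨ h ⟩ (c * f * (ξ^σ⟨ h ⟩ - ξ⟨ h ⟩)) 0# ξ^σ⟨ h ⟩
  φ-H h = ≈ᴹ-trans (φ≈VIndV⁻¹ (proj₁ h))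
    (≈ᴹ-trans (*ᴹ-congʳ {N = GL₂.inverse V} (*ᴹ-congˡ {GL₂.matrix V} (Ind-H ξ h))) (V-diagonal ξ⟨ h ⟩ ξ^σ⟨ h ⟩))

  φ-σ : ρ φ σ ≈ᴹ mat (c * ξ⟨ σ² ⟩) (f * (1# - c * c * ξ⟨ σ² ⟩)) (e * ξ⟨ σ² ⟩) (- c * ξ⟨ σ² ⟩)
  φ-σ = ≈ᴹ-trans (φ≈VIndV⁻¹ σ)
    (≈ᴹ-trans (*ᴹ-congʳ {N = GL₂.inverse V} (*ᴹ-congˡ {GL₂.matrix V} (Ind-σ ξ))) (V-antidiagonal 1# ξ⟨ σ² ⟩))

  private
    V-conjugate : ∀ x y z w → let M = GL₂.matrix V *ᴹ mat x y z w *ᴹ GL₂.inverse V in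
      e₁₁ M ≈ x + c * z × e₂₁ M ≈ e * z × e₂₂ M ≈ w - c * z
    V-conjugate x y z w =
      solve 5 (λ x y z w c → (:1 :* x :+ c :* z) :* :1 :+ (:1 :* y :+ c :* w) :* :0 := x :+ c :* z) refl x y z w c ,
      solve 5 (λ x y z w e → (:0 :* x :+ e :* z) :* :1 :+ (:0 :* y :+ e :* w) :* :0 := e :* z) refl x y z w e ,
      trans (solve 7 (λ x y z w c e f →
          (:0 :* x :+ e :* z) :* (:- (c :* f)) :+ (:0 :* y :+ e :* w) :* f := (w :- c :* z) :* (e :* f)) refl x y z w c e f)
        (trans (*-congˡ e*f≈1) (*-identityʳ _))

    φ-conjugate : ∀ g → let N = ρ (Ind ξ) g in
      e₁₁ (ρ φ g) ≈ e₁₁ N + c * e₂₁ N × e₂₁ (ρ φ g) ≈ e * e₂₁ N × e₂₂ (ρ φ g) ≈ e₂₂ N - c * e₂₁ N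
    φ-conjugate g =
      let N = ρ (Ind ξ) g
          (p , _ , q , r) = φ≈VIndV⁻¹ g
          (p′ , q′ , r′)  = V-conjugate (e₁₁ N) (e₁₂ N) (e₂₁ N) (e₂₂ N)
      in trans p p′ , trans q q′ , trans r r′

  -- Here and in `φ₂₁` and `φ₂₂` the entries are given at all elements and not just on `H` and at σ.
  -- In the triangular case the diagonal ones become the characters θ₁ and θ₂ of the theorem.
  φ₁₁ : ∀ g → e₁₁ (ρ φ g) ≈ cosetwise ξ⟨_⟩ (λ h → c * ξ⟨ σ⟨ h ⟩σ ⟩) g
  φ₁₁ g = trans (proj₁ (φ-conjugate g)) (by-coset g)
    where
    by-coset : ∀ g → e₁₁ (ρ (Ind ξ) g) + c * e₂₁ (ρ (Ind ξ) g) ≈ cosetwise ξ⟨_⟩ (λ h → c * ξ⟨ σ⟨ h ⟩σ ⟩) g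
    by-coset g with coset g
    ... | inj₁ _ = solve 2 (λ c x → x :+ c :* :0 := x) refl c _
    ... | inj₂ _ = +-identityˡ _

  φ₂₁ : ∀ g → e₂₁ (ρ φ g) ≈ cosetwise (λ _ → 0#) (λ h → e * ξ⟨ σ⟨ h ⟩σ ⟩) g
  φ₂₁ g = trans (proj₁ (proj₂ (φ-conjugate g))) (by-coset g)
    where
    by-coset : ∀ g → e * e₂₁ (ρ (Ind ξ) g) ≈ cosetwise (λ _ → 0#) (λ h → e * ξ⟨ σ⟨ h ⟩σ ⟩) g
    by-coset g with coset g
    ... | inj₁ _ = zeroʳ e
    ... | inj₂ _ = refl

  φ₂₂ : ∀ g → e₂₂ (ρ φ g) ≈ cosetwise ξ^σ⟨_⟩ (λ h → - c * ξ⟨ σ⟨ h ⟩σ ⟩) g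
  φ₂₂ g = trans (proj₂ (proj₂ (φ-conjugate g))) (by-coset g)
    where
    by-coset : ∀ g → e₂₂ (ρ (Ind ξ) g) - c * e₂₁ (ρ (Ind ξ) g) ≈ cosetwise ξ^σ⟨_⟩ (λ h → - c * ξ⟨ σ⟨ h ⟩σ ⟩) g
    by-coset g with coset g
    ... | inj₁ _ = solve 2 (λ c x → x :- c :* :0 := x) refl c _
    ... | inj₂ _ = solve 2 (λ c x → :0 :- c :* x := (:- c) :* x) refl c _

-- Reduction of ξ and of the representation induced from it

module CharacterReduction
  {G : Group 0ℓ 0ℓ} (I : IndexTwoSubgroup G) {K : Field} (valuation : DiscreteValuation K)
  (ξ : Character (IndexTwoSubgroup.subgroup I) (Field.commutativeRing K))
  (ξ∈𝒪 : ∀ h → DiscreteValuation._∈𝒪 valuation (Character.χ ξ h))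
  where
  open Field K
  open DiscreteValuation valuation
  open ValuationProperties valuation
  open IndexTwoSubgroup I
  open IntegerCoefficients commutativeRing using (solve; _:=_; _:+_; _:*_; :0)
  open Induction I commutativeRing using () renaming (Ind to Indᴷ)
  open Character ξ renaming (χ to ξ⟨_⟩)
  private
    module k = Field residueField
  open Induction I k.commutativeRing
  open Matrices k.commutativeRing
  open InductionProperties I residueField
  open Representations subgroup k.commutativeRing using (_≋_)
  open Representation using (ρ)

  ≈⇒≡̄ : ∀ {x y} → x ≈ y → x ≡ y mod𝔪^ 1
  ≈⇒≡̄ = ≈⇒residue≈ valuation

  ξ̄ : Character subgroup k.commutativeRing
  ξ̄ = record
    { χ      = λ h → ξ⟨ h ⟩ , ξ∈𝒪 h
    ; χ-cong = λ g≈h → ≈⇒≡̄ (χ-cong g≈h)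
    ; χ-∙    = λ g h → ≈⇒≡̄ (χ-∙ g h)
    ; χ-ε    = ≈⇒≡̄ χ-ε
    }

  ξ̄-reduction : IsReductionOf valuation ξ̄ ξ⟨_⟩
  ξ̄-reduction h = ≈⇒≡̄ refl

  Ind-integral : IsIntegral valuation (Indᴷ ξ)
  Ind-integral g with coset g
  ... | inj₁ _ = ξ∈𝒪 _ , proj₂ k.0# , proj₂ k.0# , ξ∈𝒪 _
  ... | inj₂ _ = proj₂ k.0# , ξ∈𝒪 _ , ξ∈𝒪 _ , proj₂ k.0#

  -- Reducing and inducing commute: once `coset g` is known, both sides have the same entries.
  reduction-Ind : ∀ g → ρ (reduction valuation (Indᴷ ξ) Ind-integral) g ≈ᴹ ρ (Ind ξ̄) g
  reduction-Ind g with coset g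
  ... | inj₁ _ = ≈⇒≡̄ refl , ≈⇒≡̄ refl , ≈⇒≡̄ refl , ≈⇒≡̄ refl
  ... | inj₂ _ = ≈⇒≡̄ refl , ≈⇒≡̄ refl , ≈⇒≡̄ refl , ≈⇒≡̄ refl

  eigencharacter-reduction :
    (ξ̄≋ξ̄^σ : ξ̄ ≋ ξ̄ ^σ) (t : k.Carrier) (t²≈s : t k.* t k.≈ Character.χ ξ̄ σ²) →
    IsReductionOf valuation (eigencharacter ξ̄ ξ̄≋ξ̄^σ {t} t²≈s) (cosetwise ξ⟨_⟩ (λ h → proj₁ t * ξ⟨ h ⟩))
  eigencharacter-reduction _ (t , _) _ g with coset g
  ... | inj₁ _ = ≈⇒≡̄ (solve 2 (λ t x → x := x :+ t :* :0) refl t _)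
  ... | inj₂ _ = ≈⇒≡̄ (solve 2 (λ t x → t :* x := :0 :+ t :* x) refl t _)

-- The reduction of ρ, with d/a a unit or in the maximal ideal

module Reduction
  {G : Group 0ℓ 0ℓ} (I : IndexTwoSubgroup G) {K : Field} (valuation : DiscreteValuation K)
  (2∈𝒪ˣ : DiscreteValuation._∈𝒪ˣ valuation (Field._+_ K (Field.1# K) (Field.1# K)))
  (φ : Representation G (Field.commutativeRing K))
  (φ-integral : IsIntegral valuation φ)
  (ξ : Character (IndexTwoSubgroup.subgroup I) (Field.commutativeRing K))
  (φ≅Ind : Representations._≅_ G (Field.commutativeRing K) φ (Induction.Ind I (Field.commutativeRing K) ξ))
  {a b d : Field.Carrier K}
  (U≈ : Matrices._≈ᴹ_ (Field.commutativeRing K)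
          (Matrices.GL₂.matrix (proj₁ φ≅Ind)) (mat a b (Field.0# K) d))
  where
  open Field K
  open DiscreteValuation valuation
  open ValuationProperties valuation
  open IndexTwoSubgroup I
  open Representation using (ρ)
  open TriangularConjugate I K φ ξ φ≅Ind U≈
  open IntegerCoefficients commutativeRing using (solve; _:=_; _:+_; _:*_; _:-_; :-_; :1)
  open Induction I commutativeRing using () renaming (Ind to Indᴷ; _^σ to _^σᴷ)
  open Character ξ using () renaming (χ to ξ⟨_⟩)
  open Character (ξ ^σᴷ) using () renaming (χ to ξ^σ⟨_⟩)

  k : Field
  k = residueField

  private
    module k = Field k
    module VK = Matrices.GL₂ V

  open Induction I k.commutativeRing
  open Matrices k.commutativeRing
  open MatrixProperties k.commutativeRing
  open FieldProperties k
  open InductionProperties I k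
  open RepresentationProperties G k.commutativeRing
  open Representations G k.commutativeRing hiding (Character; Representation; _≋_)
  open Representations subgroup k.commutativeRing using (_≋_) renaming (Decomposable to Decomposableᴴ)

  φ̄ : Representation G k.commutativeRing
  φ̄ = reduction valuation φ φ-integral

  abstract
    -- Triangularity makes `ξ⟨ h ⟩` an entry of `φ` itself. The proof is kept opaque because it is a
    -- component of every residue class formed from `ξ`.
    ξ∈𝒪 : ∀ h → ξ⟨ h ⟩ ∈𝒪
    ξ∈𝒪 h = ∈𝒪-resp (proj₁ (φ-H h)) (proj₁ (φ-integral (proj₁ h)))

  open CharacterReduction I valuation ξ ξ∈𝒪 public

  -- The reduction of `ξ` is again a character, so its values are nonzero in the residue field.
  ξ∈𝒪ˣ : ∀ h → ξ⟨ h ⟩ ∈𝒪ˣ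
  ξ∈𝒪ˣ h = ∈𝒪∧≢0⇒∈𝒪ˣ (ξ∈𝒪 h) (ξ≉0 ξ̄ h)

  s : Carrier
  s = ξ⟨ σ² ⟩

  c∈𝒪 : c ∈𝒪
  c∈𝒪 = ∈𝒪-cancelʳ (ξ∈𝒪ˣ σ²) (∈𝒪-resp (proj₁ φ-σ) (proj₁ (φ-integral σ)))

  e∈𝒪 : e ∈𝒪
  e∈𝒪 = ∈𝒪-cancelʳ (ξ∈𝒪ˣ σ²) (∈𝒪-resp (φ-σ .proj₂ .proj₂ .proj₁) (φ-integral σ .proj₂ .proj₂ .proj₁))

  2≢0 : ¬ (1# + 1# ≡ 0# mod𝔪^ 1)
  2≢0 = ∈𝒪ˣ⇒∉𝔪 2∈𝒪ˣ ∘ ≡0⇒∈𝔪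

  SquareRoot : Set
  SquareRoot = Σ[ r ∈ Carrier ] r * r ≈ s

  square-root∈𝒪 : ((r , _) : SquareRoot) → r ∈𝒪
  square-root∈𝒪 (r , r²≈s) = square-∈𝒪ˣ⇒∈𝒪 (≡.trans (v-cong r²≈s) (ξ∈𝒪ˣ σ²))

  module _ (r : SquareRoot) where
    r̄ : k.Carrier
    r̄ = proj₁ r , square-root∈𝒪 r

    r̄²≈s : r̄ k.* r̄ k.≈ (s , ξ∈𝒪 σ²)
    r̄²≈s = ≈⇒≡̄ (proj₂ r)

  module Unit (e∈𝒪ˣ : e ∈𝒪ˣ) where
    private
      f∈𝒪 : f ∈𝒪
      f∈𝒪 = ∈𝒪ˣ⇒∈𝒪 (inverse-∈𝒪ˣ e*f≈1 e∈𝒪ˣ)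

      c̄ ē f̄ : k.Carrier
      c̄ = c , c∈𝒪
      ē = e , e∈𝒪
      f̄ = f , f∈𝒪

      V̄ : GL₂
      V̄ = record
        { matrix   = mat k.1# c̄ k.0# ē
        ; inverse  = mat k.1# (k.- (c̄ k.* f̄)) k.0# f̄
        ; inverseʳ = let (p , q , r , t) = VK.inverseʳ in ≈⇒≡̄ p , ≈⇒≡̄ q , ≈⇒≡̄ r , ≈⇒≡̄ t
        ; inverseˡ = let (p , q , r , t) = VK.inverseˡ in ≈⇒≡̄ p , ≈⇒≡̄ q , ≈⇒≡̄ r , ≈⇒≡̄ t
        }

    -- Both sides of the relation between `φ`, `V` and `Ind ξ` have integral entries, so the
    -- relation can be read modulo 𝔪, where `V` remains invertible.
    φ̄≅Ind : φ̄ ≅ Ind ξ̄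
    φ̄≅Ind = ≅-fromIntertwiner {φ̄} {Ind ξ̄} V̄ λ g →
      let (p , q , r , t) = V-intertwines g in
      ≈ᴹ-trans {ρ φ̄ g *ᴹ GL₂.matrix V̄} {GL₂.matrix V̄ *ᴹ ρ (reduction valuation (Indᴷ ξ) Ind-integral) g} {GL₂.matrix V̄ *ᴹ ρ (Ind ξ̄) g}
        (≈⇒≡̄ p , ≈⇒≡̄ q , ≈⇒≡̄ r , ≈⇒≡̄ t)
        (*ᴹ-congˡ {GL₂.matrix V̄} {ρ (reduction valuation (Indᴷ ξ) Ind-integral) g} {ρ (Ind ξ̄) g} (reduction-Ind g))

    reducible⇒ : Reducible φ̄ → ξ̄ ≋ ξ̄ ^σ × Σ[ t ∈ k.Carrier ] t k.* t k.≈ (s , ξ∈𝒪 σ²)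
    reducible⇒ = Ind-reducible⇒ ξ̄ ∘ reducible-≅ {φ̄} {Ind ξ̄} φ̄≅Ind

    module _ (ξ̄≋ξ̄^σ : ξ̄ ≋ ξ̄ ^σ) (t : k.Carrier) (t²≈s : t k.* t k.≈ (s , ξ∈𝒪 σ²)) where
      -t²≈s : (k.- t) k.* (k.- t) k.≈ (s , ξ∈𝒪 σ²)
      -t²≈s = ≡-trans (≈⇒≡̄ (solve 1 (λ t → (:- t) :* (:- t) := t :* t) refl (proj₁ t))) t²≈s

      private
        t≉0 : ¬ (t k.≈ k.0#)
        t≉0 t≈0 = ξ≉0 ξ̄ σ² (k.trans {s , ξ∈𝒪 σ²} {t k.* t} {k.0#} (≡-sym t²≈s)
          (k.trans {t k.* t} {t k.* k.0#} {k.0#} (k.*-congˡ {t} {t} {k.0#} t≈0) (k.zeroʳ t)))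

      θ₁ θ₂ : Character G k.commutativeRing
      θ₁ = eigencharacter ξ̄ ξ̄≋ξ̄^σ {t} t²≈s
      θ₂ = eigencharacter ξ̄ ξ̄≋ξ̄^σ {k.- t} -t²≈s

      φ̄-splits : φ̄ ≅ θ₁ ⊕ θ₂
      φ̄-splits = ≅-trans {φ̄} {Ind ξ̄} {θ₁ ⊕ θ₂} φ̄≅Ind
        -- The roots t and -t are distinct because 2 and ξ(σ²) are units.
        (Ind-splits ξ̄ ξ̄≋ξ̄^σ {t} {k.- t} t²≈s -t²≈s (x≉-x {t} 2≢0 t≉0))

      φ̄-decomposable : Decomposable φ̄
      φ̄-decomposable = decomposable-≅ {θ₁ ⊕ θ₂} {φ̄} (≅-sym {φ̄} {θ₁ ⊕ θ₂} φ̄-splits) (⊕-decomposable θ₁ θ₂ k.1≉0)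

    module _ (ξ̄≋ξ̄^σ : ξ̄ ≋ ξ̄ ^σ) (r : SquareRoot) where
      θ₁-reduction : IsReductionOf valuation (θ₁ ξ̄≋ξ̄^σ (r̄ r) (r̄²≈s r)) (cosetwise ξ⟨_⟩ (λ h → proj₁ r * ξ⟨ h ⟩))
      θ₁-reduction = eigencharacter-reduction ξ̄≋ξ̄^σ (r̄ r) (r̄²≈s r)

      θ₂-reduction : IsReductionOf valuation (θ₂ ξ̄≋ξ̄^σ (r̄ r) (r̄²≈s r)) (cosetwise ξ⟨_⟩ (λ h → - proj₁ r * ξ⟨ h ⟩))
      θ₂-reduction = eigencharacter-reduction ξ̄≋ξ̄^σ (k.- r̄ r) (-t²≈s ξ̄≋ξ̄^σ (r̄ r) (r̄²≈s r))

  module Nonunit (e∈𝔪 : e ∈𝔪) where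
    private
      e*_∈𝔪 : ∀ {x} → x ∈𝒪 → (e * x) ∈𝔪
      e* x∈ ∈𝔪 = ≤v-resp (*-comm _ _) (≤v-𝒪* x∈ e∈𝔪)

    1-c²s∈𝔪 : (1# - c * c * s) ∈𝔪
    1-c²s∈𝔪 = ≤v-resp
      (begin
        e * (f * (1# - c * c * s))      ≈⟨ *-assoc _ _ _ ⟨
        e * f * (1# - c * c * s)        ≈⟨ *-congʳ e*f≈1 ⟩
        1# * (1# - c * c * s)           ≈⟨ *-identityˡ _ ⟩
        1# - c * c * s                  ∎)
      (e* ∈𝒪-resp (φ-σ .proj₂ .proj₁) (φ-integral σ .proj₂ .proj₁) ∈𝔪)
      where open SetoidReasoning setoid

    c∈𝒪ˣ : c ∈𝒪ˣ
    c∈𝒪ˣ = ∈𝒪∧∉𝔪⇒∈𝒪ˣ c∈𝒪 λ c∈𝔪 → ∈𝒪ˣ⇒∉𝔪 1∈𝒪ˣ (≤v-resp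
      (solve 2 (λ c s → (:1 :- c :* c :* s) :+ (c :* s) :* c := :1) refl c s)
      (v-+ 1-c²s∈𝔪 (≤v-𝒪* (*-∈𝒪 c∈𝒪 (ξ∈𝒪 σ²)) c∈𝔪)))

    c⁻¹∈𝒪ˣ : (c ⁻¹) ∈𝒪ˣ
    c⁻¹∈𝒪ˣ = inverse-∈𝒪ˣ (*-inverseʳ (∈𝒪ˣ⇒≉0 c∈𝒪ˣ)) c∈𝒪ˣ

    -- The upper right entry of ρ(h). It is integral although `f` has negative valuation, which
    -- forces ξ^σ(h) - ξ(h) to be small.
    β : H → Carrier
    β h = c * f * (ξ^σ⟨ h ⟩ - ξ⟨ h ⟩)

    abstract
      β∈𝒪 : ∀ h → β h ∈𝒪
      β∈𝒪 h = ∈𝒪-resp (φ-H h .proj₂ .proj₁) (φ-integral (proj₁ h) .proj₂ .proj₁)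

      -- Trades information on β for congruences: integral β gives ξ ≡ ξ^σ to the exponent v(e), and
      -- β in 𝔪 gains one more.
      ξ^σ-ξ≈ : ∀ h → c ⁻¹ * β h * e ≈ ξ^σ⟨ h ⟩ - ξ⟨ h ⟩
      ξ^σ-ξ≈ h = begin
        c ⁻¹ * β h * e                  ≈⟨ solve 5 (λ c e f i x → i :* (c :* f :* x) :* e := (c :* i) :* ((e :* f) :* x)) refl c e f (c ⁻¹) x ⟩
        (c * c ⁻¹) * ((e * f) * x)      ≈⟨ *-cong (*-inverseʳ (∈𝒪ˣ⇒≉0 c∈𝒪ˣ)) (*-congʳ e*f≈1) ⟩
        1# * (1# * x)                   ≈⟨ solve 1 (λ x → :1 :* (:1 :* x) := x) refl x ⟩
        x                               ∎
        where
        open SetoidReasoning setoid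
        x : Carrier
        x = ξ^σ⟨ h ⟩ - ξ⟨ h ⟩

    ≤v-c⁻¹β : ∀ {n h} → [ n ] ≤∞ v (β h) → [ n ] ≤∞ v (c ⁻¹ * β h)
    ≤v-c⁻¹β = ≤v-𝒪* (∈𝒪ˣ⇒∈𝒪 c⁻¹∈𝒪ˣ)

    abstract
      ξ̄≋ξ̄^σ : ξ̄ ≋ ξ̄ ^σ
      ξ̄≋ξ̄^σ h = ≡-sym (≤v-resp (ξ^σ-ξ≈ h) (≤v-𝒪* (≤v-c⁻¹β (β∈𝒪 h)) e∈𝔪))

      φ̄₂₁≈0 : ∀ g → e₂₁ (ρ φ̄ g) k.≈ k.0#
      φ̄₂₁≈0 g = ∈𝔪⇒≡0 (≤v-resp (sym (φ₂₁ g)) (cosetwise∈𝔪 g))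
        where
        cosetwise∈𝔪 : ∀ g → cosetwise (λ _ → 0#) (λ h → e * ξ⟨ σ⟨ h ⟩σ ⟩) g ∈𝔪
        cosetwise∈𝔪 g with coset g
        ... | inj₁ _ = ≡0⇒∈𝔪 (≈⇒≡̄ refl)
        ... | inj₂ _ = e* ξ∈𝒪 _ ∈𝔪

    φ̄-reducible : Reducible φ̄
    φ̄-reducible = triangular-reducible φ̄ φ̄₂₁≈0 k.1≉0

    φ̄-H : ∀ h → ρ φ̄ (proj₁ h) ≈ᴹ mat (ξ⟨ h ⟩ , ξ∈𝒪 h) (β h , β∈𝒪 h) k.0# (ξ⟨ h ⟩ , ξ∈𝒪 h)
    φ̄-H h = let (p , q , r , t) = φ-H h in
      ≈⇒≡̄ p , ≈⇒≡̄ q , ≈⇒≡̄ r , ≡-trans (≈⇒≡̄ t) (≡-sym (ξ̄≋ξ̄^σ h))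

    decomposable-H⇒β∈𝔪 : Decomposableᴴ (φ̄ |H) → ∀ h → β h ∈𝔪
    decomposable-H⇒β∈𝔪 D h = ≡0⇒∈𝔪 (unipotent-decomposable subgroup {φ̄ |H} {ξ⟨ h ⟩ , ξ∈𝒪 h} {β h , β∈𝒪 h} h (φ̄-H h) D)

    decomposable⇒decomposable-H : Decomposable φ̄ → Decomposableᴴ (φ̄ |H)
    decomposable⇒decomposable-H D = record
      { S = restrict S ; T = restrict T
      ; S-nonzero = S-nonzero ; T-nonzero = T-nonzero
      ; S∩T≈0 = S∩T≈0 ; S+T = S+T
      }
      where
      open Decomposable D
      restrict : Subrepresentation φ̄ → Representations.Subrepresentation subgroup k.commutativeRing (φ̄ |H)
      restrict S = record
        { _∈S = _∈S ; ∈-resp = ∈-resp ; 0∈ = 0∈ ; +∈ = +∈ ; *∈ = *∈ ; ρ∈ = λ h → ρ∈ (proj₁ h) }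
        where open Subrepresentation S

    θ₁ θ₂ : Character G k.commutativeRing
    θ₁ = diagonal₁ φ̄ φ̄₂₁≈0
    θ₂ = diagonal₂ φ̄ φ̄₂₁≈0

    θ₁-reduction : IsReductionOf valuation θ₁ (cosetwise ξ⟨_⟩ (λ h → c * ξ⟨ σ⟨ h ⟩σ ⟩))
    θ₁-reduction g = ≈⇒≡̄ (sym (φ₁₁ g))

    θ₂-reduction : IsReductionOf valuation θ₂ (cosetwise ξ^σ⟨_⟩ (λ h → - c * ξ⟨ σ⟨ h ⟩σ ⟩))
    θ₂-reduction g = ≈⇒≡̄ (sym (φ₂₂ g))

    cs≢-cs : ¬ (c * s ≡ - (c * s) mod𝔪^ 1)
    cs≢-cs = x≉-x {c * s , *-∈𝒪 c∈𝒪 (ξ∈𝒪 σ²)} 2≢0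
      (*-≉0 {c , c∈𝒪} {s , ξ∈𝒪 σ²} (∈𝒪ˣ⇒∉𝔪 c∈𝒪ˣ ∘ ≡0⇒∈𝔪) (ξ≉0 ξ̄ σ²))

    β∈𝔪⇒φ̄-splits : (∀ h → β h ∈𝔪) → φ̄ ≅ θ₁ ⊕ θ₂
    β∈𝔪⇒φ̄-splits β∈𝔪 = triangular-splits φ̄ φ̄₂₁≈0
      (λ h → let (p , q , _ , t) = φ̄-H h in ≡-trans q (∈𝔪⇒≡0 (β∈𝔪 h)) , ≡-trans p (≡-sym t))
      (λ p → cs≢-cs (≡-trans (≡-sym (≈⇒≡̄ (proj₁ φ-σ))) (≡-trans p
        (≈⇒≡̄ (trans (φ-σ .proj₂ .proj₂ .proj₂) (solve 2 (λ c s → (:- c) :* s := :- (c :* s)) refl c s))))))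

    β∈𝔪⇒φ̄-decomposable : (∀ h → β h ∈𝔪) → Decomposable φ̄
    β∈𝔪⇒φ̄-decomposable β∈𝔪 = decomposable-≅ {θ₁ ⊕ θ₂} {φ̄}
      (≅-sym {φ̄} {θ₁ ⊕ θ₂} (β∈𝔪⇒φ̄-splits β∈𝔪)) (⊕-decomposable θ₁ θ₂ k.1≉0)

    module _ (i : ℕ) where

      -- β(h) is the product of b/d and ξ^σ(h) - ξ(h), and the lower bounds on their valuations add
      -- up to (1 - i) + i = 1.
      bound⇒β∈𝔪 : (∀ h → ξ⟨ h ⟩ ≡ ξ^σ⟨ h ⟩ mod𝔪^ i) →
                  [ + 1 ℤ.- + i ] ≤∞ v (b * d ⁻¹) → ∀ h → β h ∈𝔪
      bound⇒β∈𝔪 ξ≡ξ^σ bound h = ≡.subst (λ n → [ n ] ≤∞ v (β h))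
        (AbelianGroupProperties.//-rightDividesˡ ℤₚ.+-0-abelianGroup (+ i) (+ 1))
        (≤v-* (≤v-resp b/d≈c*f bound) (≡-sym (ξ≡ξ^σ h)))

      β∈𝔪⇒bound : (∀ j → (∀ h → ξ⟨ h ⟩ ≡ ξ^σ⟨ h ⟩ mod𝔪^ j) → j ≤ i) →
                  (∀ h → β h ∈𝔪) → [ + 1 ℤ.- + i ] ≤∞ v (b * d ⁻¹)
      β∈𝔪⇒bound maximal β∈𝔪 = let (m , ve≡m) = v-finite (FieldProperties.x*y≈1⇒x≉0 K e*f≈1) in
        ≤v-resp (sym b/d≈c*f) (≤∞-trans Supremum.[ 1-i≤-m (≡.subst ([ + 1 ] ≤∞_) ve≡m e∈𝔪) ve≡m ]
            (≤v-* (∈𝒪ˣ⇒∈𝒪 c∈𝒪ˣ) (≡⇒≤∞ (≡.sym (v-inverse e*f≈1 ve≡m)))))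
        where
        1-i≤-m : ∀ {m} → [ + 1 ] ≤∞ [ m ] → v e ≡ [ m ] → + 1 ℤ.- + i ℤ.≤ + 0 ℤ.+ ℤ.- m
        -- With v(e) = `suc m` the congruence reaches the exponent 1 + v(e) = `suc (suc m)`, so
        -- maximality bounds this by i. Negating and adding 1 gives 1 - i ≤ -v(e); the summand `+ 0`
        -- on the right is the lower bound for v(c).
        1-i≤-m {+ suc m} _ ve≡m = ℤₚ.+-monoʳ-≤ (+ 1) (ℤₚ.neg-mono-≤ (ℤ.+≤+ (maximal (suc (suc m)) λ h →
          ≡-sym (≤v-resp (ξ^σ-ξ≈ h) (≤v-* (≤v-c⁻¹β (β∈𝔪 h)) (≡⇒≤∞ (≡.sym ve≡m)))))))
        1-i≤-m {+ 0}      Supremum.[ ℤ.+≤+ () ] _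
        1-i≤-m { -[1+ _ ]} Supremum.[ () ] _

  private
    e-cases : e ∈𝒪ˣ ⊎ e ∈𝔪
    e-cases = ∈𝒪⇒∈𝒪ˣ⊎∈𝔪 e∈𝒪

  -- The contradiction comes from the invariant line of Ind ξ̄ when `e` is a unit, and from the
  -- integrality of ρ(h) when `e` is in 𝔪.
  φ̄-irreducible : ¬ (ξ̄ ≋ ξ̄ ^σ) → Irreducible φ̄
  φ̄-irreducible ξ̄≢ξ̄^σ φ̄-reducible = Sum.[ (λ e∈𝒪ˣ → ξ̄≢ξ̄^σ (proj₁ (Unit.reducible⇒ e∈𝒪ˣ φ̄-reducible)))
                                          , (λ e∈𝔪 → ξ̄≢ξ̄^σ (Nonunit.ξ̄≋ξ̄^σ e∈𝔪)) ] e-cases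

  -- For a unit `e` the reduced square root splits Ind ξ̄; for `e` in 𝔪 the triangular shape
  -- exhibits an invariant line.
  ξ̄≋ξ̄^σ⇒reducible : SquareRoot → ξ̄ ≋ ξ̄ ^σ → Reducible φ̄
  ξ̄≋ξ̄^σ⇒reducible r ξ̄≋ξ̄^σ = from-cases e-cases
    where
    from-cases : e ∈𝒪ˣ ⊎ e ∈𝔪 → Reducible φ̄
    from-cases (inj₁ e∈𝒪ˣ) = decomposable⇒reducible {φ̄} (Unit.φ̄-decomposable e∈𝒪ˣ ξ̄≋ξ̄^σ (r̄ r) (r̄²≈s r))
    from-cases (inj₂ e∈𝔪)  = Nonunit.φ̄-reducible e∈𝔪

  unit-case : Reducible φ̄ → (d * a ⁻¹) ∈𝒪ˣ →
    φ̄ ≅ Ind ξ̄ × Decomposable φ̄ ×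
    (((r , _) : SquareRoot) →
      Σ[ θ̄₁ ∈ Character G k.commutativeRing ] Σ[ θ̄₂ ∈ Character G k.commutativeRing ]
        IsReductionOf valuation θ̄₁ (cosetwise ξ⟨_⟩ (λ h → r * ξ⟨ h ⟩)) ×
        IsReductionOf valuation θ̄₂ (cosetwise ξ⟨_⟩ (λ h → - r * ξ⟨ h ⟩)) ×
        φ̄ ≅ θ̄₁ ⊕ θ̄₂)
  -- Two roots are at work: decomposability uses the residual one obtained from the invariant line,
  -- while the named characters use the reduction of the given root in K.
  unit-case φ̄-reducible e∈𝒪ˣ = φ̄≅Ind , φ̄-decomposable ξ̄≋ξ̄^σ (proj₁ root) (proj₂ root) , λ r →
    θ₁ ξ̄≋ξ̄^σ (r̄ r) (r̄²≈s r) , θ₂ ξ̄≋ξ̄^σ (r̄ r) (r̄²≈s r) ,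
    θ₁-reduction ξ̄≋ξ̄^σ r , θ₂-reduction ξ̄≋ξ̄^σ r , φ̄-splits ξ̄≋ξ̄^σ (r̄ r) (r̄²≈s r)
    where
    open Unit e∈𝒪ˣ
    ξ̄≋ξ̄^σ : ξ̄ ≋ ξ̄ ^σ
    ξ̄≋ξ̄^σ = proj₁ (reducible⇒ φ̄-reducible)
    root : Σ[ t ∈ k.Carrier ] t k.* t k.≈ (s , ξ∈𝒪 σ²)
    root = proj₂ (reducible⇒ φ̄-reducible)

  -- Every condition is compared with the vanishing of β modulo 𝔪. The implications close up in a
  -- circle: decomposable, decomposable on `H`, β in 𝔪, split into θ₁ and θ₂.
  nonunit-case : (i : ℕ) →
    (∀ h → ξ⟨ h ⟩ ≡ ξ^σ⟨ h ⟩ mod𝔪^ i) →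
    (∀ j → (∀ h → ξ⟨ h ⟩ ≡ ξ^σ⟨ h ⟩ mod𝔪^ j) → j ≤ i) →
    (d * a ⁻¹) ∈𝔪 →
    (Decomposable φ̄ ⇔ [ + 1 ℤ.- + i ] ≤∞ v (b * d ⁻¹)) ×
    (Decomposable φ̄ ⇔ Decomposableᴴ (φ̄ |H)) ×
    (Decomposable φ̄ →
      Σ[ θ̄₁ ∈ Character G k.commutativeRing ] Σ[ θ̄₂ ∈ Character G k.commutativeRing ]
        IsReductionOf valuation θ̄₁ (cosetwise ξ⟨_⟩ (λ h → (b * a ⁻¹) * ξ⟨ σ⟨ h ⟩σ ⟩)) ×
        IsReductionOf valuation θ̄₂ (cosetwise ξ^σ⟨_⟩ (λ h → - (b * a ⁻¹) * ξ⟨ σ⟨ h ⟩σ ⟩)) ×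
        φ̄ ≅ θ̄₁ ⊕ θ̄₂)
  nonunit-case i ξ≡ξ^σ maximal e∈𝔪 =
    mk⇔ (β∈𝔪⇒bound i maximal ∘ decomposable⇒β∈𝔪) (β∈𝔪⇒φ̄-decomposable ∘ bound⇒β∈𝔪 i ξ≡ξ^σ) ,
    mk⇔ decomposable⇒decomposable-H (β∈𝔪⇒φ̄-decomposable ∘ decomposable-H⇒β∈𝔪) ,
    λ D → θ₁ , θ₂ , θ₁-reduction , θ₂-reduction , β∈𝔪⇒φ̄-splits (decomposable⇒β∈𝔪 D)
    where
    open Nonunit e∈𝔪
    decomposable⇒β∈𝔪 : Decomposable φ̄ → ∀ h → β h ∈𝔪
    decomposable⇒β∈𝔪 = decomposable-H⇒β∈𝔪 ∘ decomposable⇒decomposable-H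

theorem2p10 :
  (p ℓ : ℕ) → Prime p → Prime ℓ → p ≢ 2 → ℓ ≢ 2 → p ≢ ℓ →
  (F : PAdicField p) (Ω/F : AlgebraicClosure (PAdicField.𝔽 F)) (W_F : WeilGroup F Ω/F) →
  (K : PAdicField ℓ) →
  let open WeilGroup W_F using (group)
      open PAdicField K
      open Matrices commutativeRing
  in
  (ρ : Representation group commutativeRing) →
  (ρ-integral : IsIntegral valuation ρ) →
  (S : NonexceptionalSupercuspidal W_F K ρ) →
  let open NonexceptionalSupercuspidal S
      k = residueRing valuation
      open Induction index2 k
      open Representations group k hiding (Character)
      open Representations subgroup k using () renaming (_≋_ to _≋ᴴ_)
      U = proj₁ ρ≅Ind
      ρ̄ = reduction valuation ρ ρ-integral
  in
  (a b d : Carrier) → GL₂.matrix U ≈ᴹ mat a b 0# d →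
  (i : ℕ) →
  (∀ h → ξ⟨ h ⟩ ≡ ξ^σ⟨ h ⟩ mod𝔪^ i) →
  (∀ j → (∀ h → ξ⟨ h ⟩ ≡ ξ^σ⟨ h ⟩ mod𝔪^ j) → j ≤ i) →
  Σ[ ξ̄ ∈ Character subgroup k ]
    IsReductionOf valuation ξ̄ ξ⟨_⟩ ×
    (¬ (ξ̄ ≋ᴴ ξ̄ ^σ) → Irreducible ρ̄) ×
    (SquareRoot → Irreducible ρ̄ → ¬ (ξ̄ ≋ᴴ ξ̄ ^σ)) ×
    (Reducible ρ̄ →
      ((d * a ⁻¹) ∈𝒪ˣ →
        ρ̄ ≅ Ind ξ̄ ×
        Decomposable ρ̄ ×
        (((r , _) : SquareRoot) →
          Σ[ θ̄₁ ∈ Character group k ] Σ[ θ̄₂ ∈ Character group k ]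
            IsReductionOf valuation θ̄₁ (cosetwise ξ⟨_⟩ (λ h → r * ξ⟨ h ⟩)) ×
            IsReductionOf valuation θ̄₂ (cosetwise ξ⟨_⟩ (λ h → - r * ξ⟨ h ⟩)) ×
            ρ̄ ≅ θ̄₁ ⊕ θ̄₂)) ×
      ((d * a ⁻¹) ∈𝔪 →
        (Decomposable ρ̄ ⇔ [ + 1 ℤ.- + i ] ≤∞ v (b * d ⁻¹)) ×
        (Decomposable ρ̄ ⇔ Representations.Decomposable subgroup k (ρ̄ |H)) ×
        (Decomposable ρ̄ →
          Σ[ θ̄₁ ∈ Character group k ] Σ[ θ̄₂ ∈ Character group k ]
            IsReductionOf valuation θ̄₁ (cosetwise ξ⟨_⟩ (λ h → (b * a ⁻¹) * ξ⟨ σ⟨ h ⟩σ ⟩)) ×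
            IsReductionOf valuation θ̄₂ (cosetwise ξ^σ⟨_⟩ (λ h → - (b * a ⁻¹) * ξ⟨ σ⟨ h ⟩σ ⟩)) ×
            ρ̄ ≅ θ̄₁ ⊕ θ̄₂)))
theorem2p10 p ℓ _ ℓ-prime _ ℓ≢2 _ F Ω/F W_F K ρ ρ-integral S a b d U≈ i ξ≡ξ^σ maximal =
  ξ̄ , ξ̄-reduction , φ̄-irreducible , (λ r irreducible → irreducible ∘ ξ̄≋ξ̄^σ⇒reducible r) ,
  λ φ̄-reducible → unit-case φ̄-reducible , nonunit-case i ξ≡ξ^σ maximal
  where
  open NonexceptionalSupercuspidal S using (index2; ξ; ρ≅Ind)
  open Reduction index2 (PAdicField.valuation K) (2-unit ℓ-prime ℓ≢2 K) ρ ρ-integral ξ ρ≅Ind U≈
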